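{- Let $q\ge 89$ be a prime power such that $3$ is not a square in $\mathbb{F}_q$. Then the track $$\{(1,t,t^2,t^3,t^4)\mid t\in \mathbb{F}_q\} \cup \{(0,1,2t,3t^2,4t^3) \mid t\in \mathbb{F}_q\} \cup \{(0,0,0,0,1)\}\subseteq \mathbb{P}^4(\mathbb{F}_q)$$ is complete.
   Context: Points of $\mathbb{P}^4(\mathbb{F}_q)$ are written in homogeneous coordinates $(x_0,x_1,x_2,x_3,x_4)$. A track in $\mathbb{P}^4(\mathbb{F}_q)$ is a set of points no four distinct of which lie on a common plane (a $2$-dimensional projective subspace). A track is complete if it is not a proper subset of a larger track in $\mathbb{P}^4(\mathbb{F}_q)$. (The given set is a track under the stated hypothesis on $3$.) -}

module Defs where

open import Level using (Level; _⊔_) renaming (suc to lsuc)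
open import Data.Nat using (ℕ) renaming (suc to sucℕ; _^_ to _^ℕ_)
open import Data.Nat.Primality using (Prime)
open import Data.Fin using (Fin; zero; suc)
open import Data.Product using (Σ; ∃; _×_; _,_)
open import Data.Sum using (_⊎_)
open import Relation.Nullary using (¬_)
open import Relation.Binary.PropositionalEquality using (_≡_)
import Relation.Binary.PropositionalEquality as ≡
open import Algebra.Bundles using (CommutativeRing)
open import Function.Bundles using (Bijection)

record Field (c ℓ : Level) : Set (lsuc (c ⊔ ℓ)) where
  field
    commutativeRing : CommutativeRing c ℓ
  open CommutativeRing commutativeRing public
  field
    1≉0     : ¬ (1# ≈ 0#)
    inverse : ∀ x → ¬ (x ≈ 0#) → ∃ λ y → (x * y) ≈ 1#

IsPrimePower : ℕ → Set
IsPrimePower q = Σ ℕ λ p → Σ ℕ λ k → Prime p × q ≡ p ^ℕ sucℕ k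

HasCardinality : ∀ {c ℓ} → Field c ℓ → ℕ → Set (c ⊔ ℓ)
HasCardinality F q = Bijection (≡.setoid (Fin q)) (Field.setoid F)

module Projective {c ℓ} (F : Field c ℓ) where
  open Field F

  V5 : Set c
  V5 = Fin 5 → Carrier

  vec : Carrier → Carrier → Carrier → Carrier → Carrier → V5
  vec a b d e f zero = a
  vec a b d e f (suc zero) = b
  vec a b d e f (suc (suc zero)) = d
  vec a b d e f (suc (suc (suc zero))) = e
  vec a b d e f (suc (suc (suc (suc zero)))) = f

  _≋_ : V5 → V5 → Set ℓ
  v ≋ w = ∀ i → v i ≈ w i

  IsZeroVec : V5 → Set ℓ
  IsZeroVec v = ∀ i → v i ≈ 0#

  _∼_ : V5 → V5 → Set (c ⊔ ℓ)
  v ∼ w = ∃ λ λ' → ¬ (λ' ≈ 0#) × (∀ i → v i ≈ (λ' * w i))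

  lin3 : Carrier → Carrier → Carrier → V5 → V5 → V5 → V5
  lin3 a b d u v w i = ((a * u i) + (b * v i)) + (d * w i)

  LinIndep3 : V5 → V5 → V5 → Set (c ⊔ ℓ)
  LinIndep3 u v w = ∀ a b d → IsZeroVec (lin3 a b d u v w) → (a ≈ 0#) × (b ≈ 0#) × (d ≈ 0#)

  -- a plane of P^4 is the projectivisation of a 3-dim subspace span(u,v,w), u,v,w independent;
  -- the point [p] lies on it iff p ∈ span(u,v,w)
  OnPlane : V5 → V5 → V5 → V5 → Set (c ⊔ ℓ)
  OnPlane u v w p = ∃ λ a → ∃ λ b → ∃ λ d → p ≋ lin3 a b d u v w

  OnCommonPlane : V5 → V5 → V5 → V5 → Set (c ⊔ ℓ)
  OnCommonPlane p₁ p₂ p₃ p₄ = ∃ λ u → ∃ λ v → ∃ λ w →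
    LinIndep3 u v w × OnPlane u v w p₁ × OnPlane u v w p₂ × OnPlane u v w p₃ × OnPlane u v w p₄

  -- a set of points of P^4, given by a predicate on representative vectors
  PointSet : (s : Level) → Set (c ⊔ lsuc s)
  PointSet s = V5 → Set s

  _∈ₚ_ : ∀ {s} → V5 → PointSet s → Set (c ⊔ ℓ ⊔ s)
  p ∈ₚ S = ∃ λ w → S w × (p ∼ w)

  _⊆ₚ_ : ∀ {s t} → PointSet s → PointSet t → Set (c ⊔ ℓ ⊔ s ⊔ t)
  S ⊆ₚ T = ∀ p → ¬ IsZeroVec p → p ∈ₚ S → p ∈ₚ T

  IsTrack : ∀ {s} → PointSet s → Set (c ⊔ ℓ ⊔ s)
  IsTrack S =
    (∀ v → S v → ¬ IsZeroVec v) ×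
    (∀ p₁ p₂ p₃ p₄ → p₁ ∈ₚ S → p₂ ∈ₚ S → p₃ ∈ₚ S → p₄ ∈ₚ S →
      ¬ (p₁ ∼ p₂) → ¬ (p₁ ∼ p₃) → ¬ (p₁ ∼ p₄) →
      ¬ (p₂ ∼ p₃) → ¬ (p₂ ∼ p₄) → ¬ (p₃ ∼ p₄) →
      ¬ OnCommonPlane p₁ p₂ p₃ p₄)

  IsCompleteTrack : ∀ {s} → PointSet s → Set (c ⊔ ℓ ⊔ lsuc s)
  IsCompleteTrack {s} S = IsTrack S × (∀ (T : PointSet s) → IsTrack T → S ⊆ₚ T → T ⊆ₚ S)

  two three four : Carrier
  two = 1# + 1#
  three = two + 1#
  four = three + 1#

  theSet : PointSet (c ⊔ ℓ)
  theSet v =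
    (∃ λ t → v ≋ vec 1# t (t * t) (t * (t * t)) (t * (t * (t * t))))
    ⊎ ((∃ λ t → v ≋ vec 0# 1# (two * t) (three * (t * t)) (four * (t * (t * t))))
    ⊎ (v ≋ vec 0# 0# 0# 0# 1#))

ThreeIsSquare : ∀ {c ℓ} → Field c ℓ → Set (c ⊔ ℓ)
ThreeIsSquare F = ∃ λ x → (x * x) ≈ ((1# + 1#) + 1#)
  where open Field F

{-# OPTIONS --safe #-}
-- For a point p = (1, 0, b, c, d) (the general affine point, after a translation) one looks for a plane through
-- p, one curve point ⟪ curve s ⟫ and two points at infinity.  Such a plane exists when the projection of p from
-- ⟪ curve s ⟫ to the hyperplane x₀ = 0 lies on a rational chord of the twisted cubic traced out there, that is,
-- when 3 F(s) is a nonzero square for a certain monic polynomial F of degree 10.  If this fails for all s then,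
-- 3 being a nonsquare, F(s)^((q−1)/2) ∈ {0, 1} for all s.  Instead of Weil's bound for the genus 4 curve
-- y² = F(s), a Stepanov argument with an explicit auxiliary polynomial then shows that F is a constant times a
-- square: with X = s^q − s and T the truncation at order 5 in X of F(s)⁵ √(F(s + X) / F(s)), the polynomial
-- F (F^((q−1)/2 + 5) − T) has degree below 6q but vanishes to order 6 at every s, so it is zero, and squaring
-- F^((q−1)/2 + 5) = T turns the truncated expansion into an exact one.  Comparing coefficients, F is a constant
-- times a square only for b = c = d = 0.

module Submission where

-- The order 5 is the least that works: `F^((q−1)/2 + n)` has degree about 5q, and q zeros of order
-- n + 1 outnumber it only if n + 1 > 5. The extra factor F serves the zeros of F: F T is
-- homogeneous of degree 6 in F and X, and both vanish there. At the other points the conjugate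
-- factor `F^((q−1)/2 + 5) + T` is nonzero. The bound on q comes from the last step. Since F^(q+9) =
-- F⁹ F(s + X), the equation F^(q+9) = T² leaves a relation among the terms X⁶, ..., X¹⁰, and their
-- coefficients can be compared one by one only when their degrees are below q. Plain counting gives
-- 94; comparison with the square of the polynomial part of √F gives 88, hence 89. Afterwards X may
-- be any variable, in particular z - s at a fixed s with F(s) ≠ 0. Characteristics 5 and 7 may
-- occur, so Taylor coefficients are Hasse derivatives, and integers are cancelled only if they are
-- products of 2 and 3. For the track property, points are read as functionals on quartic
-- polynomials: evaluation at t, derivative at t, leading coefficient. Only two evaluations with two
-- derivatives could be dependent, and then 3 would be a square.

open import Defs
open import Level using (Level; _⊔_; 0ℓ; Lift; lift)
open import Algebra.Bundles using (CommutativeRing)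
open import Data.Bool.Base using (Bool; true; false)
open import Data.Empty using (⊥; ⊥-elim)
open import Data.Fin.Base using (Fin; zero; suc; punchIn)
import Data.Fin.Properties as Fin
open import Data.Fin.Permutation using (Permutation; permutation)
open import Data.Integer.Base as ℤ using (ℤ; +_; -[1+_])
import Data.Integer.Properties as ℤ
open import Data.List.Base using (List; []; _∷_; map; length; tabulate)
open import Data.List.Properties using (length-tabulate)
open import Data.List.Relation.Unary.All using (All; []; _∷_)
import Data.List.Relation.Unary.All.Properties as All
open import Data.List.Relation.Unary.AllPairs using (AllPairs; []; _∷_)
import Data.List.Relation.Unary.AllPairs.Properties as AllPairs
open import Data.Maybe.Base using (nothing)
open import Data.Nat using (ℕ; _≥_)
open import Data.Nat.Base as ℕ using (zero; suc)
import Data.Nat.Properties as ℕ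
open import Data.Nat.Tactic.RingSolver using (solve-∀)
open import Data.Product using (_,_; _×_; ∃; proj₁; proj₂)
open import Data.Sum using (_⊎_; inj₁; inj₂)
open import Data.Unit.Base using (⊤; tt)
open import Data.Vec.Base using (Vec)
open import Data.Vec.Functional using (insertAt)
open import Data.Vec.Functional.Properties using (insertAt-lookup; insertAt-punchIn)
open import Function.Bundles using (Bijection)
open import Relation.Binary.Bundles using (Setoid)
import Relation.Binary.PropositionalEquality as ≡
open ≡ using (_≡_)
open import Relation.Nullary using (¬_; Dec; yes; no; ¬?)
open import Relation.Nullary.Decidable using (_×-dec_)
open import Tactic.RingSolver.Core.AlmostCommutativeRing using (AlmostCommutativeRing; fromCommutativeRing)
open import Tactic.RingSolver.Core.Expression using (Expr; Κ; Ι; _⊕_; _⊗_; _⊛_; ⊝_)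
open import Tactic.RingSolver.Core.Polynomial.Parameters using (Homomorphism)

-- Over an abstract ring the library's solver cannot compute with numerals, so it is instantiated with
-- coefficients in ℤ.
module IntegerSolver {c ℓ} (R : CommutativeRing c ℓ) where
  open CommutativeRing R
  open import Algebra.Properties.Ring ring using (-0#≈0#; -‿distribˡ-*; -‿distribʳ-*; -‿involutive)
  open import Algebra.Properties.AbelianGroup +-abelianGroup using (⁻¹-∙-comm)
  open import Algebra.Properties.Semiring.Mult.TCOptimised semiring using (×1-homo-*; ×-homo-+)
    renaming (_×_ to _×′_)
  open import Relation.Binary.Reasoning.Setoid setoid

  almost : AlmostCommutativeRing c ℓ
  almost = fromCommutativeRing R (λ _ → nothing)
  module A = AlmostCommutativeRing almost
  open import Algebra.Properties.Semiring.Exp.TCOptimised A.semiring using (^-congˡ)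

  ⟦_⟧ℤ : ℤ → Carrier
  ⟦ + n ⟧ℤ = n ×′ 1#
  ⟦ -[1+ n ] ⟧ℤ = - (suc n ×′ 1#)

  neg-homo : ∀ i → ⟦ ℤ.- i ⟧ℤ ≈ - ⟦ i ⟧ℤ
  neg-homo (+ zero) = sym -0#≈0#
  neg-homo (+ suc n) = refl
  neg-homo -[1+ n ] = sym (-‿involutive _)

  ⊖-homo : ∀ m n → ⟦ m ℤ.⊖ n ⟧ℤ ≈ (m ×′ 1#) + - (n ×′ 1#)
  ⊖-homo m zero = trans (sym (+-identityʳ _)) (+-cong refl (sym -0#≈0#))
  ⊖-homo zero (suc n) = sym (+-identityˡ _)
  ⊖-homo (suc m) (suc n) = begin
    ⟦ suc m ℤ.⊖ suc n ⟧ℤ ≡⟨ ≡.cong ⟦_⟧ℤ (ℤ.[1+m]⊖[1+n]≡m⊖n m n) ⟩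
    ⟦ m ℤ.⊖ n ⟧ℤ ≈⟨ ⊖-homo m n ⟩
    (m ×′ 1#) + - (n ×′ 1#) ≈⟨ cancel (m ×′ 1#) (n ×′ 1#) ⟨
    (1# + m ×′ 1#) + - (1# + n ×′ 1#) ≈⟨ +-cong (×-homo-+ 1# 1 m) (-‿cong (×-homo-+ 1# 1 n)) ⟨
    (suc m ×′ 1#) + - (suc n ×′ 1#) ∎
    where
    cancel : ∀ a b → (1# + a) + - (1# + b) ≈ a + - b
    cancel a b = begin
      (1# + a) + - (1# + b) ≈⟨ +-cong (+-comm _ _) (sym (⁻¹-∙-comm _ _)) ⟩
      (a + 1#) + (- 1# + - b) ≈⟨ +-assoc _ _ _ ⟩
      a + (1# + (- 1# + - b)) ≈⟨ +-congˡ (sym (+-assoc _ _ _)) ⟩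
      a + ((1# + - 1#) + - b) ≈⟨ +-congˡ (+-congʳ (-‿inverseʳ _)) ⟩
      a + (0# + - b) ≈⟨ +-congˡ (+-identityˡ _) ⟩
      a + - b ∎

  +-homo : ∀ i j → ⟦ i ℤ.+ j ⟧ℤ ≈ ⟦ i ⟧ℤ + ⟦ j ⟧ℤ
  +-homo (+ m) (+ n) = ×-homo-+ 1# m n
  +-homo (+ m) -[1+ n ] = ⊖-homo m (suc n)
  +-homo -[1+ m ] (+ n) = trans (⊖-homo n (suc m)) (+-comm _ _)
  +-homo -[1+ m ] -[1+ n ] = begin
    - (suc (suc (m ℕ.+ n)) ×′ 1#) ≡⟨ ≡.cong (λ k → - (k ×′ 1#)) (≡.cong suc (≡.sym (ℕ.+-suc m n))) ⟩
    - ((suc m ℕ.+ suc n) ×′ 1#) ≈⟨ -‿cong (×-homo-+ 1# (suc m) (suc n)) ⟩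
    - ((suc m ×′ 1#) + (suc n ×′ 1#)) ≈⟨ ⁻¹-∙-comm _ _ ⟨
    - (suc m ×′ 1#) + - (suc n ×′ 1#) ∎

  *-homo : ∀ i j → ⟦ i ℤ.* j ⟧ℤ ≈ ⟦ i ⟧ℤ * ⟦ j ⟧ℤ
  *-homo (+ m) (+ n) = trans (reflexive (≡.cong ⟦_⟧ℤ (≡.sym (ℤ.pos-* m n)))) (×1-homo-* m n)
  *-homo (+ m) -[1+ n ] = begin
    ⟦ + m ℤ.* -[1+ n ] ⟧ℤ ≡⟨ ≡.cong ⟦_⟧ℤ (ℤ.neg-distribʳ-* (+ m) (+ suc n)) ⟨
    ⟦ ℤ.- (+ m ℤ.* + suc n) ⟧ℤ ≈⟨ neg-homo (+ m ℤ.* + suc n) ⟩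
    - ⟦ + m ℤ.* + suc n ⟧ℤ ≈⟨ -‿cong (*-homo (+ m) (+ suc n)) ⟩
    - (⟦ + m ⟧ℤ * (suc n ×′ 1#)) ≈⟨ -‿distribʳ-* _ _ ⟩
    ⟦ + m ⟧ℤ * - (suc n ×′ 1#) ∎
  *-homo -[1+ m ] j = begin
    ⟦ -[1+ m ] ℤ.* j ⟧ℤ ≡⟨ ≡.cong ⟦_⟧ℤ (ℤ.neg-distribˡ-* (+ suc m) j) ⟨
    ⟦ ℤ.- (+ suc m ℤ.* j) ⟧ℤ ≈⟨ neg-homo (+ suc m ℤ.* j) ⟩
    - ⟦ + suc m ℤ.* j ⟧ℤ ≈⟨ -‿cong (pos j) ⟩
    - ((suc m ×′ 1#) * ⟦ j ⟧ℤ) ≈⟨ -‿distribˡ-* _ _ ⟩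
    - (suc m ×′ 1#) * ⟦ j ⟧ℤ ∎
    where
    pos : ∀ j → ⟦ + suc m ℤ.* j ⟧ℤ ≈ (suc m ×′ 1#) * ⟦ j ⟧ℤ
    pos (+ n) = trans (reflexive (≡.cong ⟦_⟧ℤ (≡.sym (ℤ.pos-* (suc m) n)))) (×1-homo-* (suc m) n)
    pos -[1+ n ] = trans (-‿cong (×1-homo-* (suc m) (suc n))) (-‿distribʳ-* _ _)

  isZero : ℤ → Bool
  isZero (+ zero) = true
  isZero _ = false

  homo : Homomorphism 0ℓ 0ℓ c ℓ
  homo = record
    { from = record { rawRing = ℤ.+-*-rawRing ; isZero = isZero }
    ; to = almost
    ; morphism = record
      { ⟦_⟧ = ⟦_⟧ℤ ; +-homo = +-homo ; *-homo = *-homo ; -‿homo = neg-homo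
      ; 0-homo = refl ; 1-homo = refl }
    ; Zero-C⟶Zero-R = λ { (+ zero) _ → refl }
    }

  open Tactic.RingSolver.Core.Expression.Eval A.rawRing ⟦_⟧ℤ
  open import Tactic.RingSolver.Core.Polynomial.Base (Homomorphism.from homo)
  open import Tactic.RingSolver.Core.Polynomial.Semantics homo renaming (⟦_⟧ to ⟦_⟧ₚ)
  open import Tactic.RingSolver.Core.Polynomial.Homomorphism homo

  norm : ∀ {n} → Expr ℤ n → Poly n
  norm (Κ x) = κ x
  norm (Ι x) = ι x
  norm (x ⊕ y) = norm x ⊞ norm y
  norm (x ⊗ y) = norm x ⊠ norm y
  norm (⊝ x) = ⊟ norm x
  norm (x ⊛ i) = norm x ⊡ i

  ⟦_⇓⟧ : ∀ {n} → Expr ℤ n → Vec Carrier n → Carrier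
  ⟦ e ⇓⟧ = ⟦ norm e ⟧ₚ

  correct : ∀ {n} (e : Expr ℤ n) ρ → ⟦ e ⇓⟧ ρ ≈ ⟦ e ⟧ ρ
  correct (Κ x) ρ = κ-hom x ρ
  correct (Ι x) ρ = ι-hom x ρ
  correct (x ⊕ y) ρ = trans (⊞-hom (norm x) (norm y) ρ) (+-cong (correct x ρ) (correct y ρ))
  correct (x ⊗ y) ρ = trans (⊠-hom (norm x) (norm y) ρ) (*-cong (correct x ρ) (correct y ρ))
  correct (⊝ x) ρ = trans (⊟-hom (norm x) ρ) (-‿cong (correct x ρ))
  correct (x ⊛ i) ρ = trans (⊡-hom (norm x) i ρ) (^-congˡ i (correct x ρ))

  open import Relation.Binary.Reflection setoid Ι ⟦_⟧ ⟦_⇓⟧ correct public using (solve)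

infix 4 _⊜_
_⊜_ : ∀ {n : ℕ} → Expr ℤ n → Expr ℤ n → Expr ℤ n × Expr ℤ n
_⊜_ = _,_

κ : ∀ {n : ℕ} → ℕ → Expr ℤ n
κ k = Κ (+ k)

-- The ring of univariate polynomials.

module Polynomial {c ℓ} (R : CommutativeRing c ℓ) where
  open CommutativeRing R
  open IntegerSolver R using (solve)
  open import Algebra.Properties.Ring ring using (-0#≈0#)
  private
    module ≈-Reasoning where
      open import Relation.Binary.Reasoning.Setoid setoid public

  Poly : Set c
  Poly = List Carrier

  coeff : Poly → ℕ → Carrier
  coeff [] _ = 0#
  coeff (a ∷ p) zero = a
  coeff (a ∷ p) (suc n) = coeff p n

  infix 4 _≈ₚ_
  -- Lists are not normalised and may end in zeros, so equality is coefficientwise. The record keeps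
  -- `p` and `q` visible to unification, which a bare function type would not.
  record _≈ₚ_ (p q : Poly) : Set ℓ where
    constructor coeffwise
    field at : ∀ n → coeff p n ≈ coeff q n
  open _≈ₚ_ public

  infixl 6 _+ₚ_
  infixl 7 _*ₚ_ _·ₚ_

  _+ₚ_ : Poly → Poly → Poly
  [] +ₚ q = q
  (a ∷ p) +ₚ [] = a ∷ p
  (a ∷ p) +ₚ (b ∷ q) = (a + b) ∷ (p +ₚ q)

  -ₚ_ : Poly → Poly
  -ₚ_ = map (λ a → - a)

  _·ₚ_ : Carrier → Poly → Poly
  a ·ₚ p = map (a *_) p

  _*ₚ_ : Poly → Poly → Poly
  [] *ₚ q = []
  (a ∷ p) *ₚ q = (a ·ₚ q) +ₚ (0# ∷ (p *ₚ q))

  polySetoid : Setoid c ℓ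
  polySetoid = record
    { Carrier = Poly ; _≈_ = _≈ₚ_
    ; isEquivalence = record
      { refl = coeffwise λ _ → refl
      ; sym = λ e → coeffwise λ n → sym (at e n)
      ; trans = λ e f → coeffwise λ n → trans (at e n) (at f n) } }
  module ≈ₚ = Setoid polySetoid

  coeff-+ : ∀ p q n → coeff (p +ₚ q) n ≈ coeff p n + coeff q n
  coeff-+ [] q n = sym (+-identityˡ _)
  coeff-+ (a ∷ p) [] n = sym (+-identityʳ _)
  coeff-+ (a ∷ p) (b ∷ q) zero = refl
  coeff-+ (a ∷ p) (b ∷ q) (suc n) = coeff-+ p q n

  coeff-neg : ∀ p n → coeff (-ₚ p) n ≈ - coeff p n
  coeff-neg [] n = sym -0#≈0#
  coeff-neg (a ∷ p) zero = refl
  coeff-neg (a ∷ p) (suc n) = coeff-neg p n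

  coeff-· : ∀ a p n → coeff (a ·ₚ p) n ≈ a * coeff p n
  coeff-· a [] n = sym (zeroʳ a)
  coeff-· a (b ∷ p) zero = refl
  coeff-· a (b ∷ p) (suc n) = coeff-· a p n

  ∷-cong : ∀ {a b p q} → a ≈ b → p ≈ₚ q → a ∷ p ≈ₚ b ∷ q
  ∷-cong e f = coeffwise λ { zero → e ; (suc n) → at f n }

  0∷[] : 0# ∷ [] ≈ₚ []
  0∷[] = coeffwise λ { zero → refl ; (suc n) → refl }

  +ₚ-cong : ∀ {p p′ q q′} → p ≈ₚ p′ → q ≈ₚ q′ → p +ₚ q ≈ₚ p′ +ₚ q′
  +ₚ-cong {p} {p′} {q} {q′} e f = coeffwise λ n →
    trans (coeff-+ p q n) (trans (+-cong (at e n) (at f n)) (sym (coeff-+ p′ q′ n)))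

  -ₚ-cong : ∀ {p q} → p ≈ₚ q → -ₚ p ≈ₚ -ₚ q
  -ₚ-cong {p} {q} e = coeffwise λ n →
    trans (coeff-neg p n) (trans (-‿cong (at e n)) (sym (coeff-neg q n)))

  ·ₚ-cong : ∀ {a b p q} → a ≈ b → p ≈ₚ q → a ·ₚ p ≈ₚ b ·ₚ q
  ·ₚ-cong {a} {b} {p} {q} e f = coeffwise λ n →
    trans (coeff-· a p n) (trans (*-cong e (at f n)) (sym (coeff-· b q n)))

  +ₚ-assoc : ∀ p q r → (p +ₚ q) +ₚ r ≈ₚ p +ₚ (q +ₚ r)
  +ₚ-assoc p q r = coeffwise λ n → begin
    coeff ((p +ₚ q) +ₚ r) n ≈⟨ coeff-+ (p +ₚ q) r n ⟩
    coeff (p +ₚ q) n + coeff r n ≈⟨ +-congʳ (coeff-+ p q n) ⟩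
    coeff p n + coeff q n + coeff r n ≈⟨ +-assoc _ _ _ ⟩
    coeff p n + (coeff q n + coeff r n) ≈⟨ +-congˡ (coeff-+ q r n) ⟨
    coeff p n + coeff (q +ₚ r) n ≈⟨ coeff-+ p (q +ₚ r) n ⟨
    coeff (p +ₚ (q +ₚ r)) n ∎
    where open ≈-Reasoning

  +ₚ-comm : ∀ p q → p +ₚ q ≈ₚ q +ₚ p
  +ₚ-comm p q = coeffwise λ n →
    trans (coeff-+ p q n) (trans (+-comm _ _) (sym (coeff-+ q p n)))

  +ₚ-identityʳ : ∀ p → p +ₚ [] ≈ₚ p
  +ₚ-identityʳ p = +ₚ-comm p []

  -ₚ-inverseʳ : ∀ p → p +ₚ (-ₚ p) ≈ₚ []
  -ₚ-inverseʳ p = coeffwise λ n →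
    trans (coeff-+ p (-ₚ p) n) (trans (+-congˡ (coeff-neg p n)) (-‿inverseʳ _))

  +ₚ-interchange : ∀ p q r s → (p +ₚ q) +ₚ (r +ₚ s) ≈ₚ (p +ₚ r) +ₚ (q +ₚ s)
  +ₚ-interchange p q r s = coeffwise λ n → begin
    coeff ((p +ₚ q) +ₚ (r +ₚ s)) n ≈⟨ coeff-+ (p +ₚ q) (r +ₚ s) n ⟩
    coeff (p +ₚ q) n + coeff (r +ₚ s) n ≈⟨ +-cong (coeff-+ p q n) (coeff-+ r s n) ⟩
    (coeff p n + coeff q n) + (coeff r n + coeff s n)
      ≈⟨ solve 4 (λ a b c d → (a ⊕ b) ⊕ (c ⊕ d) ⊜ (a ⊕ c) ⊕ (b ⊕ d)) refl _ _ _ _ ⟩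
    (coeff p n + coeff r n) + (coeff q n + coeff s n) ≈⟨ +-cong (coeff-+ p r n) (coeff-+ q s n) ⟨
    coeff (p +ₚ r) n + coeff (q +ₚ s) n ≈⟨ coeff-+ (p +ₚ r) (q +ₚ s) n ⟨
    coeff ((p +ₚ r) +ₚ (q +ₚ s)) n ∎
    where open ≈-Reasoning

  ·ₚ-distrib-+ₚ : ∀ a p q → a ·ₚ (p +ₚ q) ≈ₚ a ·ₚ p +ₚ a ·ₚ q
  ·ₚ-distrib-+ₚ a p q = coeffwise λ n → begin
    coeff (a ·ₚ (p +ₚ q)) n ≈⟨ coeff-· a (p +ₚ q) n ⟩
    a * coeff (p +ₚ q) n ≈⟨ *-congˡ (coeff-+ p q n) ⟩
    a * (coeff p n + coeff q n) ≈⟨ distribˡ _ _ _ ⟩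
    a * coeff p n + a * coeff q n ≈⟨ +-cong (coeff-· a p n) (coeff-· a q n) ⟨
    coeff (a ·ₚ p) n + coeff (a ·ₚ q) n ≈⟨ coeff-+ (a ·ₚ p) (a ·ₚ q) n ⟨
    coeff (a ·ₚ p +ₚ a ·ₚ q) n ∎
    where open ≈-Reasoning

  +-distrib-·ₚ : ∀ a b p → (a + b) ·ₚ p ≈ₚ a ·ₚ p +ₚ b ·ₚ p
  +-distrib-·ₚ a b p = coeffwise λ n → begin
    coeff ((a + b) ·ₚ p) n ≈⟨ coeff-· (a + b) p n ⟩
    (a + b) * coeff p n ≈⟨ distribʳ _ _ _ ⟩
    a * coeff p n + b * coeff p n ≈⟨ +-cong (coeff-· a p n) (coeff-· b p n) ⟨
    coeff (a ·ₚ p) n + coeff (b ·ₚ p) n ≈⟨ coeff-+ (a ·ₚ p) (b ·ₚ p) n ⟨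
    coeff (a ·ₚ p +ₚ b ·ₚ p) n ∎
    where open ≈-Reasoning

  ·ₚ-assoc : ∀ a b p → (a * b) ·ₚ p ≈ₚ a ·ₚ (b ·ₚ p)
  ·ₚ-assoc a b p = coeffwise λ n → begin
    coeff ((a * b) ·ₚ p) n ≈⟨ coeff-· (a * b) p n ⟩
    a * b * coeff p n ≈⟨ *-assoc _ _ _ ⟩
    a * (b * coeff p n) ≈⟨ *-congˡ (coeff-· b p n) ⟨
    a * coeff (b ·ₚ p) n ≈⟨ coeff-· a (b ·ₚ p) n ⟨
    coeff (a ·ₚ (b ·ₚ p)) n ∎
    where open ≈-Reasoning

  0·ₚ : ∀ p → 0# ·ₚ p ≈ₚ []
  0·ₚ p = coeffwise λ n → trans (coeff-· 0# p n) (zeroˡ _)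

  1·ₚ : ∀ p → 1# ·ₚ p ≈ₚ p
  1·ₚ p = coeffwise λ n → trans (coeff-· 1# p n) (*-identityˡ _)

  module ≈ₚ-Reasoning where
    open import Relation.Binary.Reasoning.Setoid polySetoid public

  *ₚ-zeroʳ : ∀ p → p *ₚ [] ≈ₚ []
  *ₚ-zeroʳ [] = ≈ₚ.refl
  *ₚ-zeroʳ (a ∷ p) = ≈ₚ.trans (∷-cong refl (*ₚ-zeroʳ p)) 0∷[]

  *ₚ-congˡ : ∀ p {q q′} → q ≈ₚ q′ → p *ₚ q ≈ₚ p *ₚ q′
  *ₚ-congˡ [] e = ≈ₚ.refl
  *ₚ-congˡ (a ∷ p) e = +ₚ-cong (·ₚ-cong refl e) (∷-cong refl (*ₚ-congˡ p e))

  -- `_*ₚ_` recurses on its left factor; this is the mirror recursion on the right factor, from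
  -- which commutativity follows by induction.
  *ₚ-∷ : ∀ q a p → q *ₚ (a ∷ p) ≈ₚ a ·ₚ q +ₚ (0# ∷ q *ₚ p)
  *ₚ-∷ [] a p = ≈ₚ.sym 0∷[]
  *ₚ-∷ (b ∷ q) a p = ∷-cong (+-cong (*-comm b a) refl) (begin
    b ·ₚ p +ₚ q *ₚ (a ∷ p) ≈⟨ +ₚ-cong (≈ₚ.refl {b ·ₚ p}) (*ₚ-∷ q a p) ⟩
    b ·ₚ p +ₚ (a ·ₚ q +ₚ (0# ∷ q *ₚ p)) ≈⟨ +ₚ-assoc (b ·ₚ p) (a ·ₚ q) _ ⟨
    (b ·ₚ p +ₚ a ·ₚ q) +ₚ (0# ∷ q *ₚ p) ≈⟨ +ₚ-cong (+ₚ-comm (b ·ₚ p) (a ·ₚ q)) ≈ₚ.refl ⟩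
    (a ·ₚ q +ₚ b ·ₚ p) +ₚ (0# ∷ q *ₚ p) ≈⟨ +ₚ-assoc (a ·ₚ q) (b ·ₚ p) _ ⟩
    a ·ₚ q +ₚ (b ·ₚ p +ₚ (0# ∷ q *ₚ p)) ∎)
    where open ≈ₚ-Reasoning

  *ₚ-comm : ∀ p q → p *ₚ q ≈ₚ q *ₚ p
  *ₚ-comm [] q = ≈ₚ.sym (*ₚ-zeroʳ q)
  *ₚ-comm (a ∷ p) q = ≈ₚ.trans (+ₚ-cong (≈ₚ.refl {a ·ₚ q}) (∷-cong refl (*ₚ-comm p q))) (≈ₚ.sym (*ₚ-∷ q a p))

  *ₚ-cong : ∀ {p p′ q q′} → p ≈ₚ p′ → q ≈ₚ q′ → p *ₚ q ≈ₚ p′ *ₚ q′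
  *ₚ-cong {p} {p′} {q} {q′} e f = begin
    p *ₚ q ≈⟨ *ₚ-congˡ p f ⟩
    p *ₚ q′ ≈⟨ *ₚ-comm p q′ ⟩
    q′ *ₚ p ≈⟨ *ₚ-congˡ q′ e ⟩
    q′ *ₚ p′ ≈⟨ *ₚ-comm q′ p′ ⟩
    p′ *ₚ q′ ∎
    where open ≈ₚ-Reasoning

  0∷-+ : ∀ p q → 0# ∷ (p +ₚ q) ≈ₚ (0# ∷ p) +ₚ (0# ∷ q)
  0∷-+ p q = ∷-cong (sym (+-identityˡ 0#)) ≈ₚ.refl

  *ₚ-distribʳ : ∀ r p q → (p +ₚ q) *ₚ r ≈ₚ p *ₚ r +ₚ q *ₚ r
  *ₚ-distribʳ r [] q = ≈ₚ.refl
  *ₚ-distribʳ r (a ∷ p) [] = ≈ₚ.sym (+ₚ-identityʳ _)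
  *ₚ-distribʳ r (a ∷ p) (b ∷ q) = begin
    (a + b) ·ₚ r +ₚ (0# ∷ (p +ₚ q) *ₚ r)
      ≈⟨ +ₚ-cong (+-distrib-·ₚ a b r) (∷-cong refl (*ₚ-distribʳ r p q)) ⟩
    (a ·ₚ r +ₚ b ·ₚ r) +ₚ (0# ∷ (p *ₚ r +ₚ q *ₚ r))
      ≈⟨ +ₚ-cong (≈ₚ.refl {a ·ₚ r +ₚ b ·ₚ r}) (0∷-+ (p *ₚ r) (q *ₚ r)) ⟩
    (a ·ₚ r +ₚ b ·ₚ r) +ₚ ((0# ∷ p *ₚ r) +ₚ (0# ∷ q *ₚ r))
      ≈⟨ +ₚ-interchange (a ·ₚ r) (b ·ₚ r) (0# ∷ p *ₚ r) (0# ∷ q *ₚ r) ⟩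
    (a ∷ p) *ₚ r +ₚ (b ∷ q) *ₚ r ∎
    where open ≈ₚ-Reasoning

  0∷-*ₚ : ∀ p q → (0# ∷ p) *ₚ q ≈ₚ 0# ∷ p *ₚ q
  0∷-*ₚ p q = +ₚ-cong (0·ₚ q) ≈ₚ.refl

  ·ₚ-*ₚ : ∀ a p q → (a ·ₚ p) *ₚ q ≈ₚ a ·ₚ (p *ₚ q)
  ·ₚ-*ₚ a [] q = ≈ₚ.refl
  ·ₚ-*ₚ a (b ∷ p) q = begin
    (a * b) ·ₚ q +ₚ (0# ∷ (a ·ₚ p) *ₚ q)
      ≈⟨ +ₚ-cong (·ₚ-assoc a b q) (∷-cong (sym (zeroʳ a)) (·ₚ-*ₚ a p q)) ⟩
    a ·ₚ (b ·ₚ q) +ₚ a ·ₚ (0# ∷ p *ₚ q) ≈⟨ ·ₚ-distrib-+ₚ a (b ·ₚ q) (0# ∷ p *ₚ q) ⟨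
    a ·ₚ ((b ∷ p) *ₚ q) ∎
    where open ≈ₚ-Reasoning

  *ₚ-assoc : ∀ p q r → (p *ₚ q) *ₚ r ≈ₚ p *ₚ (q *ₚ r)
  *ₚ-assoc [] q r = ≈ₚ.refl
  *ₚ-assoc (a ∷ p) q r = begin
    (a ·ₚ q +ₚ (0# ∷ p *ₚ q)) *ₚ r ≈⟨ *ₚ-distribʳ r (a ·ₚ q) (0# ∷ p *ₚ q) ⟩
    (a ·ₚ q) *ₚ r +ₚ (0# ∷ p *ₚ q) *ₚ r ≈⟨ +ₚ-cong (·ₚ-*ₚ a q r) (0∷-*ₚ (p *ₚ q) r) ⟩
    a ·ₚ (q *ₚ r) +ₚ (0# ∷ (p *ₚ q) *ₚ r) ≈⟨ +ₚ-cong (≈ₚ.refl {a ·ₚ (q *ₚ r)}) (∷-cong refl (*ₚ-assoc p q r)) ⟩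
    (a ∷ p) *ₚ (q *ₚ r) ∎
    where open ≈ₚ-Reasoning

  *ₚ-identityˡ : ∀ p → (1# ∷ []) *ₚ p ≈ₚ p
  *ₚ-identityˡ p = ≈ₚ.trans (+ₚ-cong (1·ₚ p) 0∷[]) (+ₚ-identityʳ p)

  polyRing : CommutativeRing c ℓ
  polyRing = record
    { Carrier = Poly ; _≈_ = _≈ₚ_ ; _+_ = _+ₚ_ ; _*_ = _*ₚ_ ; -_ = -ₚ_ ; 0# = [] ; 1# = 1# ∷ []
    ; isCommutativeRing = record
      { isRing = record
        { +-isAbelianGroup = record
          { isGroup = record
            { isMonoid = record
              { isSemigroup = record
                { isMagma = record { isEquivalence = ≈ₚ.isEquivalence ; ∙-cong = +ₚ-cong }
                ; assoc = +ₚ-assoc }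
              ; identity = (λ _ → ≈ₚ.refl) , +ₚ-identityʳ }
            ; inverse = (λ p → ≈ₚ.trans (+ₚ-comm (-ₚ p) p) (-ₚ-inverseʳ p)) , -ₚ-inverseʳ
            ; ⁻¹-cong = -ₚ-cong }
          ; comm = +ₚ-comm }
        ; *-cong = *ₚ-cong
        ; *-assoc = *ₚ-assoc
        ; *-identity = *ₚ-identityˡ , λ p → ≈ₚ.trans (*ₚ-comm p _) (*ₚ-identityˡ p)
        ; distrib = (λ p q r → ≈ₚ.trans (*ₚ-comm p (q +ₚ r)) (≈ₚ.trans (*ₚ-distribʳ p q r)
            (+ₚ-cong (*ₚ-comm q p) (*ₚ-comm r p)))) , *ₚ-distribʳ
        }
      ; *-comm = *ₚ-comm } }

  C : Carrier → Poly
  C a = a ∷ []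

  var : Poly
  var = 0# ∷ 1# ∷ []

  var-* : ∀ p → var *ₚ p ≈ₚ 0# ∷ p
  var-* p = ≈ₚ.trans (0∷-*ₚ (1# ∷ []) p) (∷-cong refl (*ₚ-identityˡ p))

  ∷≈ : ∀ a p → a ∷ p ≈ₚ C a +ₚ var *ₚ p
  ∷≈ a p = ≈ₚ.trans (∷-cong (sym (+-identityʳ a)) ≈ₚ.refl) (+ₚ-cong (≈ₚ.refl {C a}) (≈ₚ.sym (var-* p)))

-- Evaluation along a ring homomorphism.

module Evaluation {c ℓ} (R : CommutativeRing c ℓ) {a ℓ′} (A : CommutativeRing a ℓ′) where
  private
    module R = CommutativeRing R
    module A = CommutativeRing A
  open Polynomial R
  open CommutativeRing A
  open IntegerSolver A using (solve)
  open import Algebra.Properties.Semiring.Exp.TCOptimised semiring using (_^_; ^-homo-*)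
  open import Algebra.Properties.Semiring.Exp.TCOptimised (CommutativeRing.semiring polyRing) using ()
    renaming (_^_ to _^ₚ_; ^-homo-* to ^ₚ-homo-*)
  open import Relation.Binary.Reasoning.Setoid setoid

  -- The homomorphism lets one set of lemmas serve twice: with the identity it yields values in the
  -- field, with the embedding of constants into polynomials it yields composition.
  record RingHom : Set (c ⊔ ℓ ⊔ a ⊔ ℓ′) where
    field
      ι : R.Carrier → Carrier
      ι-cong : ∀ {x y} → x R.≈ y → ι x ≈ ι y
      ι-+ : ∀ x y → ι (x R.+ y) ≈ ι x + ι y
      ι-* : ∀ x y → ι (x R.* y) ≈ ι x * ι y
      ι-1 : ι R.1# ≈ 1#
      ι-0 : ι R.0# ≈ 0#

  module Eval (hom : RingHom) where
    open RingHom hom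

    ev : Poly → Carrier → Carrier
    ev [] x = 0#
    ev (a ∷ p) x = ι a + x * ev p x

    ev-congʳ : ∀ p {x y} → x ≈ y → ev p x ≈ ev p y
    ev-congʳ [] e = refl
    ev-congʳ (a ∷ p) e = +-congˡ (*-cong e (ev-congʳ p e))

    ev-zero : ∀ p x → p ≈ₚ [] → ev p x ≈ 0#
    ev-zero [] x e = refl
    ev-zero (a ∷ p) x e = begin
      ι a + x * ev p x ≈⟨ +-cong (trans (ι-cong (at e 0)) ι-0) (*-congˡ (ev-zero p x (coeffwise λ n → at e (suc n)))) ⟩
      0# + x * 0# ≈⟨ solve 1 (λ x → κ 0 ⊕ x ⊗ κ 0 ⊜ κ 0) refl x ⟩
      0# ∎

    ev-cong : ∀ {p q} x → p ≈ₚ q → ev p x ≈ ev q x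
    ev-cong {[]} {q} x e = sym (ev-zero q x (≈ₚ.sym e))
    ev-cong {a ∷ p} {[]} x e = ev-zero (a ∷ p) x e
    ev-cong {a ∷ p} {b ∷ q} x e =
      +-cong (ι-cong (at e 0)) (*-congˡ (ev-cong {p} {q} x (coeffwise λ n → at e (suc n))))

    ev-+ : ∀ p q x → ev (p +ₚ q) x ≈ ev p x + ev q x
    ev-+ [] q x = sym (+-identityˡ _)
    ev-+ (a ∷ p) [] x = sym (+-identityʳ _)
    ev-+ (a ∷ p) (b ∷ q) x = begin
      ι (a R.+ b) + x * ev (p +ₚ q) x ≈⟨ +-cong (ι-+ a b) (*-congˡ (ev-+ p q x)) ⟩
      (ι a + ι b) + x * (ev p x + ev q x)
        ≈⟨ solve 5 (λ a b x p q → (a ⊕ b) ⊕ x ⊗ (p ⊕ q) ⊜ (a ⊕ x ⊗ p) ⊕ (b ⊕ x ⊗ q)) refl _ _ _ _ _ ⟩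
      (ι a + x * ev p x) + (ι b + x * ev q x) ∎

    ev-· : ∀ a p x → ev (a ·ₚ p) x ≈ ι a * ev p x
    ev-· a [] x = sym (zeroʳ _)
    ev-· a (b ∷ p) x = begin
      ι (a R.* b) + x * ev (a ·ₚ p) x ≈⟨ +-cong (ι-* a b) (*-congˡ (ev-· a p x)) ⟩
      ι a * ι b + x * (ι a * ev p x) ≈⟨ solve 4 (λ a b x p → a ⊗ b ⊕ x ⊗ (a ⊗ p) ⊜ a ⊗ (b ⊕ x ⊗ p)) refl _ _ _ _ ⟩
      ι a * (ι b + x * ev p x) ∎

    ev-0∷ : ∀ p x → ev (R.0# ∷ p) x ≈ x * ev p x
    ev-0∷ p x = trans (+-congʳ ι-0) (+-identityˡ _)

    ev-* : ∀ p q x → ev (p *ₚ q) x ≈ ev p x * ev q x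
    ev-* [] q x = sym (zeroˡ _)
    ev-* (a ∷ p) q x = begin
      ev (a ·ₚ q +ₚ (R.0# ∷ p *ₚ q)) x ≈⟨ ev-+ (a ·ₚ q) (R.0# ∷ p *ₚ q) x ⟩
      ev (a ·ₚ q) x + ev (R.0# ∷ p *ₚ q) x ≈⟨ +-cong (ev-· a q x) (trans (ev-0∷ (p *ₚ q) x) (*-congˡ (ev-* p q x))) ⟩
      ι a * ev q x + x * (ev p x * ev q x)
        ≈⟨ solve 4 (λ a x p q → a ⊗ q ⊕ x ⊗ (p ⊗ q) ⊜ (a ⊕ x ⊗ p) ⊗ q) refl _ _ _ _ ⟩
      (ι a + x * ev p x) * ev q x ∎

    ev-C : ∀ a x → ev (C a) x ≈ ι a
    ev-C a x = trans (+-congˡ (zeroʳ x)) (+-identityʳ _)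

    ev-var : ∀ x → ev var x ≈ x
    ev-var x = begin
      ι R.0# + x * (ι R.1# + x * 0#) ≈⟨ +-cong ι-0 (*-congˡ (+-congʳ ι-1)) ⟩
      0# + x * (1# + x * 0#) ≈⟨ solve 1 (λ x → κ 0 ⊕ x ⊗ (κ 1 ⊕ x ⊗ κ 0) ⊜ x) refl x ⟩
      x ∎

    ev-neg : ∀ p x → ev (-ₚ p) x ≈ - ev p x
    ev-neg p x = begin
      ev (-ₚ p) x ≈⟨ solve 2 (λ u v → v ⊜ ⊝ u ⊕ (u ⊕ v)) refl (ev p x) _ ⟩
      - ev p x + (ev p x + ev (-ₚ p) x) ≈⟨ +-congˡ (ev-+ p (-ₚ p) x) ⟨
      - ev p x + ev (p +ₚ (-ₚ p)) x ≈⟨ +-congˡ (ev-zero (p +ₚ (-ₚ p)) x (-ₚ-inverseʳ p)) ⟩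
      - ev p x + 0# ≈⟨ +-identityʳ _ ⟩
      - ev p x ∎

    ev-^ : ∀ p k x → ev (p ^ₚ k) x ≈ ev p x ^ k
    ev-^ p zero x = trans (ev-C R.1# x) ι-1
    ev-^ p (suc k) x = begin
      ev (p ^ₚ suc k) x ≈⟨ ev-cong {p ^ₚ suc k} x (^ₚ-homo-* p 1 k) ⟩
      ev (p *ₚ p ^ₚ k) x ≈⟨ ev-* p (p ^ₚ k) x ⟩
      ev p x * ev (p ^ₚ k) x ≈⟨ *-congˡ (ev-^ p k x) ⟩
      ev p x * ev p x ^ k ≈⟨ ^-homo-* (ev p x) 1 k ⟨
      ev p x ^ suc k ∎

-- Degree bounds, linear factors and Hasse derivatives.

module Degree {c ℓ} (R : CommutativeRing c ℓ) where
  open CommutativeRing R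
  open IntegerSolver R using (solve)
  open Polynomial R
  open import Algebra.Properties.Ring ring using (-0#≈0#)
  private
    module P = CommutativeRing polyRing
  open import Algebra.Properties.Semiring.Exp.TCOptimised P.semiring using ()
    renaming (_^_ to _^ₚ_; ^-homo-* to ^ₚ-homo-*)

  -- deg p ≤ n − s, phrased so that no subtraction occurs.
  record Deg (s n : ℕ) (p : Poly) : Set ℓ where
    constructor deg
    field vanish : ∀ j → n ℕ.< j ℕ.+ s → coeff p j ≈ 0#
  open Deg public

  Deg-resp : ∀ {s n p q} → p ≈ₚ q → Deg s n p → Deg s n q
  Deg-resp e d = deg λ j h → trans (sym (at e j)) (vanish d j h)

  Deg-weaken : ∀ {s n s′ n′ p} → n ℕ.+ s′ ℕ.≤ n′ ℕ.+ s → Deg s n p → Deg s′ n′ p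
  Deg-weaken {s} {n} {s′} {n′} le d = deg λ j h → vanish d j
    (ℕ.+-cancelʳ-< s′ n (j ℕ.+ s) (ℕ.≤-<-trans le (≡.subst (n′ ℕ.+ s ℕ.<_)
      (≡.trans (ℕ.+-assoc j s′ s) (≡.trans (≡.cong (j ℕ.+_) (ℕ.+-comm s′ s)) (≡.sym (ℕ.+-assoc j s s′))))
      (ℕ.+-monoˡ-< s h))))

  Deg-forget : ∀ {s n p} → Deg s n p → Deg 0 n p
  Deg-forget {n = n} = Deg-weaken (ℕ.+-monoʳ-≤ n ℕ.z≤n)

  Deg-[] : ∀ {s n} → Deg s n []
  Deg-[] = deg λ _ _ → refl

  Deg-+ : ∀ {s n p q} → Deg s n p → Deg s n q → Deg s n (p +ₚ q)
  Deg-+ {p = p} {q} d e = deg λ j h →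
    trans (coeff-+ p q j) (trans (+-cong (vanish d j h) (vanish e j h)) (+-identityˡ 0#))

  Deg-neg : ∀ {s n p} → Deg s n p → Deg s n (-ₚ p)
  Deg-neg {p = p} d = deg λ j h → trans (coeff-neg p j) (trans (-‿cong (vanish d j h)) -0#≈0#)

  Deg-· : ∀ {s n p} a → Deg s n p → Deg s n (a ·ₚ p)
  Deg-· {p = p} a d = deg λ j h → trans (coeff-· a p j) (trans (*-congˡ (vanish d j h)) (zeroʳ a))

  Deg-tail : ∀ {s n a p} → Deg s n (a ∷ p) → Deg (suc s) n p
  Deg-tail {s} {n} d = deg λ j h → vanish d (suc j) (≡.subst (n ℕ.<_) (ℕ.+-suc j s) h)

  Deg-∷ : ∀ {s n a p} → s ℕ.≤ n → Deg (suc s) n p → Deg s n (a ∷ p)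
  Deg-∷ {s} {n} le d = deg λ where
    zero h → ⊥-elim (ℕ.<-irrefl ≡.refl (ℕ.<-≤-trans h le))
    (suc j) h → vanish d j (≡.subst (n ℕ.<_) (≡.sym (ℕ.+-suc j s)) h)

  Deg-* : ∀ {s m t n p q} → Deg s m p → Deg t n q → Deg (s ℕ.+ t) (m ℕ.+ n) (p *ₚ q)
  Deg-* {p = []} d e = Deg-[]
  Deg-* {s} {m} {t} {n} {p = a ∷ p} {q} d e = Deg-+ {p = a ·ₚ q} {0# ∷ p *ₚ q} (deg head) (deg rest)
    where
    head : ∀ j → m ℕ.+ n ℕ.< j ℕ.+ (s ℕ.+ t) → coeff (a ·ₚ q) j ≈ 0#
    head j h with s ℕ.≤? m
    ... | no s≰m = trans (coeff-· a q j) (trans (*-congʳ (vanish d 0 (ℕ.≰⇒> s≰m))) (zeroˡ _))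
    ... | yes s≤m = trans (coeff-· a q j) (trans (*-congˡ (vanish e j lt)) (zeroʳ a))
      where
      lt : n ℕ.< j ℕ.+ t
      lt = ℕ.+-cancelˡ-< s n (j ℕ.+ t) (ℕ.≤-<-trans (ℕ.+-monoˡ-≤ n s≤m)
        (≡.subst (m ℕ.+ n ℕ.<_) (≡.trans (≡.sym (ℕ.+-assoc j s t))
          (≡.trans (≡.cong (ℕ._+ t) (ℕ.+-comm j s)) (ℕ.+-assoc s j t))) h))
    rest : ∀ j → m ℕ.+ n ℕ.< j ℕ.+ (s ℕ.+ t) → coeff (0# ∷ p *ₚ q) j ≈ 0#
    rest zero h = refl
    rest (suc j) h = vanish (Deg-* {p = p} (Deg-tail d) e) j
      (≡.subst (m ℕ.+ n ℕ.<_) (≡.sym (ℕ.+-suc j (s ℕ.+ t))) h)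

  Deg-C : ∀ a → Deg 0 0 (C a)
  Deg-C a = Deg-∷ ℕ.z≤n Deg-[]

  Deg-var : Deg 0 1 var
  Deg-var = Deg-∷ ℕ.z≤n (Deg-∷ ℕ.≤-refl Deg-[])

  ^ₚ-suc : ∀ p k → p ^ₚ suc k ≈ₚ p *ₚ p ^ₚ k
  ^ₚ-suc p k = ^ₚ-homo-* p 1 k

  Deg-^ : ∀ {s n p} k → Deg s n p → Deg (k ℕ.* s) (k ℕ.* n) (p ^ₚ k)
  Deg-^ zero d = Deg-C 1#
  Deg-^ {p = p} (suc k) d = Deg-resp (≈ₚ.sym (^ₚ-suc p k)) (Deg-* d (Deg-^ k d))

  Deg-length : ∀ p {n} → length p ℕ.≤ n → Deg 1 n p
  Deg-length [] le = Deg-[]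
  Deg-length (a ∷ p) {suc n} (ℕ.s≤s le) = Deg-∷ (ℕ.s≤s ℕ.z≤n) (Deg-weaken
    (ℕ.≤-reflexive (≡.trans (ℕ.+-comm n 2) (ℕ.+-comm 1 (suc n)))) (Deg-length p le))

  -- `Deg 1 n` is the form used below for "degree less than n". It includes the zero polynomial, and
  -- for n = 0 nothing else.
  Deg-zero : ∀ {p} → Deg 1 0 p → p ≈ₚ []
  Deg-zero d = coeffwise λ n → vanish d n (≡.subst (0 ℕ.<_) (ℕ.+-comm 1 n) (ℕ.s≤s ℕ.z≤n))

  linear : Carrier → Poly
  linear a = - a ∷ 1# ∷ []

  coeff-linear : ∀ a q k → coeff (linear a *ₚ q) (suc k) ≈ - a * coeff q (suc k) + coeff q k
  coeff-linear a q k = trans (coeff-+ ((- a) ·ₚ q) (0# ∷ (1# ∷ []) *ₚ q) (suc k))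
    (+-cong (coeff-· (- a) q (suc k)) (at (*ₚ-identityˡ q) k))

  -- A linear factor is monic, so this needs no field: each coefficient `q_j` equals coefficient j +
  -- 1 of the product plus `a * q_(j+1)`. The induction descends from beyond the end of the list,
  -- where `q` vanishes.
  linear-Deg : ∀ a {n} q → Deg 1 (suc n) (linear a *ₚ q) → Deg 1 n q
  linear-Deg a {n} q d = deg λ j h →
    descend (length q) j (ℕ.≤-pred (≡.subst (n ℕ.<_) (ℕ.+-comm j 1) h)) (ℕ.m≤n+m (length q) j)
    where
    descend : ∀ k j → n ℕ.≤ j → length q ℕ.≤ j ℕ.+ k → coeff q j ≈ 0#
    descend zero j h le = vanish (Deg-length q ℕ.≤-refl) j
      (≡.subst (length q ℕ.<_) (ℕ.+-comm 1 j) (ℕ.s≤s (≡.subst (length q ℕ.≤_) (ℕ.+-identityʳ j) le)))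
    descend (suc k) j h le = begin
      coeff q j ≈⟨ solve 3 (λ a u v → u ⊜ (⊝ a ⊗ v ⊕ u) ⊕ a ⊗ v) refl a (coeff q j) (coeff q (suc j)) ⟩
      (- a * coeff q (suc j) + coeff q j) + a * coeff q (suc j)
        ≈⟨ +-cong (trans (sym (coeff-linear a q j)) (vanish d (suc j)
              (≡.subst (suc n ℕ.<_) (ℕ.+-comm 1 (suc j)) (ℕ.s≤s (ℕ.s≤s h)))))
            (*-congˡ (descend k (suc j) (ℕ.m≤n⇒m≤1+n h) (≡.subst (length q ℕ.≤_) (ℕ.+-suc j k) le))) ⟩
      0# + a * 0# ≈⟨ solve 1 (λ a → κ 0 ⊕ a ⊗ κ 0 ⊜ κ 0) refl a ⟩
      0# ∎
      where open import Relation.Binary.Reasoning.Setoid setoid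

  linear-Deg^ : ∀ a k {n} q → Deg 1 (k ℕ.+ n) (linear a ^ₚ k *ₚ q) → Deg 1 n q
  linear-Deg^ a zero q d = Deg-resp (P.*-identityˡ q) d
  linear-Deg^ a (suc k) q d = linear-Deg^ a k q (linear-Deg a (linear a ^ₚ k *ₚ q)
    (Deg-resp (≈ₚ.trans (*ₚ-cong (^ₚ-suc (linear a) k) (≈ₚ.refl {q})) (*ₚ-assoc (linear a) (linear a ^ₚ k) q)) d))

  linear-cancel : ∀ a q → linear a *ₚ q ≈ₚ [] → q ≈ₚ []
  linear-cancel a q e = Deg-zero (linear-Deg a q (Deg-resp (≈ₚ.sym e) Deg-[]))

  open Evaluation R R using (RingHom)
  idHom : RingHom
  idHom = record
    { ι = λ x → x ; ι-cong = λ e → e ; ι-+ = λ _ _ → refl ; ι-* = λ _ _ → refl ; ι-1 = refl ; ι-0 = refl }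
  open Evaluation.Eval R R idHom public

  -- Synthetic division: the entries of the quotient are the intermediate values of Horner's scheme
  -- at `a`.
  quot : Carrier → Poly → Poly
  quot a [] = []
  quot a (b ∷ p) = ev p a ∷ quot a p

  factor : ∀ a p → p ≈ₚ linear a *ₚ quot a p +ₚ C (ev p a)
  factor a [] = ≈ₚ.sym (≈ₚ.trans (+ₚ-cong {linear a *ₚ []} {[]} (*ₚ-zeroʳ (linear a)) ≈ₚ.refl) 0∷[])
  factor a (b ∷ p) = coeffwise go
    where
    open import Relation.Binary.Reasoning.Setoid setoid
    q = quot a p
    coeff-linear₀ : coeff (linear a *ₚ q) 0 ≈ - a * coeff q 0
    coeff-linear₀ = trans (coeff-+ ((- a) ·ₚ q) (0# ∷ (1# ∷ []) *ₚ q) 0)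
      (trans (+-identityʳ _) (coeff-· (- a) q 0))
    step : ∀ n → coeff (linear a *ₚ q) n + coeff (C (ev p a)) n ≈ coeff (linear a *ₚ quot a (b ∷ p)) (suc n)
    step zero = trans (+-congʳ coeff-linear₀) (sym (coeff-linear a (quot a (b ∷ p)) 0))
    step (suc n) = trans (+-identityʳ _) (trans (coeff-linear a q n) (sym (coeff-linear a (quot a (b ∷ p)) (suc n))))
    go : ∀ n → coeff (b ∷ p) n ≈ coeff (linear a *ₚ quot a (b ∷ p) +ₚ C (ev (b ∷ p) a)) n
    go zero = solve 3 (λ a b e → b ⊜ (⊝ a ⊗ e ⊕ κ 0) ⊕ (b ⊕ a ⊗ e)) refl a b (ev p a)
    go (suc n) = begin
      coeff p n ≈⟨ at (factor a p) n ⟩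
      coeff (linear a *ₚ quot a p +ₚ C (ev p a)) n ≈⟨ coeff-+ (linear a *ₚ quot a p) (C (ev p a)) n ⟩
      coeff (linear a *ₚ quot a p) n + coeff (C (ev p a)) n ≈⟨ step n ⟩
      coeff (linear a *ₚ quot a (b ∷ p)) (suc n) ≈⟨ +-identityʳ _ ⟨
      coeff (linear a *ₚ quot a (b ∷ p)) (suc n) + 0# ≈⟨ coeff-+ (linear a *ₚ quot a (b ∷ p)) (C (ev (b ∷ p) a)) (suc n) ⟨
      coeff (linear a *ₚ quot a (b ∷ p) +ₚ C (ev (b ∷ p) a)) (suc n) ∎

  infix 4 _∣ₚ_
  _∣ₚ_ : Poly → Poly → Set (c ⊔ ℓ)
  A ∣ₚ B = ∃ λ Q → B ≈ₚ A *ₚ Q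

  ev-root⇒∣ : ∀ a p → ev p a ≈ 0# → linear a ∣ₚ p
  ev-root⇒∣ a p e = quot a p , ≈ₚ.trans (factor a p) (≈ₚ.trans
    (+ₚ-cong (≈ₚ.refl {linear a *ₚ quot a p}) (≈ₚ.trans (∷-cong e ≈ₚ.refl) 0∷[])) (+ₚ-identityʳ _))

  ev-linear : ∀ a x → ev (linear a) x ≈ x + - a
  ev-linear a x = solve 2 (λ a x → ⊝ a ⊕ x ⊗ (κ 1 ⊕ x ⊗ κ 0) ⊜ x ⊕ ⊝ a) refl a x

  -- The coefficient of y^k in p(t + y), that is, the k-th derivative divided by k!. The recursion
  -- comes from (t + y) p(t + y): the factor t keeps the order and y raises it by one. No division
  -- occurs, so small characteristics are covered.
  hasse : ℕ → Poly → Poly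
  hasse zero p = p
  hasse (suc k) [] = []
  hasse (suc k) (a ∷ p) = (0# ∷ hasse (suc k) p) +ₚ hasse k p

  Deg-hasse : ∀ k {s n} p → Deg s n p → Deg (k ℕ.+ s) n (hasse k p)
  Deg-hasse zero p d = d
  Deg-hasse (suc k) [] d = Deg-[]
  Deg-hasse (suc k) {s} {n} (a ∷ p) d = Deg-+
    (deg λ where
      zero h → refl
      (suc j) h → vanish (Deg-hasse (suc k) p (Deg-tail d)) j
        (≡.subst (n ℕ.<_) (≡.trans (≡.cong suc (≡.cong (j ℕ.+_) (≡.sym (ℕ.+-suc k s))))
          (≡.sym (ℕ.+-suc j (k ℕ.+ suc s)))) h))
    (Deg-weaken (ℕ.≤-reflexive (≡.cong (n ℕ.+_) (≡.sym (ℕ.+-suc k s)))) (Deg-hasse k p (Deg-tail d)))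

  hasse-[] : ∀ k → hasse k [] ≈ₚ []
  hasse-[] zero = ≈ₚ.refl
  hasse-[] (suc k) = ≈ₚ.refl

  hasse-zero : ∀ k p → p ≈ₚ [] → hasse k p ≈ₚ []
  hasse-zero zero p e = e
  hasse-zero (suc k) [] e = ≈ₚ.refl
  hasse-zero (suc k) (a ∷ p) e = ≈ₚ.trans (+ₚ-cong
      (∷-cong refl (hasse-zero (suc k) p e′)) (hasse-zero k p e′)) 0∷[]
    where e′ = coeffwise λ n → at e (suc n)

  hasse-+ : ∀ k p q → hasse k (p +ₚ q) ≈ₚ hasse k p +ₚ hasse k q
  hasse-+ zero p q = ≈ₚ.refl
  hasse-+ (suc k) [] q = ≈ₚ.refl
  hasse-+ (suc k) (a ∷ p) [] = ≈ₚ.sym (+ₚ-identityʳ _)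
  hasse-+ (suc k) (a ∷ p) (b ∷ q) = ≈ₚ.trans
    (+ₚ-cong (≈ₚ.trans (∷-cong refl (hasse-+ (suc k) p q)) (0∷-+ (hasse (suc k) p) (hasse (suc k) q))) (hasse-+ k p q))
    (+ₚ-interchange (0# ∷ hasse (suc k) p) (0# ∷ hasse (suc k) q) (hasse k p) (hasse k q))

  hasse-· : ∀ k a p → hasse k (a ·ₚ p) ≈ₚ a ·ₚ hasse k p
  hasse-· zero a p = ≈ₚ.refl
  hasse-· (suc k) a [] = ≈ₚ.refl
  hasse-· (suc k) a (b ∷ p) = ≈ₚ.trans
    (+ₚ-cong (∷-cong (sym (zeroʳ a)) (hasse-· (suc k) a p)) (hasse-· k a p))
    (≈ₚ.sym (·ₚ-distrib-+ₚ a (0# ∷ hasse (suc k) p) (hasse k p)))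

  hasse-cong : ∀ k {p q} → p ≈ₚ q → hasse k p ≈ₚ hasse k q
  hasse-cong k {[]} {q} e = ≈ₚ.trans (hasse-[] k) (≈ₚ.sym (hasse-zero k q (≈ₚ.sym e)))
  hasse-cong k {a ∷ p} {[]} e = ≈ₚ.trans (hasse-zero k (a ∷ p) e) (≈ₚ.sym (hasse-[] k))
  hasse-cong zero {a ∷ p} {b ∷ q} e = e
  hasse-cong (suc k) {a ∷ p} {b ∷ q} e =
    +ₚ-cong (∷-cong refl (hasse-cong (suc k) e′)) (hasse-cong k e′)
    where e′ = coeffwise λ n → at e (suc n)

  conv : ℕ → (ℕ → Poly) → (ℕ → Poly) → Poly
  conv zero f g = f 0 *ₚ g 0
  conv (suc k) f g = f 0 *ₚ g (suc k) +ₚ conv k (λ i → f (suc i)) g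

  conv-0∷-+ : ∀ k f f′ g → conv k (λ i → (0# ∷ f i) +ₚ f′ i) g ≈ₚ (0# ∷ conv k f g) +ₚ conv k f′ g
  conv-0∷-+ zero f f′ g = ≈ₚ.trans (*ₚ-distribʳ (g 0) (0# ∷ f 0) (f′ 0)) (+ₚ-cong (0∷-*ₚ (f 0) (g 0)) ≈ₚ.refl)
  conv-0∷-+ (suc k) f f′ g = begin
    ((0# ∷ f 0) +ₚ f′ 0) *ₚ g (suc k) +ₚ conv k (λ i → (0# ∷ f (suc i)) +ₚ f′ (suc i)) g
      ≈⟨ +ₚ-cong (≈ₚ.trans (*ₚ-distribʳ (g (suc k)) (0# ∷ f 0) (f′ 0)) (+ₚ-cong (0∷-*ₚ (f 0) (g (suc k))) ≈ₚ.refl))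
           (conv-0∷-+ k (λ i → f (suc i)) (λ i → f′ (suc i)) g) ⟩
    ((0# ∷ f 0 *ₚ g (suc k)) +ₚ f′ 0 *ₚ g (suc k))
      +ₚ ((0# ∷ conv k (λ i → f (suc i)) g) +ₚ conv k (λ i → f′ (suc i)) g)
      ≈⟨ +ₚ-interchange (0# ∷ f 0 *ₚ g (suc k)) (f′ 0 *ₚ g (suc k)) (0# ∷ conv k (λ i → f (suc i)) g) _ ⟩
    ((0# ∷ f 0 *ₚ g (suc k)) +ₚ (0# ∷ conv k (λ i → f (suc i)) g)) +ₚ conv (suc k) f′ g
      ≈⟨ +ₚ-cong (0∷-+ (f 0 *ₚ g (suc k)) (conv k (λ i → f (suc i)) g)) (≈ₚ.refl {conv (suc k) f′ g}) ⟨
    (0# ∷ conv (suc k) f g) +ₚ conv (suc k) f′ g ∎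
    where open ≈ₚ-Reasoning

  -- Leibniz' rule. For Hasse derivatives it carries no binomial coefficients, being the Cauchy
  -- product of two expansions in y.
  hasse-* : ∀ k p q → hasse k (p *ₚ q) ≈ₚ conv k (λ i → hasse i p) (λ i → hasse i q)
  hasse-* zero p q = ≈ₚ.refl
  hasse-* (suc k) [] q = ≈ₚ.sym (conv-zero k)
    where
    conv-zero : ∀ k → conv k (λ i → []) (λ i → hasse i q) ≈ₚ []
    conv-zero zero = ≈ₚ.refl
    conv-zero (suc k) = conv-zero k
  hasse-* (suc k) (a ∷ p) q = begin
    hasse (suc k) (a ·ₚ q +ₚ (0# ∷ p *ₚ q)) ≈⟨ hasse-+ (suc k) (a ·ₚ q) (0# ∷ p *ₚ q) ⟩
    hasse (suc k) (a ·ₚ q) +ₚ ((0# ∷ hasse (suc k) (p *ₚ q)) +ₚ hasse k (p *ₚ q))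
      ≈⟨ +ₚ-cong (hasse-· (suc k) a q) (+ₚ-cong (∷-cong refl (hasse-* (suc k) p q)) (hasse-* k p q)) ⟩
    a ·ₚ g (suc k) +ₚ ((0# ∷ (p *ₚ g (suc k) +ₚ conv k (λ i → f (suc i)) g)) +ₚ conv k f g)
      ≈⟨ +ₚ-cong (≈ₚ.refl {a ·ₚ g (suc k)}) (+ₚ-cong (0∷-+ (p *ₚ g (suc k)) (conv k (λ i → f (suc i)) g)) (≈ₚ.refl {conv k f g})) ⟩
    a ·ₚ g (suc k) +ₚ (((0# ∷ p *ₚ g (suc k)) +ₚ (0# ∷ conv k (λ i → f (suc i)) g)) +ₚ conv k f g)
      ≈⟨ +ₚ-cong (≈ₚ.refl {a ·ₚ g (suc k)}) (+ₚ-assoc (0# ∷ p *ₚ g (suc k)) (0# ∷ conv k (λ i → f (suc i)) g) (conv k f g)) ⟩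
    a ·ₚ g (suc k) +ₚ ((0# ∷ p *ₚ g (suc k)) +ₚ ((0# ∷ conv k (λ i → f (suc i)) g) +ₚ conv k f g))
      ≈⟨ +ₚ-assoc (a ·ₚ g (suc k)) (0# ∷ p *ₚ g (suc k)) _ ⟨
    (a ∷ p) *ₚ g (suc k) +ₚ ((0# ∷ conv k (λ i → f (suc i)) g) +ₚ conv k f g)
      ≈⟨ +ₚ-cong (≈ₚ.refl {(a ∷ p) *ₚ g (suc k)}) (conv-0∷-+ k (λ i → f (suc i)) f g) ⟨
    (a ∷ p) *ₚ g (suc k) +ₚ conv k (λ i → hasse (suc i) (a ∷ p)) g ∎
    where
    open ≈ₚ-Reasoning
    f = λ i → hasse i p
    g = λ i → hasse i q

-- Taylor expansion in Horner form.

module Horner {a ℓ} (A : CommutativeRing a ℓ) where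
  open CommutativeRing A
  open IntegerSolver A using (solve)

  horner : ℕ → (ℕ → Carrier) → Carrier → Carrier
  horner zero f y = 0#
  horner (suc n) f y = f 0 + y * horner n (λ i → f (suc i)) y

  horner-cong : ∀ n {f g} y → (∀ i → f i ≈ g i) → horner n f y ≈ horner n g y
  horner-cong zero y e = refl
  horner-cong (suc n) y e = +-cong (e 0) (*-congˡ (horner-cong n y (λ i → e (suc i))))

  horner-zero : ∀ n {f} y → (∀ i → f i ≈ 0#) → horner n f y ≈ 0#
  horner-zero zero y e = refl
  horner-zero (suc n) y e = trans (+-cong (e 0) (*-congˡ (horner-zero n y (λ i → e (suc i)))))
    (trans (+-identityˡ _) (zeroʳ y))

  horner-linear : ∀ n x f g y → horner n (λ i → x * f i + g i) y ≈ x * horner n f y + horner n g y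
  horner-linear zero x f g y = solve 1 (λ x → κ 0 ⊜ x ⊗ κ 0 ⊕ κ 0) refl x
  horner-linear (suc n) x f g y = trans (+-congˡ (*-congˡ (horner-linear n x _ _ y)))
    (solve 6 (λ x y f g u v → (x ⊗ f ⊕ g) ⊕ y ⊗ (x ⊗ u ⊕ v) ⊜ x ⊗ (f ⊕ y ⊗ u) ⊕ (g ⊕ y ⊗ v)) refl x y _ _ _ _)

module Taylor {c ℓ} (R : CommutativeRing c ℓ) {a ℓ′} (A : CommutativeRing a ℓ′)
  (hom : Evaluation.RingHom R A) where
  private module R = CommutativeRing R
  open CommutativeRing A
  open IntegerSolver A using (solve)
  open Horner A
  open Polynomial R
  open Degree R using (hasse; hasse-[])
  open Evaluation.Eval R A hom
  open Evaluation.RingHom hom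
  open import Relation.Binary.Reasoning.Setoid setoid

  -- In (x + y) p(x + y) the two summands x and y reproduce the two summands in the recursion of
  -- `hasse`. Derivatives of order at least the length of `p` vanish, so any n from that length on
  -- will do.
  taylor : ∀ n p x y → length p ℕ.≤ n → ev p (x + y) ≈ horner n (λ k → ev (hasse k p) x) y
  taylor n [] x y le = sym (horner-zero n y (λ k → ev-zero (hasse k []) x (hasse-[] k)))
  taylor (suc n) (a ∷ p) x y (ℕ.s≤s le) = begin
    ι a + (x + y) * ev p (x + y) ≈⟨ solve 4 (λ a x y e → a ⊕ (x ⊕ y) ⊗ e ⊜ (a ⊕ x ⊗ e) ⊕ y ⊗ e) refl _ _ _ _ ⟩
    (ι a + x * ev p (x + y)) + y * ev p (x + y)
      ≈⟨ +-cong (+-congˡ (*-congˡ (taylor (suc n) p x y (ℕ.m≤n⇒m≤1+n le)))) (*-congˡ (taylor n p x y le)) ⟩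
    (ι a + x * (ev p x + y * horner n (λ k → h (suc k)) y)) + y * horner n h y
      ≈⟨ solve 6 (λ a x y e u v → (a ⊕ x ⊗ (e ⊕ y ⊗ u)) ⊕ y ⊗ v ⊜ (a ⊕ x ⊗ e) ⊕ y ⊗ (x ⊗ u ⊕ v)) refl _ _ _ _ _ _ ⟩
    (ι a + x * ev p x) + y * (x * horner n (λ k → h (suc k)) y + horner n h y)
      ≈⟨ +-congˡ (*-congˡ (horner-linear n x (λ k → h (suc k)) h y)) ⟨
    (ι a + x * ev p x) + y * horner n (λ k → x * h (suc k) + h k) y
      ≈⟨ +-congˡ (*-congˡ (horner-cong n y (λ k → trans (ev-+ (R.0# ∷ hasse (suc k) p) (hasse k p) x)
           (+-congʳ (ev-0∷ (hasse (suc k) p) x))))) ⟨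
    (ι a + x * ev p x) + y * horner n (λ k → ev (hasse (suc k) (a ∷ p)) x) y ∎
    where
    h : ℕ → Carrier
    h k = ev (hasse k p) x

-- Multiple roots over a field, and composition.

module FieldLemmas {c ℓ} (F : Field c ℓ) where
  open Field F hiding (zero)
  open IntegerSolver commutativeRing using (solve)
  open Polynomial commutativeRing
  open Degree commutativeRing
  open import Algebra.Properties.Semiring.Exp.TCOptimised semiring using (_^_; ^-homo-*)
  open import Algebra.Properties.Semiring.Exp.TCOptimised (CommutativeRing.semiring polyRing) using ()
    renaming (_^_ to _^ₚ_)
  open import Relation.Binary.Reasoning.Setoid setoid

  infix 4 _≉0
  _≉0 : Carrier → Set ℓ
  x ≉0 = ¬ (x ≈ 0#)

  ≉0-resp : ∀ {x y} → x ≈ y → x ≉0 → y ≉0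
  ≉0-resp e n z = n (trans e z)

  *-cancelʳ-0 : ∀ {x y} → y ≉0 → x * y ≈ 0# → x ≈ 0#
  *-cancelʳ-0 {x} {y} y≉0 e with inverse y y≉0
  ... | y⁻¹ , inv = begin
    x ≈⟨ *-identityʳ x ⟨
    x * 1# ≈⟨ *-congˡ inv ⟨
    x * (y * y⁻¹) ≈⟨ *-assoc _ _ _ ⟨
    (x * y) * y⁻¹ ≈⟨ *-congʳ e ⟩
    0# * y⁻¹ ≈⟨ zeroˡ _ ⟩
    0# ∎

  *-cancelˡ-0 : ∀ {x y} → x ≉0 → x * y ≈ 0# → y ≈ 0#
  *-cancelˡ-0 x≉0 e = *-cancelʳ-0 x≉0 (trans (*-comm _ _) e)

  *-≉0 : ∀ {x y} → x ≉0 → y ≉0 → x * y ≉0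
  *-≉0 x≉0 y≉0 e = x≉0 (*-cancelʳ-0 y≉0 e)

  ^-≉0 : ∀ {x} k → x ≉0 → x ^ k ≉0
  ^-≉0 zero x≉0 = 1≉0
  ^-≉0 {x} (suc k) x≉0 e = *-≉0 x≉0 (^-≉0 k x≉0) (trans (sym (^-homo-* x 1 k)) e)

  x-y≈0⇒x≈y : ∀ {x y} → x + - y ≈ 0# → x ≈ y
  x-y≈0⇒x≈y {x} {y} e = begin
    x ≈⟨ solve 2 (λ x y → x ⊜ (x ⊕ ⊝ y) ⊕ y) refl x y ⟩
    (x + - y) + y ≈⟨ +-congʳ e ⟩
    0# + y ≈⟨ +-identityˡ y ⟩
    y ∎

  x≈y⇒x-y≈0 : ∀ {x y} → x ≈ y → x + - y ≈ 0#
  x≈y⇒x-y≈0 {x} {y} e = trans (+-congʳ e) (-‿inverseʳ y)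

  *-cancelˡ : ∀ {z x y} → z ≉0 → z * x ≈ z * y → x ≈ y
  *-cancelˡ {z} {x} {y} z≉0 e = x-y≈0⇒x≈y (*-cancelˡ-0 z≉0 (begin
    z * (x + - y) ≈⟨ solve 3 (λ z x y → z ⊗ (x ⊕ ⊝ y) ⊜ z ⊗ x ⊕ ⊝ (z ⊗ y)) refl z x y ⟩
    z * x + - (z * y) ≈⟨ x≈y⇒x-y≈0 e ⟩
    0# ∎))

  private module P = CommutativeRing polyRing
  private module PS = IntegerSolver polyRing

  -- Evaluation at `a` shows B(a) C(a) = 0, hence B(a) = 0, so one linear factor splits off from
  -- `B`. It is cancelled on both sides and the argument repeats.
  linear^-∣-cancel : ∀ a n {B C} → ev C a ≉0 → linear a ^ₚ n ∣ₚ B *ₚ C → linear a ^ₚ n ∣ₚ B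
  linear^-∣-cancel a zero {B} C≉0 d = B , ≈ₚ.sym (P.*-identityˡ B)
  linear^-∣-cancel a (suc n) {B} {C} C≉0 (D , e) = B″ , ≈ₚ.trans e′ (≈ₚ.trans (*ₚ-cong (≈ₚ.refl {l}) e″)
      (≈ₚ.trans (≈ₚ.sym (*ₚ-assoc l (l ^ₚ n) B″)) (*ₚ-cong (≈ₚ.sym (^ₚ-suc l n)) (≈ₚ.refl {B″}))))
    where
    l = linear a
    root : ev B a ≈ 0#
    root = *-cancelʳ-0 C≉0 (begin
      ev B a * ev C a ≈⟨ ev-* B C a ⟨
      ev (B *ₚ C) a ≈⟨ ev-cong {B *ₚ C} {l ^ₚ suc n *ₚ D} a e ⟩
      ev (l ^ₚ suc n *ₚ D) a ≈⟨ ev-* (l ^ₚ suc n) D a ⟩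
      ev (l ^ₚ suc n) a * ev D a ≈⟨ *-congʳ (ev-^ l (suc n) a) ⟩
      ev l a ^ suc n * ev D a ≈⟨ *-congʳ (^-homo-* (ev l a) 1 n) ⟩
      ev l a * ev l a ^ n * ev D a ≈⟨ *-congʳ (*-congʳ (trans (ev-linear a a) (-‿inverseʳ a))) ⟩
      0# * ev l a ^ n * ev D a ≈⟨ solve 2 (λ u v → κ 0 ⊗ u ⊗ v ⊜ κ 0) refl _ _ ⟩
      0# ∎)
    B′ = proj₁ (ev-root⇒∣ a B root)
    e′ : B ≈ₚ l *ₚ B′
    e′ = proj₂ (ev-root⇒∣ a B root)
    diff : l *ₚ (B′ *ₚ C +ₚ (-ₚ (l ^ₚ n *ₚ D))) ≈ₚ []
    diff = ≈ₚ.trans (PS.solve 5 (λ l b c m d → l ⊗ (b ⊗ c ⊕ ⊝ (m ⊗ d)) ⊜ (l ⊗ b) ⊗ c ⊕ ⊝ ((l ⊗ m) ⊗ d)) ≈ₚ.refl l B′ C (l ^ₚ n) D)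
      (≈ₚ.trans (+ₚ-cong (*ₚ-cong (≈ₚ.sym e′) ≈ₚ.refl) (-ₚ-cong (*ₚ-cong (≈ₚ.sym (^ₚ-suc l n)) ≈ₚ.refl)))
        (≈ₚ.trans (+ₚ-cong e (≈ₚ.refl { -ₚ (l ^ₚ suc n *ₚ D)})) (-ₚ-inverseʳ (l ^ₚ suc n *ₚ D))))
    cancelled : B′ *ₚ C ≈ₚ l ^ₚ n *ₚ D
    cancelled = ≈ₚ.trans (PS.solve 2 (λ u v → u ⊜ (u ⊕ ⊝ v) ⊕ v) ≈ₚ.refl (B′ *ₚ C) (l ^ₚ n *ₚ D))
      (+ₚ-cong (linear-cancel a (B′ *ₚ C +ₚ (-ₚ (l ^ₚ n *ₚ D))) diff) (≈ₚ.refl {l ^ₚ n *ₚ D}))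
    ih = linear^-∣-cancel a n {B′} {C} C≉0 (D , cancelled)
    B″ = proj₁ ih
    e″ : B′ ≈ₚ l ^ₚ n *ₚ B″
    e″ = proj₂ ih

  -- After division by the e-th power belonging to one point, the quotient keeps its divisibility at
  -- the other points, since that power does not vanish there. Each division lowers the degree bound
  -- by e, down to 0.
  roots⇒zero : ∀ e L {B} → AllPairs (λ a b → ¬ a ≈ b) L → All (λ a → linear a ^ₚ e ∣ₚ B) L →
    Deg 1 (length L ℕ.* e) B → B ≈ₚ []
  roots⇒zero e [] _ _ d = Deg-zero d
  roots⇒zero e (a ∷ L) {B} (a≉ ∷ distinct) ((Q , eq) ∷ divs) d = ≈ₚ.trans eq
    (≈ₚ.trans (*ₚ-cong (≈ₚ.refl {linear a ^ₚ e}) (roots⇒zero e L distinct (others L a≉ divs)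
      (linear-Deg^ a e Q (Deg-resp eq d)))) (*ₚ-zeroʳ (linear a ^ₚ e)))
    where
    nonroot : ∀ {b} → ¬ a ≈ b → ev (linear a ^ₚ e) b ≉0
    nonroot {b} a≉b = ≉0-resp (sym (ev-^ (linear a) e b))
      (^-≉0 e (≉0-resp (sym (ev-linear a b)) λ z → a≉b (sym (x-y≈0⇒x≈y z))))
    others : ∀ M → All (λ b → ¬ a ≈ b) M → All (λ b → linear b ^ₚ e ∣ₚ B) M → All (λ b → linear b ^ₚ e ∣ₚ Q) M
    others [] _ _ = []
    others (b ∷ M) (a≉b ∷ h) ((D , eq′) ∷ h′) =
      linear^-∣-cancel b e {Q} {linear a ^ₚ e} (nonroot a≉b)
        (D , ≈ₚ.trans (*ₚ-comm Q (linear a ^ₚ e)) (≈ₚ.trans (≈ₚ.sym eq) eq′)) ∷ others M h h′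

  open Evaluation commutativeRing polyRing using () renaming (RingHom to PolyHom)

  constHom : PolyHom
  constHom = record
    { ι = C ; ι-cong = λ e → ∷-cong e ≈ₚ.refl ; ι-+ = λ _ _ → ≈ₚ.refl
    ; ι-* = λ a b → ∷-cong (sym (+-identityʳ _)) ≈ₚ.refl ; ι-1 = ≈ₚ.refl ; ι-0 = 0∷[] }

  module Comp = Evaluation.Eval commutativeRing polyRing constHom
  open Comp public using () renaming (ev to comp)

  ev-comp : ∀ p s x → ev (comp p s) x ≈ ev p (ev s x)
  ev-comp [] s x = refl
  ev-comp (a ∷ p) s x = trans (ev-+ (C a) (s *ₚ comp p s) x)
    (+-cong (ev-C a x) (trans (ev-* s (comp p s) x) (*-congˡ (ev-comp p s x))))

-- Finite fields: Fermat, Frobenius and Euler's criterion.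

module FiniteField {c ℓ} (F : Field c ℓ) (q : ℕ) (card : HasCardinality F q) where
  open Field F hiding (zero)
  open IntegerSolver commutativeRing using (solve)
  open Polynomial commutativeRing
  open Degree commutativeRing
  open FieldLemmas F
  open import Algebra.Properties.CommutativeSemiring.Exp.TCOptimised commutativeSemiring
    using (_^_; ^-homo-*; ^-congˡ; ^-distrib-*)
  open import Algebra.Properties.CommutativeSemiring.Exp.TCOptimised (CommutativeRing.commutativeSemiring polyRing) using ()
    renaming (_^_ to _^ₚ_; ^-congˡ to ^ₚ-congˡ; ^-distrib-* to ^ₚ-distrib-*)
  open import Relation.Binary.Reasoning.Setoid setoid
  private module PS = IntegerSolver polyRing
  private module B = Bijection card

  el : Fin q → Carrier
  el = B.to

  index : Carrier → Fin q
  index x = proj₁ (B.surjective x)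

  el-index : ∀ x → el (index x) ≈ x
  el-index x = proj₂ (B.surjective x) ≡.refl

  index-cong : ∀ {x y} → x ≈ y → index x ≡ index y
  index-cong e = B.injective (trans (el-index _) (trans e (sym (el-index _))))

  index-el : ∀ i → index (el i) ≡ i
  index-el i = B.injective (el-index (el i))

  infix 4 _≟_
  _≟_ : ∀ x y → Dec (x ≈ y)
  x ≟ y with index x Fin.≟ index y
  ... | yes e = yes (trans (sym (el-index x)) (trans (reflexive (≡.cong el e)) (el-index y)))
  ... | no ne = no λ e → ne (index-cong e)

  -- Exhaustive search. Only the enumerated representatives are tested, so `P` has to respect
  -- equality in the field.
  ∃? : ∀ {p} {P : Carrier → Set p} → (∀ {x y} → x ≈ y → P x → P y) → (∀ x → Dec (P x)) → Dec (∃ P)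
  ∃? resp P? with Fin.any? (λ i → P? (el i))
  ... | yes (i , p) = yes (el i , p)
  ... | no none = no λ { (x , p) → none (index x , resp (sym (el-index x)) p) }

  elements : List Carrier
  elements = tabulate el

  elements-distinct : AllPairs (λ a b → ¬ a ≈ b) elements
  elements-distinct = AllPairs.tabulate⁺ λ i≢j e → i≢j (B.injective e)

  roots⇒zero-everywhere : ∀ e {B} → (∀ a → linear a ^ₚ e ∣ₚ B) → Deg 1 (q ℕ.* e) B → B ≈ₚ []
  roots⇒zero-everywhere e divs d = roots⇒zero e elements elements-distinct (All.tabulate⁺ (λ i → divs (el i)))
    (≡.subst (λ k → Deg 1 (k ℕ.* e) _) (≡.sym (length-tabulate el)) d)

  vanishing⇒zero : ∀ {B} → (∀ a → ev B a ≈ 0#) → Deg 1 q B → B ≈ₚ []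
  vanishing⇒zero {B} v d = roots⇒zero-everywhere 1 (λ a → ev-root⇒∣ a B (v a))
    (≡.subst (λ k → Deg 1 k B) (≡.sym (ℕ.*-identityʳ q)) d)

  private
    inhabited⇒suc : ∀ {k} → Fin k → ∃ λ n → k ≡ suc n
    inhabited⇒suc {suc n} _ = n , ≡.refl

    n = proj₁ (inhabited⇒suc (index 0#))
    q≡ = proj₂ (inhabited⇒suc (index 0#))

  -- Multiplication by x ≠ 0 permutes the field, so the product of all nonzero elements is
  -- multiplied by x^(q-1) and yet unchanged.
  fermat : ∀ x → x ^ q ≈ x
  fermat x with x ≟ 0#
  ... | yes x≈0 = begin
    x ^ q ≡⟨ ≡.cong (x ^_) q≡ ⟩
    x ^ suc n ≈⟨ ^-homo-* x 1 n ⟩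
    x * x ^ n ≈⟨ *-congʳ x≈0 ⟩
    0# * x ^ n ≈⟨ zeroˡ _ ⟩
    0# ≈⟨ x≈0 ⟨
    x ∎
  ... | no x≉0 = trans (reflexive (≡.cong (x ^_) q≡)) (trans (^-homo-* x 1 n) (trans (*-congˡ (trans (sym power) unit)) (*-identityʳ x)))
    where
    open import Algebra.Properties.CommutativeMonoid.Sum *-commutativeMonoid
      using (sum-cong-≋; ∑-distrib-+; sum-permute; sum-remove; sum-replicate) renaming (sum to ∏)
    open import Algebra.Properties.Monoid.Mult.TCOptimised *-monoid using (×ᵤ≈×)
    x⁻¹ = proj₁ (inverse x x≉0)
    x*x⁻¹ = proj₂ (inverse x x≉0)

    toEl : Fin (suc n) → Carrier
    toEl i = el (≡.subst Fin (≡.sym q≡) i)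
    toIndex : Carrier → Fin (suc n)
    toIndex y = ≡.subst Fin q≡ (index y)
    toEl-toIndex : ∀ y → toEl (toIndex y) ≈ y
    toEl-toIndex y = trans (reflexive (≡.cong el (≡.subst-sym-subst q≡))) (el-index y)
    toIndex-toEl : ∀ i → toIndex (toEl i) ≡ i
    toIndex-toEl i = ≡.trans (≡.cong (≡.subst Fin q≡) (index-el _)) (≡.subst-subst-sym q≡)
    toIndex-cong : ∀ {y z} → y ≈ z → toIndex y ≡ toIndex z
    toIndex-cong e = ≡.cong (≡.subst Fin q≡) (index-cong e)

    π : Permutation (suc n) (suc n)
    π = permutation (λ i → toIndex (x * toEl i)) (λ i → toIndex (x⁻¹ * toEl i))
      (λ i → ≡.trans (toIndex-cong (trans (*-congˡ (toEl-toIndex _)) (trans (sym (*-assoc _ _ _))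
        (trans (*-congʳ x*x⁻¹) (*-identityˡ _))))) (toIndex-toEl i))
      (λ i → ≡.trans (toIndex-cong (trans (*-congˡ (toEl-toIndex _)) (trans (sym (*-assoc _ _ _))
        (trans (*-congʳ (trans (*-comm _ _) x*x⁻¹)) (*-identityˡ _))))) (toIndex-toEl i))

    -- Putting 1 in place of 0 turns products over the nonzero elements into products over the whole
    -- enumeration, so the nonzero elements need no enumeration of their own.
    ifZero : Carrier → Carrier → Carrier
    ifZero z y with y ≟ 0#
    ... | yes _ = 1#
    ... | no _ = z
    ifZero-no : ∀ {z y} → y ≉0 → ifZero z y ≈ z
    ifZero-no {z} {y} y≉0 with y ≟ 0#
    ... | yes e = ⊥-elim (y≉0 e)
    ... | no _ = refl
    ifZero-yes : ∀ {z y} → y ≈ 0# → ifZero z y ≈ 1#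
    ifZero-yes {z} {y} e with y ≟ 0#
    ... | yes _ = refl
    ... | no ne = ⊥-elim (ne e)

    unitPart : Carrier → Carrier
    unitPart y = ifZero y y
    unitPart-≉0 : ∀ y → unitPart y ≉0
    unitPart-≉0 y with y ≟ 0#
    ... | yes _ = 1≉0
    ... | no ne = ne
    unitPart-cong : ∀ {y z} → y ≈ z → unitPart y ≈ unitPart z
    unitPart-cong {y} {z} e with y ≟ 0#
    ... | yes y≈0 = sym (ifZero-yes (trans (sym e) y≈0))
    ... | no y≉0 = trans e (sym (ifZero-no (≉0-resp e y≉0)))
    unitPart-* : ∀ y → unitPart (x * y) ≈ ifZero x y * unitPart y
    unitPart-* y with y ≟ 0#
    ... | yes y≈0 = trans (ifZero-yes (trans (*-congˡ y≈0) (zeroʳ x))) (sym (*-identityˡ 1#))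
    ... | no y≉0 = ifZero-no (*-≉0 x≉0 y≉0)

    ∏-≉0 : ∀ {k} (f : Fin k → Carrier) → (∀ i → f i ≉0) → ∏ f ≉0
    ∏-≉0 {zero} f h = 1≉0
    ∏-≉0 {suc k} f h = *-≉0 (h zero) (∏-≉0 (λ i → f (suc i)) (λ i → h (suc i)))

    G = ∏ (λ i → unitPart (toEl i))
    w = λ i → ifZero x (toEl i)

    unit : ∏ w ≈ 1#
    unit = sym (*-cancelˡ (∏-≉0 (λ i → unitPart (toEl i)) (λ i → unitPart-≉0 (toEl i))) (begin
      G * 1# ≈⟨ *-identityʳ G ⟩
      G ≈⟨ sum-permute (λ i → unitPart (toEl i)) π ⟩
      ∏ (λ i → unitPart (toEl (toIndex (x * toEl i)))) ≈⟨ sum-cong-≋ (λ i → trans (unitPart-cong (toEl-toIndex _)) (unitPart-* (toEl i))) ⟩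
      ∏ (λ i → w i * unitPart (toEl i)) ≈⟨ ∑-distrib-+ w (λ i → unitPart (toEl i)) ⟩
      ∏ w * G ≈⟨ *-comm _ _ ⟩
      G * ∏ w ∎))

    i₀ = toIndex 0#
    power : ∏ w ≈ x ^ n
    power = begin
      ∏ w ≈⟨ sum-remove {i = i₀} w ⟩
      w i₀ * ∏ (λ j → w (punchIn i₀ j)) ≈⟨ *-cong (ifZero-yes (toEl-toIndex 0#)) (sum-cong-≋ λ j → ifZero-no λ e →
           Fin.punchInᵢ≢i i₀ j (≡.trans (≡.sym (toIndex-toEl _)) (toIndex-cong e))) ⟩
      1# * ∏ {n} (λ _ → x) ≈⟨ *-identityˡ _ ⟩
      ∏ {n} (λ _ → x) ≈⟨ sum-replicate n ⟩
      _ ≈⟨ ×ᵤ≈× n x ⟩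
      x ^ n ∎

  -- The leading terms cancel: with s = t + a, s^(n+1) - t^(n+1) = s (s^n - t^n) + a t^n, and both
  -- summands have degree at most n.
  shift^-Deg : ∀ a n → Deg 1 n ((var +ₚ C a) ^ₚ n +ₚ (-ₚ (var ^ₚ n)))
  shift^-Deg a zero = Deg-resp (≈ₚ.sym (-ₚ-inverseʳ (C 1#))) Deg-[]
  shift^-Deg a (suc n) = Deg-resp (≈ₚ.sym split) (Deg-+
      (Deg-* {0} {1} {1} {n} (Deg-+ Deg-var (Deg-weaken ℕ.z≤n (Deg-C a))) (shift^-Deg a n))
      (Deg-weaken le (Deg-* (Deg-C a) (Deg-^ n Deg-var))))
    where
    le : n ℕ.* 1 ℕ.+ 1 ℕ.≤ suc n ℕ.+ n ℕ.* 0
    le = ℕ.≤-reflexive (≡.trans (≡.cong (ℕ._+ 1) (ℕ.*-identityʳ n)) (≡.trans (ℕ.+-comm n 1)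
      (≡.sym (≡.trans (≡.cong (suc n ℕ.+_) (ℕ.*-zeroʳ n)) (ℕ.+-identityʳ _)))))
    split : (var +ₚ C a) ^ₚ suc n +ₚ (-ₚ (var ^ₚ suc n))
      ≈ₚ (var +ₚ C a) *ₚ ((var +ₚ C a) ^ₚ n +ₚ (-ₚ (var ^ₚ n))) +ₚ C a *ₚ var ^ₚ n
    split = ≈ₚ.trans (+ₚ-cong (^ₚ-suc (var +ₚ C a) n) (-ₚ-cong (^ₚ-suc var n)))
      (PS.solve 4 (λ v a s t → (v ⊕ a) ⊗ s ⊕ ⊝ (v ⊗ t) ⊜ (v ⊕ a) ⊗ (s ⊕ ⊝ t) ⊕ a ⊗ t) ≈ₚ.refl var (C a) ((var +ₚ C a) ^ₚ n) (var ^ₚ n))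

  0<q : 0 ℕ.< q
  0<q = ≡.subst (0 ℕ.<_) (≡.sym q≡) (ℕ.s≤s ℕ.z≤n)

  -- (t + a)^q − t^q − a has degree below q and vanishes on the whole field, so it is the zero polynomial.
  frobenius-shift : ∀ a s → (s +ₚ C a) ^ₚ q ≈ₚ s ^ₚ q +ₚ C a
  frobenius-shift a s = shifted
    where
    Φ = ((var +ₚ C a) ^ₚ q +ₚ (-ₚ (var ^ₚ q))) +ₚ (-ₚ C a)
    Φ-vanishes : ∀ x → ev Φ x ≈ 0#
    Φ-vanishes x = begin
      ev Φ x ≈⟨ ev-+ ((var +ₚ C a) ^ₚ q +ₚ (-ₚ (var ^ₚ q))) (-ₚ C a) x ⟩
      ev ((var +ₚ C a) ^ₚ q +ₚ (-ₚ (var ^ₚ q))) x + ev (-ₚ C a) x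
        ≈⟨ +-cong (ev-+ ((var +ₚ C a) ^ₚ q) (-ₚ (var ^ₚ q)) x) (ev-C (- a) x) ⟩
      (ev ((var +ₚ C a) ^ₚ q) x + ev (-ₚ (var ^ₚ q)) x) + - a
        ≈⟨ +-congʳ (+-cong (trans (ev-^ (var +ₚ C a) q x) (fermat _)) (trans (ev-neg (var ^ₚ q) x) (-‿cong (trans (ev-^ var q x) (fermat _))))) ⟩
      (ev (var +ₚ C a) x + - ev var x) + - a
        ≈⟨ +-congʳ (+-congʳ (trans (ev-+ var (C a) x) (+-congˡ (ev-C a x)))) ⟩
      ((ev var x + a) + - ev var x) + - a ≈⟨ solve 2 (λ v a → ((v ⊕ a) ⊕ ⊝ v) ⊕ ⊝ a ⊜ κ 0) refl _ a ⟩
      0# ∎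
    Φ≈0 : Φ ≈ₚ []
    Φ≈0 = vanishing⇒zero Φ-vanishes (Deg-+ (shift^-Deg a q)
      (Deg-neg (Deg-weaken (≡.subst (1 ℕ.≤_) (≡.sym (ℕ.+-identityʳ q)) 0<q) (Deg-C a))))
    compΦ : (s +ₚ C a) ^ₚ q +ₚ (-ₚ (s ^ₚ q)) +ₚ (-ₚ C a) ≈ₚ []
    compΦ = ≈ₚ.trans (≈ₚ.sym (≈ₚ.trans (Comp.ev-+ ((var +ₚ C a) ^ₚ q +ₚ (-ₚ (var ^ₚ q))) (-ₚ C a) s)
      (+ₚ-cong (≈ₚ.trans (Comp.ev-+ ((var +ₚ C a) ^ₚ q) (-ₚ (var ^ₚ q)) s)
        (+ₚ-cong (≈ₚ.trans (Comp.ev-^ (var +ₚ C a) q s) (^ₚ-congˡ q (≈ₚ.trans (Comp.ev-+ var (C a) s) (+ₚ-cong (Comp.ev-var s) (Comp.ev-C a s)))))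
          (≈ₚ.trans (Comp.ev-neg (var ^ₚ q) s) (-ₚ-cong (≈ₚ.trans (Comp.ev-^ var q s) (^ₚ-congˡ q (Comp.ev-var s)))))))
        (≈ₚ.trans (Comp.ev-neg (C a) s) (-ₚ-cong (Comp.ev-C a s))))))
      (Comp.ev-zero Φ s Φ≈0)
    shifted : (s +ₚ C a) ^ₚ q ≈ₚ s ^ₚ q +ₚ C a
    shifted = ≈ₚ.trans (PS.solve 3 (λ u v w → u ⊜ (u ⊕ ⊝ v ⊕ ⊝ w) ⊕ (v ⊕ w)) ≈ₚ.refl ((s +ₚ C a) ^ₚ q) (s ^ₚ q) (C a))
      (+ₚ-cong compΦ (≈ₚ.refl {s ^ₚ q +ₚ C a}))

  []^q : [] ^ₚ q ≈ₚ []
  []^q = ≈ₚ.trans (≈ₚ.reflexive (≡.cong ([] ^ₚ_) q≡)) (^ₚ-suc [] n)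

  -- Horner's scheme builds `p` from additions of constants and multiplications by the variable; the
  -- q-th power passes through the former by `frobenius-shift` and through the latter by
  -- commutativity.
  frobenius : ∀ p → p ^ₚ q ≈ₚ comp p (var ^ₚ q)
  frobenius [] = []^q
  frobenius (a ∷ p) = ≈ₚ.trans (^ₚ-congˡ q (≈ₚ.trans (∷≈ a p) (+ₚ-comm (C a) (var *ₚ p))))
    (≈ₚ.trans (frobenius-shift a (var *ₚ p))
      (≈ₚ.trans (+ₚ-comm ((var *ₚ p) ^ₚ q) (C a))
        (+ₚ-cong (≈ₚ.refl {C a}) (≈ₚ.trans (^ₚ-distrib-* var p q) (*ₚ-cong (≈ₚ.refl {var ^ₚ q}) (frobenius p))))))

  module Odd (2≉0 : (1# + 1#) ≉0) where

    private
      halve : ∀ n → ∃ λ m → n ≡ m ℕ.+ m ⊎ n ≡ suc (m ℕ.+ m)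
      halve zero = 0 , inj₁ ≡.refl
      halve (suc n) with halve n
      ... | m , inj₁ e = m , inj₂ (≡.cong suc e)
      ... | m , inj₂ e = suc m , inj₁ (≡.cong suc (≡.trans e (≡.sym (ℕ.+-suc m m))))

    1^ : ∀ n → 1# ^ n ≈ 1#
    1^ zero = refl
    1^ (suc n) = trans (^-homo-* 1# 1 n) (trans (*-identityˡ _) (1^ n))

    -- For even q, (-1)^q would be 1 while Fermat gives -1, so 2 would be 0.
    q-odd : ∃ λ m → q ≡ suc (m ℕ.+ m)
    q-odd with halve q
    ... | m , inj₂ e = m , e
    ... | m , inj₁ e = ⊥-elim (2≉0 (begin
      1# + 1# ≈⟨ +-congˡ (trans (sym even) (trans (reflexive (≡.cong ((- 1#) ^_) (≡.sym e))) (fermat (- 1#)))) ⟩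
      1# + - 1# ≈⟨ -‿inverseʳ 1# ⟩
      0# ∎))
      where
      even : (- 1#) ^ (m ℕ.+ m) ≈ 1#
      even = begin
        (- 1#) ^ (m ℕ.+ m) ≈⟨ ^-homo-* (- 1#) m m ⟩
        (- 1#) ^ m * (- 1#) ^ m ≈⟨ ^-distrib-* (- 1#) (- 1#) m ⟨
        (- 1# * - 1#) ^ m ≈⟨ ^-congˡ m (solve 0 (⊝ κ 1 ⊗ ⊝ κ 1 ⊜ κ 1) refl) ⟩
        1# ^ m ≈⟨ 1^ m ⟩
        1# ∎

    m : ℕ
    m = proj₁ q-odd

    q≡1+2m : q ≡ suc (m ℕ.+ m)
    q≡1+2m = proj₂ q-odd

    fermat-sq : ∀ {x} → x ≉0 → x ^ m * x ^ m ≈ 1#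
    fermat-sq {x} x≉0 = *-cancelˡ x≉0 (begin
      x * (x ^ m * x ^ m) ≈⟨ *-congˡ (^-homo-* x m m) ⟨
      x * x ^ (m ℕ.+ m) ≈⟨ ^-homo-* x 1 (m ℕ.+ m) ⟨
      x ^ suc (m ℕ.+ m) ≡⟨ ≡.cong (x ^_) q≡1+2m ⟨
      x ^ q ≈⟨ fermat x ⟩
      x ≈⟨ *-identityʳ x ⟨
      x * 1# ∎)

    square^m : ∀ {x} → x ≉0 → (x * x) ^ m ≈ 1#
    square^m {x} x≉0 = trans (^-distrib-* x x m) (fermat-sq x≉0)

    x²≈1⇒x≉1⇒x≈-1 : ∀ {x} → x * x ≈ 1# → ¬ x ≈ 1# → x ≈ - 1#
    x²≈1⇒x≉1⇒x≈-1 {x} e ne = x-y≈0⇒x≈y (*-cancelˡ-0 (λ z → ne (x-y≈0⇒x≈y z)) (begin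
      (x + - 1#) * (x + - - 1#) ≈⟨ solve 1 (λ x → (x ⊕ ⊝ κ 1) ⊗ (x ⊕ ⊝ ⊝ κ 1) ⊜ x ⊗ x ⊕ ⊝ κ 1) refl x ⟩
      x * x + - 1# ≈⟨ x≈y⇒x-y≈0 e ⟩
      0# ∎))

    Deg-comp-sq : ∀ {s n} p → Deg s n p → Deg (s ℕ.+ s) (n ℕ.+ n) (comp p (var *ₚ var))
    Deg-comp-sq [] d = Deg-[]
    Deg-comp-sq {s} {n} (a ∷ p) d = Deg-+ headDeg (Deg-weaken le
      (Deg-* {0} {2} (Deg-* Deg-var Deg-var) (Deg-comp-sq p (Deg-tail d))))
      where
      headDeg : Deg (s ℕ.+ s) (n ℕ.+ n) (C a)
      headDeg with s ℕ.≤? n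
      ... | yes s≤n = Deg-weaken (≡.subst (s ℕ.+ s ℕ.≤_) (≡.sym (ℕ.+-identityʳ _)) (ℕ.+-mono-≤ s≤n s≤n)) (Deg-C a)
      ... | no s≰n = Deg-resp (≈ₚ.sym (≈ₚ.trans (∷-cong (vanish d 0 (ℕ.≰⇒> s≰n)) ≈ₚ.refl) 0∷[])) Deg-[]
      le : 2 ℕ.+ (n ℕ.+ n) ℕ.+ (s ℕ.+ s) ℕ.≤ n ℕ.+ n ℕ.+ (0 ℕ.+ (suc s ℕ.+ suc s))
      le = ℕ.≤-reflexive (≡.trans (≡.cong (ℕ._+ (s ℕ.+ s)) (ℕ.+-comm 2 (n ℕ.+ n)))
        (≡.trans (ℕ.+-assoc (n ℕ.+ n) 2 (s ℕ.+ s)) (≡.cong (n ℕ.+ n ℕ.+_) (≡.cong suc (≡.sym (ℕ.+-suc s s))))))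

    -- If z^m = 1 for a nonsquare z, write t^m − 1 = (t − z) c(t); then c(t²), of degree below 2m,
    -- vanishes at all 2m nonzero elements.
    nonsquare^m : ∀ {z} → (∀ x → ¬ x * x ≈ z) → z ^ m ≈ - 1#
    nonsquare^m {z} ns = x²≈1⇒x≉1⇒x≈-1 (fermat-sq λ z≈0 → ns 0# (trans (zeroˡ 0#) (sym z≈0))) λ z^m≈1 → contra z^m≈1
      where
      A = var ^ₚ m +ₚ (-ₚ C 1#)
      c′ = quot z A
      D = comp c′ (var *ₚ var)

      ev-A : ∀ x → ev A x ≈ x ^ m + - 1#
      ev-A x = trans (ev-+ (var ^ₚ m) (-ₚ C 1#) x)
        (+-cong (trans (ev-^ var m x) (^-congˡ m (ev-var x))) (ev-C (- 1#) x))

      ev-D : ∀ x → ev D x ≈ ev c′ (x * x)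
      ev-D x = trans (ev-comp c′ (var *ₚ var) x)
        (ev-congʳ c′ (trans (ev-* var var x) (*-cong (ev-var x) (ev-var x))))

      module _ (z^m≈1 : z ^ m ≈ 1#) where
        A-root : ev A z ≈ 0#
        A-root = trans (ev-A z) (x≈y⇒x-y≈0 z^m≈1)

        A≈ : A ≈ₚ linear z *ₚ c′
        A≈ = proj₂ (ev-root⇒∣ z A A-root)

        A-split : ∀ x → x ^ m + - 1# ≈ (x + - z) * ev c′ x
        A-split x = trans (sym (ev-A x)) (trans (ev-cong {A} {linear z *ₚ c′} x A≈)
          (trans (ev-* (linear z) c′ x) (*-congʳ (ev-linear z x))))

        D-root : ∀ {x} → x ≉0 → ev D x ≈ 0#
        D-root {x} x≉0 = trans (ev-D x) (*-cancelˡ-0 (λ e → ns x (x-y≈0⇒x≈y e))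
          (trans (sym (A-split (x * x))) (x≈y⇒x-y≈0 (square^m x≉0))))

        tD-root : ∀ x → ev (0# ∷ D) x ≈ 0#
        tD-root x with x ≟ 0#
        ... | yes e = trans (ev-0∷ D x) (trans (*-congʳ e) (zeroˡ _))
        ... | no ne = trans (ev-0∷ D x) (trans (*-congˡ (D-root ne)) (zeroʳ _))

        c′-Deg : Deg 1 m c′
        c′-Deg = linear-Deg z c′ (Deg-resp A≈ (Deg-+
          (Deg-weaken (ℕ.≤-reflexive (≡.trans (≡.cong (ℕ._+ 1) (ℕ.*-identityʳ m)) (≡.trans (ℕ.+-comm m 1)
            (≡.sym (≡.trans (≡.cong (suc m ℕ.+_) (ℕ.*-zeroʳ m)) (ℕ.+-identityʳ _)))))) (Deg-^ m Deg-var))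
          (Deg-neg (Deg-weaken (ℕ.s≤s ℕ.z≤n) (Deg-C 1#)))))

        0∷D≈[] : 0# ∷ D ≈ₚ []
        0∷D≈[] = vanishing⇒zero tD-root (Deg-resp (var-* D) (Deg-weaken
          (≡.subst (λ k → 1 ℕ.+ (m ℕ.+ m) ℕ.+ 1 ℕ.≤ k ℕ.+ 2) (≡.sym q≡1+2m)
            (ℕ.+-monoʳ-≤ (suc (m ℕ.+ m)) (ℕ.s≤s (ℕ.z≤n {1}))))
          (Deg-* {0} {1} {2} Deg-var (Deg-comp-sq c′ c′-Deg))))

        c′0≈0 : ev c′ 0# ≈ 0#
        c′0≈0 = trans (ev-congʳ c′ (sym (zeroˡ 0#))) (trans (sym (ev-D 0#))
          (ev-zero D 0# (coeffwise λ n → at 0∷D≈[] (suc n))))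

        -- The contradiction: c(0) = 0 turns t^m - 1 = (t - z) c(t) at t = 0 into 0^m = 1, which
        -- fails since m is positive.
        0^m≈1 : 0# ^ m ≈ 1#
        0^m≈1 = x-y≈0⇒x≈y (trans (A-split 0#) (trans (*-congˡ c′0≈0) (zeroʳ _)))

        m≢0 : ¬ m ≡ 0
        m≢0 e = 1≉0 (trans (sym (trans (el-index 1#) refl)) (trans (reflexive (≡.cong el (unique _ _))) (el-index 0#)))
          where
          Fin1 : ∀ {k} → k ≡ 1 → (i j : Fin k) → i ≡ j
          Fin1 ≡.refl zero zero = ≡.refl
          unique : (i j : Fin q) → i ≡ j
          unique = Fin1 (≡.trans q≡1+2m (≡.cong (λ k → suc (k ℕ.+ k)) e))

        contra : ⊥
        contra = positive m m≢0 0^m≈1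
          where
          positive : ∀ k → ¬ k ≡ 0 → ¬ 0# ^ k ≈ 1#
          positive zero ne _ = ne ≡.refl
          positive (suc k) _ e = 1≉0 (trans (sym e) (trans (^-homo-* 0# 1 k) (zeroˡ _)))

-- The truncated square root of a power series.

IsHalf : ∀ {c ℓ} (R : CommutativeRing c ℓ) → CommutativeRing.Carrier R → Set ℓ
IsHalf R h = h + h ≈ 1#
  where open CommutativeRing R

module SqrtExpansion {c ℓ} (R : CommutativeRing c ℓ) (h : CommutativeRing.Carrier R) (h+h≈1 : IsHalf R h)
  (f : ℕ → CommutativeRing.Carrier R) where
  open CommutativeRing R
  open IntegerSolver R using (solve)
  open Horner R using (horner)
  open import Algebra.Properties.Semiring.Exp.TCOptimised semiring using (_^_; ^-congˡ)
  open import Relation.Binary.Reasoning.Setoid setoid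

  -- Write √(f₀ + f₁ y + ⋯) = √f₀ Σ p_k (y / f₀)^k. Comparing squares gives 2 p_k + Σ p_i p_(k-i) =
  -- f₀^(k-1) f_k, the sum over 0 < i < k, which determines each p_k without dividing by f₀.
  F p₁ p₂ p₃ p₄ p₅ : Carrier
  F = f 0
  p₁ = h * f 1
  p₂ = h * (F * f 2 + - (p₁ * p₁))
  p₃ = h * (F ^ 2 * f 3 + - ((1# + 1#) * (p₁ * p₂)))
  p₄ = h * (F ^ 3 * f 4 + - ((1# + 1#) * (p₁ * p₃) + p₂ * p₂))
  p₅ = h * (F ^ 4 * f 5 + - ((1# + 1#) * (p₁ * p₄ + p₂ * p₃)))

  -- Multiplied by f₀⁻⁵ √f₀ these are the coefficients of √(f₀ + f₁ y + f₂ y² + ⋯).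
  τ : ℕ → Carrier
  τ 0 = F ^ 5
  τ 1 = p₁ * F ^ 4
  τ 2 = p₂ * F ^ 3
  τ 3 = p₃ * F ^ 2
  τ 4 = p₄ * F
  τ 5 = p₅
  τ _ = 0#

  T : Carrier → Carrier
  T = horner 6 τ

  -- The coefficients of y⁶, ..., y¹⁰ in F⁹ (f₀ + ⋯ + f₁₀ y¹⁰) - T².
  u : ℕ → Carrier
  u 0 = F ^ 9 * f 6 + - (F ^ 4 * ((1# + 1#) * (p₁ * p₅ + p₂ * p₄) + p₃ * p₃))
  u 1 = F ^ 9 * f 7 + - (F ^ 3 * ((1# + 1#) * (p₂ * p₅ + p₃ * p₄)))
  u 2 = F ^ 9 * f 8 + - (F ^ 2 * ((1# + 1#) * (p₃ * p₅) + p₄ * p₄))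
  u 3 = F ^ 9 * f 9 + - (F * ((1# + 1#) * (p₄ * p₅)))
  u 4 = F ^ 9 * f 10 + - (p₅ * p₅)
  u _ = 0#

  halve : ∀ A S → (1# + 1#) * (h * (A + - S)) + S ≈ A
  halve A S = begin
    (1# + 1#) * (h * (A + - S)) + S ≈⟨ solve 3 (λ h A S → κ 2 ⊗ (h ⊗ (A ⊕ ⊝ S)) ⊕ S ⊜ (h ⊕ h) ⊗ (A ⊕ ⊝ S) ⊕ S) refl h A S ⟩
    (h + h) * (A + - S) + S ≈⟨ +-congʳ (*-congʳ h+h≈1) ⟩
    1# * (A + - S) + S ≈⟨ solve 2 (λ A S → κ 1 ⊗ (A ⊕ ⊝ S) ⊕ S ⊜ A) refl A S ⟩
    A ∎

  halve₀ : ∀ A → (1# + 1#) * (h * A) ≈ A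
  halve₀ A = begin
    (1# + 1#) * (h * A) ≈⟨ solve 2 (λ h A → κ 2 ⊗ (h ⊗ A) ⊜ (h ⊕ h) ⊗ A) refl h A ⟩
    (h + h) * A ≈⟨ *-congʳ h+h≈1 ⟩
    1# * A ≈⟨ *-identityˡ A ⟩
    A ∎

  -- The equations defining the p_k say exactly that the terms up to y⁵ cancel. Both sides of the
  -- difference have degree 10 in y, so five terms are left.
  T² : ∀ y → F ^ 9 * horner 11 f y + - (T y * T y) ≈ y ^ 6 * horner 5 u y
  T² y = begin
    F ^ 9 * horner 11 f y + - (T y * T y) ≈⟨ +-congʳ expand ⟩
    coefficients (f 1) (F * f 2) (F ^ 2 * f 3) (F ^ 3 * f 4) (F ^ 4 * f 5) + - (T y * T y)
      ≈⟨ +-congʳ (coefficients-cong (halve₀ _) (halve _ _) (halve _ _) (halve _ _) (halve _ _)) ⟨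
    coefficients ((1# + 1#) * p₁) ((1# + 1#) * p₂ + p₁ * p₁) ((1# + 1#) * p₃ + (1# + 1#) * (p₁ * p₂))
      ((1# + 1#) * p₄ + ((1# + 1#) * (p₁ * p₃) + p₂ * p₂)) ((1# + 1#) * p₅ + (1# + 1#) * (p₁ * p₄ + p₂ * p₃))
      + - (T y * T y) ≈⟨ collect ⟩
    y ^ 6 * horner 5 u y ∎
    where
    coefficients : Carrier → Carrier → Carrier → Carrier → Carrier → Carrier
    coefficients s₁ s₂ s₃ s₄ s₅ =
      F ^ 10 + F ^ 9 * s₁ * y + F ^ 8 * s₂ * y ^ 2 + F ^ 7 * s₃ * y ^ 3 + F ^ 6 * s₄ * y ^ 4 + F ^ 5 * s₅ * y ^ 5
        + F ^ 9 * (f 6 * y ^ 6 + f 7 * y ^ 7 + f 8 * y ^ 8 + f 9 * y ^ 9 + f 10 * y ^ 10)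
    coefficients-cong : ∀ {a a′ b b′ c c′ d d′ e e′} → a ≈ a′ → b ≈ b′ → c ≈ c′ → d ≈ d′ → e ≈ e′ →
      coefficients a b c d e ≈ coefficients a′ b′ c′ d′ e′
    coefficients-cong a b c d e = +-congʳ (+-cong (+-cong (+-cong (+-cong (+-congˡ
      (*-congʳ (*-congˡ a))) (*-congʳ (*-congˡ b))) (*-congʳ (*-congˡ c))) (*-congʳ (*-congˡ d))) (*-congʳ (*-congˡ e)))
    expand : F ^ 9 * horner 11 f y ≈ coefficients (f 1) (F * f 2) (F ^ 2 * f 3) (F ^ 3 * f 4) (F ^ 4 * f 5)
    expand = solve 12 (λ y F f1 f2 f3 f4 f5 f6 f7 f8 f9 f10 →
      F ⊛ 9 ⊗ (F ⊕ y ⊗ (f1 ⊕ y ⊗ (f2 ⊕ y ⊗ (f3 ⊕ y ⊗ (f4 ⊕ y ⊗ (f5 ⊕ y ⊗ (f6 ⊕ y ⊗ (f7 ⊕ y ⊗ (f8 ⊕ y ⊗ (f9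
        ⊕ y ⊗ (f10 ⊕ y ⊗ κ 0)))))))))))
      ⊜ F ⊛ 10 ⊕ F ⊛ 9 ⊗ f1 ⊗ y ⊕ F ⊛ 8 ⊗ (F ⊗ f2) ⊗ y ⊛ 2 ⊕ F ⊛ 7 ⊗ (F ⊛ 2 ⊗ f3) ⊗ y ⊛ 3
        ⊕ F ⊛ 6 ⊗ (F ⊛ 3 ⊗ f4) ⊗ y ⊛ 4 ⊕ F ⊛ 5 ⊗ (F ⊛ 4 ⊗ f5) ⊗ y ⊛ 5
        ⊕ F ⊛ 9 ⊗ (f6 ⊗ y ⊛ 6 ⊕ f7 ⊗ y ⊛ 7 ⊕ f8 ⊗ y ⊛ 8 ⊕ f9 ⊗ y ⊛ 9 ⊕ f10 ⊗ y ⊛ 10))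
      refl y (f 0) (f 1) (f 2) (f 3) (f 4) (f 5) (f 6) (f 7) (f 8) (f 9) (f 10)
    collect : coefficients ((1# + 1#) * p₁) ((1# + 1#) * p₂ + p₁ * p₁) ((1# + 1#) * p₃ + (1# + 1#) * (p₁ * p₂))
        ((1# + 1#) * p₄ + ((1# + 1#) * (p₁ * p₃) + p₂ * p₂)) ((1# + 1#) * p₅ + (1# + 1#) * (p₁ * p₄ + p₂ * p₃))
        + - (T y * T y) ≈ y ^ 6 * horner 5 u y
    collect = solve 12 (λ y F p1 p2 p3 p4 p5 f6 f7 f8 f9 f10 →
      let t = κ 2
          T = F ⊛ 5 ⊕ y ⊗ (p1 ⊗ F ⊛ 4 ⊕ y ⊗ (p2 ⊗ F ⊛ 3 ⊕ y ⊗ (p3 ⊗ F ⊛ 2 ⊕ y ⊗ (p4 ⊗ F ⊕ y ⊗ (p5 ⊕ y ⊗ κ 0)))))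
      in F ⊛ 10 ⊕ F ⊛ 9 ⊗ (t ⊗ p1) ⊗ y ⊕ F ⊛ 8 ⊗ (t ⊗ p2 ⊕ p1 ⊗ p1) ⊗ y ⊛ 2
        ⊕ F ⊛ 7 ⊗ (t ⊗ p3 ⊕ t ⊗ (p1 ⊗ p2)) ⊗ y ⊛ 3 ⊕ F ⊛ 6 ⊗ (t ⊗ p4 ⊕ (t ⊗ (p1 ⊗ p3) ⊕ p2 ⊗ p2)) ⊗ y ⊛ 4
        ⊕ F ⊛ 5 ⊗ (t ⊗ p5 ⊕ t ⊗ (p1 ⊗ p4 ⊕ p2 ⊗ p3)) ⊗ y ⊛ 5
        ⊕ F ⊛ 9 ⊗ (f6 ⊗ y ⊛ 6 ⊕ f7 ⊗ y ⊛ 7 ⊕ f8 ⊗ y ⊛ 8 ⊕ f9 ⊗ y ⊛ 9 ⊕ f10 ⊗ y ⊛ 10)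
        ⊕ ⊝ (T ⊗ T)
      ⊜ y ⊛ 6 ⊗ ((F ⊛ 9 ⊗ f6 ⊕ ⊝ (F ⊛ 4 ⊗ (t ⊗ (p1 ⊗ p5 ⊕ p2 ⊗ p4) ⊕ p3 ⊗ p3)))
        ⊕ y ⊗ ((F ⊛ 9 ⊗ f7 ⊕ ⊝ (F ⊛ 3 ⊗ (t ⊗ (p2 ⊗ p5 ⊕ p3 ⊗ p4))))
        ⊕ y ⊗ ((F ⊛ 9 ⊗ f8 ⊕ ⊝ (F ⊛ 2 ⊗ (t ⊗ (p3 ⊗ p5) ⊕ p4 ⊗ p4)))
        ⊕ y ⊗ ((F ⊛ 9 ⊗ f9 ⊕ ⊝ (F ⊗ (t ⊗ (p4 ⊗ p5))))
        ⊕ y ⊗ ((F ⊛ 9 ⊗ f10 ⊕ ⊝ (p5 ⊗ p5)) ⊕ y ⊗ κ 0))))))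
      refl y (f 0) p₁ p₂ p₃ p₄ p₅ (f 6) (f 7) (f 8) (f 9) (f 10)

  -- F T = F⁶ + p₁ F⁵ y + ⋯ + p₅ F y⁵ is homogeneous of degree 6 in F and y, so a common factor of
  -- both comes out to the sixth power.
  F*T-divisible : ∀ l F′ y′ → F ≈ l * F′ →
    F * T (l * y′) ≈ l ^ 6 * (F′ * (F′ ^ 5 + y′ * (p₁ * F′ ^ 4 + y′ * (p₂ * F′ ^ 3 + y′ * (p₃ * F′ ^ 2
      + y′ * (p₄ * F′ + y′ * p₅))))))
  F*T-divisible l F′ y′ e = begin
    F * T (l * y′) ≈⟨ solve 8 (λ F l y p1 p2 p3 p4 p5 →
        F ⊗ (F ⊛ 5 ⊕ l ⊗ y ⊗ (p1 ⊗ F ⊛ 4 ⊕ l ⊗ y ⊗ (p2 ⊗ F ⊛ 3 ⊕ l ⊗ y ⊗ (p3 ⊗ F ⊛ 2 ⊕ l ⊗ y ⊗ (p4 ⊗ F ⊕ l ⊗ y ⊗ (p5 ⊕ l ⊗ y ⊗ κ 0))))))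
        ⊜ F ⊛ 6 ⊕ F ⊛ 5 ⊗ (l ⊗ y ⊗ p1) ⊕ F ⊛ 4 ⊗ ((l ⊗ y) ⊛ 2 ⊗ p2) ⊕ F ⊛ 3 ⊗ ((l ⊗ y) ⊛ 3 ⊗ p3)
          ⊕ F ⊛ 2 ⊗ ((l ⊗ y) ⊛ 4 ⊗ p4) ⊕ F ⊗ ((l ⊗ y) ⊛ 5 ⊗ p5))
        refl F l y′ p₁ p₂ p₃ p₄ p₅ ⟩
    homogeneous F ≈⟨ +-cong (+-cong (+-cong (+-cong (+-cong (^-congˡ 6 e) (*-congʳ (^-congˡ 5 e))) (*-congʳ (^-congˡ 4 e)))
        (*-congʳ (^-congˡ 3 e))) (*-congʳ (^-congˡ 2 e))) (*-congʳ e) ⟩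
    homogeneous (l * F′) ≈⟨ solve 8 (λ F l y p1 p2 p3 p4 p5 →
        (l ⊗ F) ⊛ 6 ⊕ (l ⊗ F) ⊛ 5 ⊗ (l ⊗ y ⊗ p1) ⊕ (l ⊗ F) ⊛ 4 ⊗ ((l ⊗ y) ⊛ 2 ⊗ p2) ⊕ (l ⊗ F) ⊛ 3 ⊗ ((l ⊗ y) ⊛ 3 ⊗ p3)
          ⊕ (l ⊗ F) ⊛ 2 ⊗ ((l ⊗ y) ⊛ 4 ⊗ p4) ⊕ (l ⊗ F) ⊗ ((l ⊗ y) ⊛ 5 ⊗ p5)
        ⊜ l ⊛ 6 ⊗ (F ⊗ (F ⊛ 5 ⊕ y ⊗ (p1 ⊗ F ⊛ 4 ⊕ y ⊗ (p2 ⊗ F ⊛ 3 ⊕ y ⊗ (p3 ⊗ F ⊛ 2 ⊕ y ⊗ (p4 ⊗ F ⊕ y ⊗ p5)))))))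
        refl F′ l y′ p₁ p₂ p₃ p₄ p₅ ⟩
    _ ∎
    where
    homogeneous : Carrier → Carrier
    homogeneous F = F ^ 6 + F ^ 5 * (l * y′ * p₁) + F ^ 4 * ((l * y′) ^ 2 * p₂) + F ^ 3 * ((l * y′) ^ 3 * p₃)
      + F ^ 2 * ((l * y′) ^ 4 * p₄) + F * ((l * y′) ^ 5 * p₅)

  -- If the series is the square of g₀ + ⋯ + g₅ y⁵, then p_k = g₀^(2k-1) g_k and T is g₀⁹ times that
  -- polynomial. The truncation loses nothing, and every `u k` is zero.
  module OfSquare (g₀ g₁ g₂ g₃ g₄ g₅ : Carrier)
    (f₀ : F ≈ g₀ * g₀)
    (f₁ : f 1 ≈ (1# + 1#) * (g₀ * g₁))
    (f₂ : f 2 ≈ (1# + 1#) * (g₀ * g₂) + g₁ * g₁)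
    (f₃ : f 3 ≈ (1# + 1#) * (g₀ * g₃ + g₁ * g₂))
    (f₄ : f 4 ≈ (1# + 1#) * (g₀ * g₄ + g₁ * g₃) + g₂ * g₂)
    (f₅ : f 5 ≈ (1# + 1#) * (g₀ * g₅ + g₁ * g₄ + g₂ * g₃))
    where

    halve′ : ∀ {A S B} → A ≈ (1# + 1#) * B + S → h * (A + - S) ≈ B
    halve′ {A} {S} {B} e = begin
      h * (A + - S) ≈⟨ *-congˡ (+-congʳ e) ⟩
      h * ((1# + 1#) * B + S + - S) ≈⟨ solve 3 (λ h B S → h ⊗ (κ 2 ⊗ B ⊕ S ⊕ ⊝ S) ⊜ (h ⊕ h) ⊗ B) refl h B S ⟩
      (h + h) * B ≈⟨ *-congʳ h+h≈1 ⟩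
      1# * B ≈⟨ *-identityˡ B ⟩
      B ∎

    p₁≈ : p₁ ≈ g₀ * g₁
    p₁≈ = trans (*-congˡ (trans f₁ (solve 1 (λ x → κ 2 ⊗ x ⊜ κ 2 ⊗ x ⊕ κ 0 ⊕ ⊝ κ 0) refl (g₀ * g₁))))
      (halve′ {S = 0#} refl)

    p₂≈ : p₂ ≈ g₀ ^ 3 * g₂
    p₂≈ = halve′ (begin
      F * f 2 ≈⟨ *-cong f₀ f₂ ⟩
      g₀ * g₀ * ((1# + 1#) * (g₀ * g₂) + g₁ * g₁) ≈⟨ solve 3 (λ g0 g1 g2 →
         g0 ⊗ g0 ⊗ (κ 2 ⊗ (g0 ⊗ g2) ⊕ g1 ⊗ g1) ⊜ κ 2 ⊗ (g0 ⊛ 3 ⊗ g2) ⊕ (g0 ⊗ g1) ⊗ (g0 ⊗ g1)) refl g₀ g₁ g₂ ⟩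
      (1# + 1#) * (g₀ ^ 3 * g₂) + (g₀ * g₁) * (g₀ * g₁) ≈⟨ +-congˡ (*-cong p₁≈ p₁≈) ⟨
      (1# + 1#) * (g₀ ^ 3 * g₂) + p₁ * p₁ ∎)

    p₃≈ : p₃ ≈ g₀ ^ 5 * g₃
    p₃≈ = halve′ (begin
      F ^ 2 * f 3 ≈⟨ *-cong (^-congˡ 2 f₀) f₃ ⟩
      (g₀ * g₀) ^ 2 * ((1# + 1#) * (g₀ * g₃ + g₁ * g₂)) ≈⟨ solve 4 (λ g0 g1 g2 g3 →
         (g0 ⊗ g0) ⊛ 2 ⊗ (κ 2 ⊗ (g0 ⊗ g3 ⊕ g1 ⊗ g2)) ⊜ κ 2 ⊗ (g0 ⊛ 5 ⊗ g3) ⊕ κ 2 ⊗ ((g0 ⊗ g1) ⊗ (g0 ⊛ 3 ⊗ g2))) refl g₀ g₁ g₂ g₃ ⟩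
      (1# + 1#) * (g₀ ^ 5 * g₃) + (1# + 1#) * ((g₀ * g₁) * (g₀ ^ 3 * g₂)) ≈⟨ +-congˡ (*-congˡ (*-cong p₁≈ p₂≈)) ⟨
      (1# + 1#) * (g₀ ^ 5 * g₃) + (1# + 1#) * (p₁ * p₂) ∎)

    p₄≈ : p₄ ≈ g₀ ^ 7 * g₄
    p₄≈ = halve′ (begin
      F ^ 3 * f 4 ≈⟨ *-cong (^-congˡ 3 f₀) f₄ ⟩
      (g₀ * g₀) ^ 3 * ((1# + 1#) * (g₀ * g₄ + g₁ * g₃) + g₂ * g₂) ≈⟨ solve 5 (λ g0 g1 g2 g3 g4 →
         (g0 ⊗ g0) ⊛ 3 ⊗ (κ 2 ⊗ (g0 ⊗ g4 ⊕ g1 ⊗ g3) ⊕ g2 ⊗ g2)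
         ⊜ κ 2 ⊗ (g0 ⊛ 7 ⊗ g4) ⊕ (κ 2 ⊗ ((g0 ⊗ g1) ⊗ (g0 ⊛ 5 ⊗ g3)) ⊕ (g0 ⊛ 3 ⊗ g2) ⊗ (g0 ⊛ 3 ⊗ g2))) refl g₀ g₁ g₂ g₃ g₄ ⟩
      (1# + 1#) * (g₀ ^ 7 * g₄) + ((1# + 1#) * ((g₀ * g₁) * (g₀ ^ 5 * g₃)) + (g₀ ^ 3 * g₂) * (g₀ ^ 3 * g₂))
        ≈⟨ +-congˡ (+-cong (*-congˡ (*-cong p₁≈ p₃≈)) (*-cong p₂≈ p₂≈)) ⟨
      (1# + 1#) * (g₀ ^ 7 * g₄) + ((1# + 1#) * (p₁ * p₃) + p₂ * p₂) ∎)

    p₅≈ : p₅ ≈ g₀ ^ 9 * g₅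
    p₅≈ = halve′ (begin
      F ^ 4 * f 5 ≈⟨ *-cong (^-congˡ 4 f₀) f₅ ⟩
      (g₀ * g₀) ^ 4 * ((1# + 1#) * (g₀ * g₅ + g₁ * g₄ + g₂ * g₃)) ≈⟨ solve 6 (λ g0 g1 g2 g3 g4 g5 →
         (g0 ⊗ g0) ⊛ 4 ⊗ (κ 2 ⊗ (g0 ⊗ g5 ⊕ g1 ⊗ g4 ⊕ g2 ⊗ g3))
         ⊜ κ 2 ⊗ (g0 ⊛ 9 ⊗ g5) ⊕ κ 2 ⊗ ((g0 ⊗ g1) ⊗ (g0 ⊛ 7 ⊗ g4) ⊕ (g0 ⊛ 3 ⊗ g2) ⊗ (g0 ⊛ 5 ⊗ g3))) refl g₀ g₁ g₂ g₃ g₄ g₅ ⟩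
      (1# + 1#) * (g₀ ^ 9 * g₅) + (1# + 1#) * ((g₀ * g₁) * (g₀ ^ 7 * g₄) + (g₀ ^ 3 * g₂) * (g₀ ^ 5 * g₃))
        ≈⟨ +-congˡ (*-congˡ (+-cong (*-cong p₁≈ p₄≈) (*-cong p₂≈ p₃≈))) ⟨
      (1# + 1#) * (g₀ ^ 9 * g₅) + (1# + 1#) * (p₁ * p₄ + p₂ * p₃) ∎)

    u₀≈0 : f 6 ≈ (1# + 1#) * (g₁ * g₅ + g₂ * g₄) + g₃ * g₃ → u 0 ≈ 0#
    u₀≈0 e = trans (+-cong (*-cong (^-congˡ 9 f₀) e) (-‿cong (*-cong (^-congˡ 4 f₀)
        (+-cong (*-congˡ (+-cong (*-cong p₁≈ p₅≈) (*-cong p₂≈ p₄≈))) (*-cong p₃≈ p₃≈)))))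
      (solve 6 (λ g0 g1 g2 g3 g4 g5 → (g0 ⊗ g0) ⊛ 9 ⊗ (κ 2 ⊗ (g1 ⊗ g5 ⊕ g2 ⊗ g4) ⊕ g3 ⊗ g3)
        ⊕ ⊝ ((g0 ⊗ g0) ⊛ 4 ⊗ (κ 2 ⊗ ((g0 ⊗ g1) ⊗ (g0 ⊛ 9 ⊗ g5) ⊕ (g0 ⊛ 3 ⊗ g2) ⊗ (g0 ⊛ 7 ⊗ g4))
          ⊕ (g0 ⊛ 5 ⊗ g3) ⊗ (g0 ⊛ 5 ⊗ g3))) ⊜ κ 0) refl g₀ g₁ g₂ g₃ g₄ g₅)

    u₁≈0 : f 7 ≈ (1# + 1#) * (g₂ * g₅ + g₃ * g₄) → u 1 ≈ 0#
    u₁≈0 e = trans (+-cong (*-cong (^-congˡ 9 f₀) e) (-‿cong (*-cong (^-congˡ 3 f₀)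
        (*-congˡ (+-cong (*-cong p₂≈ p₅≈) (*-cong p₃≈ p₄≈))))))
      (solve 5 (λ g0 g2 g3 g4 g5 → (g0 ⊗ g0) ⊛ 9 ⊗ (κ 2 ⊗ (g2 ⊗ g5 ⊕ g3 ⊗ g4))
        ⊕ ⊝ ((g0 ⊗ g0) ⊛ 3 ⊗ (κ 2 ⊗ ((g0 ⊛ 3 ⊗ g2) ⊗ (g0 ⊛ 9 ⊗ g5) ⊕ (g0 ⊛ 5 ⊗ g3) ⊗ (g0 ⊛ 7 ⊗ g4))))
        ⊜ κ 0) refl g₀ g₂ g₃ g₄ g₅)

    u₂≈0 : f 8 ≈ (1# + 1#) * (g₃ * g₅) + g₄ * g₄ → u 2 ≈ 0#
    u₂≈0 e = trans (+-cong (*-cong (^-congˡ 9 f₀) e) (-‿cong (*-cong (^-congˡ 2 f₀)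
        (+-cong (*-congˡ (*-cong p₃≈ p₅≈)) (*-cong p₄≈ p₄≈)))))
      (solve 4 (λ g0 g3 g4 g5 → (g0 ⊗ g0) ⊛ 9 ⊗ (κ 2 ⊗ (g3 ⊗ g5) ⊕ g4 ⊗ g4)
        ⊕ ⊝ ((g0 ⊗ g0) ⊛ 2 ⊗ (κ 2 ⊗ ((g0 ⊛ 5 ⊗ g3) ⊗ (g0 ⊛ 9 ⊗ g5)) ⊕ (g0 ⊛ 7 ⊗ g4) ⊗ (g0 ⊛ 7 ⊗ g4)))
        ⊜ κ 0) refl g₀ g₃ g₄ g₅)

    u₃≈0 : f 9 ≈ (1# + 1#) * (g₄ * g₅) → u 3 ≈ 0#
    u₃≈0 e = trans (+-cong (*-cong (^-congˡ 9 f₀) e) (-‿cong (*-cong f₀ (*-congˡ (*-cong p₄≈ p₅≈)))))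
      (solve 3 (λ g0 g4 g5 → (g0 ⊗ g0) ⊛ 9 ⊗ (κ 2 ⊗ (g4 ⊗ g5))
        ⊕ ⊝ ((g0 ⊗ g0) ⊗ (κ 2 ⊗ ((g0 ⊛ 7 ⊗ g4) ⊗ (g0 ⊛ 9 ⊗ g5)))) ⊜ κ 0) refl g₀ g₄ g₅)

    u₄≈0 : f 10 ≈ g₅ * g₅ → u 4 ≈ 0#
    u₄≈0 e = trans (+-cong (*-cong (^-congˡ 9 f₀) e) (-‿cong (*-cong p₅≈ p₅≈)))
      (solve 2 (λ g0 g5 → (g0 ⊗ g0) ⊛ 9 ⊗ (g5 ⊗ g5) ⊕ ⊝ ((g0 ⊛ 9 ⊗ g5) ⊗ (g0 ⊛ 9 ⊗ g5)) ⊜ κ 0) refl g₀ g₅)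

-- Stepanov's method for a polynomial of degree at most 10.

module Stepanov {c ℓ} (K : Field c ℓ) (q : ℕ) (card : HasCardinality K q)
  (h : Field.Carrier K) (h+h≈1 : IsHalf (Field.commutativeRing K) h) where
  open Field K hiding (zero)
  open IntegerSolver commutativeRing using (solve)
  open Polynomial commutativeRing
  open Degree commutativeRing
  open FieldLemmas K
  open FiniteField K q card

  2≉0 : (1# + 1#) ≉0
  2≉0 e = 1≉0 (begin
    1# ≈⟨ h+h≈1 ⟨
    h + h ≈⟨ solve 1 (λ h → h ⊕ h ⊜ κ 2 ⊗ h) refl h ⟩
    (1# + 1#) * h ≈⟨ *-congʳ e ⟩
    0# * h ≈⟨ zeroˡ h ⟩
    0# ∎)
    where open import Relation.Binary.Reasoning.Setoid setoid

  open Odd 2≉0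
  open import Algebra.Properties.CommutativeSemiring.Exp.TCOptimised commutativeSemiring
    using (_^_; ^-homo-*)
  open import Algebra.Properties.CommutativeSemiring.Exp.TCOptimised (CommutativeRing.commutativeSemiring polyRing) using ()
    renaming (_^_ to _^ₚ_; ^-homo-* to ^ₚ-homo-*; ^-congˡ to ^ₚ-congˡ; ^-distrib-* to ^ₚ-distrib-*)
  private module P = CommutativeRing polyRing
  private module PS = IntegerSolver polyRing
  private module H = Horner polyRing

  -- Zero low coefficients of `p` are stripped until its lowest one is nonzero; then the
  -- coefficients of `q` vanish from the lowest upward.
  *ₚ-cancel-0 : ∀ p q → ¬ p ≈ₚ [] → p *ₚ q ≈ₚ [] → q ≈ₚ []
  *ₚ-cancel-0 [] q p≉[] e = ⊥-elim (p≉[] ≈ₚ.refl)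
  *ₚ-cancel-0 (a ∷ p) q p≉[] e with a ≟ 0#
  ... | yes a≈0 = *ₚ-cancel-0 p q (λ z → p≉[] (≈ₚ.trans (∷-cong a≈0 z) 0∷[]))
      (coeffwise λ n → at 0∷pq≈[] (suc n))
    where
    0∷pq≈[] : 0# ∷ p *ₚ q ≈ₚ []
    0∷pq≈[] = ≈ₚ.trans (≈ₚ.sym (0∷-*ₚ p q)) (≈ₚ.trans (*ₚ-cong {0# ∷ p} {a ∷ p} (∷-cong (sym a≈0) ≈ₚ.refl) (≈ₚ.refl {q})) e)
  ... | no a≉0 = go q e
    where
    go : ∀ q → (a ∷ p) *ₚ q ≈ₚ [] → q ≈ₚ []
    go [] e = ≈ₚ.refl
    go (b ∷ q) e = ≈ₚ.trans (∷-cong b≈0 (go q (coeffwise λ n → at 0∷≈[] (suc n)))) 0∷[]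
      where
      b≈0 : b ≈ 0#
      b≈0 = *-cancelˡ-0 a≉0 (trans (sym (+-identityʳ _)) (at e 0))
      0∷≈[] : 0# ∷ (a ∷ p) *ₚ q ≈ₚ []
      0∷≈[] = ≈ₚ.trans (∷-cong refl (*ₚ-comm (a ∷ p) q)) (≈ₚ.trans (≈ₚ.sym (0∷-*ₚ q (a ∷ p)))
        (≈ₚ.trans (*ₚ-cong {0# ∷ q} {b ∷ q} (∷-cong (sym b≈0) ≈ₚ.refl) (≈ₚ.refl {a ∷ p}))
          (≈ₚ.trans (*ₚ-comm (b ∷ q) (a ∷ p)) e)))

  -- Two polynomials within the same degree bound n - s whose six coefficients from that bound
  -- downward agree. This is preserved by sums, products and Hasse derivatives, hence by the whole
  -- construction of `u`.
  record Close (s n : ℕ) (p p̂ : Poly) : Set ℓ where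
    constructor close
    field
      deg₁ : Deg s n p
      deg₂ : Deg s n p̂
      diff : Deg (6 ℕ.+ s) n (p +ₚ (-ₚ p̂))
  open Close

  Close-refl : ∀ {s n p} → Deg s n p → Close s n p p
  Close-refl {p = p} d = close d d (Deg-resp (≈ₚ.sym (-ₚ-inverseʳ p)) Deg-[])

  Close-+ : ∀ {s n p p̂ r r̂} → Close s n p p̂ → Close s n r r̂ → Close s n (p +ₚ r) (p̂ +ₚ r̂)
  Close-+ {p = p} {p̂} {r} {r̂} d e = close (Deg-+ (deg₁ d) (deg₁ e)) (Deg-+ (deg₂ d) (deg₂ e))
    (Deg-resp (PS.solve 4 (λ p p̂ r r̂ → (p ⊕ ⊝ p̂) ⊕ (r ⊕ ⊝ r̂) ⊜ (p ⊕ r) ⊕ ⊝ (p̂ ⊕ r̂)) ≈ₚ.refl p p̂ r r̂)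
      (Deg-+ (diff d) (diff e)))

  Close-neg : ∀ {s n p p̂} → Close s n p p̂ → Close s n (-ₚ p) (-ₚ p̂)
  Close-neg {p = p} {p̂} d = close (Deg-neg (deg₁ d)) (Deg-neg (deg₂ d))
    (Deg-resp (PS.solve 2 (λ p p̂ → ⊝ (p ⊕ ⊝ p̂) ⊜ ⊝ p ⊕ ⊝ ⊝ p̂) ≈ₚ.refl p p̂) (Deg-neg (diff d)))

  -- By p r - p̂ r̂ = (p - p̂) r + p̂ (r - r̂), each summand is six below the bound for the product.
  Close-* : ∀ {s m t n p p̂ r r̂} → Close s m p p̂ → Close t n r r̂ → Close (s ℕ.+ t) (m ℕ.+ n) (p *ₚ r) (p̂ *ₚ r̂)
  Close-* {s} {m} {t} {n} {p} {p̂} {r} {r̂} d e = close (Deg-* (deg₁ d) (deg₁ e)) (Deg-* (deg₂ d) (deg₂ e))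
    (Deg-resp (PS.solve 4 (λ p p̂ r r̂ → (p ⊕ ⊝ p̂) ⊗ r ⊕ p̂ ⊗ (r ⊕ ⊝ r̂) ⊜ p ⊗ r ⊕ ⊝ (p̂ ⊗ r̂)) ≈ₚ.refl p p̂ r r̂)
      (Deg-+ (Deg-* (diff d) (deg₁ e))
        (≡.subst (λ k → Deg k (m ℕ.+ n) (p̂ *ₚ (r +ₚ (-ₚ r̂))))
          (≡.trans (≡.sym (ℕ.+-assoc s 6 t)) (≡.cong (ℕ._+ t) (ℕ.+-comm s 6)))
          (Deg-* (deg₂ d) (diff e)))))

  Close-^ : ∀ {s n p p̂} k → Close s n p p̂ → Close (k ℕ.* s) (k ℕ.* n) (p ^ₚ k) (p̂ ^ₚ k)
  Close-^ zero d = Close-refl (Deg-C 1#)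
  Close-^ {p = p} {p̂} (suc k) d = close (Deg-resp (≈ₚ.sym (^ₚ-suc p k)) (deg₁ step)) (Deg-resp (≈ₚ.sym (^ₚ-suc p̂ k)) (deg₂ step))
    (Deg-resp (+ₚ-cong (≈ₚ.sym (^ₚ-suc p k)) (-ₚ-cong (≈ₚ.sym (^ₚ-suc p̂ k)))) (diff step))
    where step = Close-* d (Close-^ k d)

  hasse-neg : ∀ k p → hasse k (-ₚ p) ≈ₚ -ₚ hasse k p
  hasse-neg k p = ≈ₚ.trans (PS.solve 2 (λ u v → v ⊜ ⊝ u ⊕ (u ⊕ v)) ≈ₚ.refl (hasse k p) (hasse k (-ₚ p)))
    (≈ₚ.trans (+ₚ-cong (≈ₚ.refl { -ₚ hasse k p}) (≈ₚ.trans (≈ₚ.sym (hasse-+ k p (-ₚ p))) (hasse-zero k (p +ₚ (-ₚ p)) (-ₚ-inverseʳ p))))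
      (+ₚ-identityʳ (-ₚ hasse k p)))

  Close-hasse : ∀ {p p̂ n} k → Close 0 n p p̂ → Close (k ℕ.+ 0) n (hasse k p) (hasse k p̂)
  Close-hasse {p} {p̂} {n} k d = close (Deg-hasse k p (deg₁ d)) (Deg-hasse k p̂ (deg₂ d))
    (≡.subst (λ s → Deg s n (hasse k p +ₚ (-ₚ hasse k p̂)))
      (≡.trans (ℕ.+-comm k 6) (≡.cong (6 ℕ.+_) (≡.sym (ℕ.+-identityʳ k))))
      (Deg-resp (≈ₚ.trans (hasse-+ k p (-ₚ p̂)) (+ₚ-cong (≈ₚ.refl {hasse k p}) (hasse-neg k p̂)))
        (Deg-hasse k (p +ₚ (-ₚ p̂)) (diff d))))

  half : IsHalf polyRing (C h)
  half = ∷-cong h+h≈1 ≈ₚ.refl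

  conv-cong : ∀ k {f f′ g g′} → (∀ i → f i ≈ₚ f′ i) → (∀ i → g i ≈ₚ g′ i) → conv k f g ≈ₚ conv k f′ g′
  conv-cong zero e e′ = *ₚ-cong (e 0) (e′ 0)
  conv-cong (suc k) e e′ = +ₚ-cong (*ₚ-cong (e 0) (e′ (suc k))) (conv-cong k (λ i → e (suc i)) e′)

  X : Poly
  X = var ^ₚ q +ₚ (-ₚ var)

  ev-X : ∀ a → ev X a ≈ 0#
  ev-X a = trans (ev-+ (var ^ₚ q) (-ₚ var) a) (trans (+-cong (trans (ev-^ var q a) (fermat _)) (ev-neg var a)) (-‿inverseʳ _))

  comp-var : ∀ p → comp p var ≈ₚ p
  comp-var [] = ≈ₚ.refl
  comp-var (a ∷ p) = ≈ₚ.trans (+ₚ-cong (≈ₚ.refl {C a}) (*ₚ-cong (≈ₚ.refl {var}) (comp-var p))) (≈ₚ.sym (∷≈ a p))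

  Deg-X : Deg 0 q X
  Deg-X = Deg-+ (Deg-weaken (ℕ.≤-reflexive (≡.trans (ℕ.+-identityʳ _)
      (≡.trans (ℕ.*-identityʳ q) (≡.sym (≡.trans (≡.cong (q ℕ.+_) (ℕ.*-zeroʳ q)) (ℕ.+-identityʳ q)))))) (Deg-^ q Deg-var))
    (Deg-neg (Deg-weaken (ℕ.+-monoˡ-≤ 0 0<q) Deg-var))

  Deg-horner : ∀ n {d τ} → (∀ k → Deg 0 d (τ k)) → Deg 0 (d ℕ.+ n ℕ.* q) (H.horner (suc n) τ X)
  Deg-horner zero {d} {τ} D = Deg-weaken (ℕ.≤-reflexive (≡.sym (ℕ.+-identityʳ _)))
    (Deg-resp (≈ₚ.sym (≈ₚ.trans (+ₚ-cong (≈ₚ.refl {τ 0}) (*ₚ-zeroʳ X)) (+ₚ-identityʳ (τ 0)))) (D 0))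
  Deg-horner (suc n) {d} D = Deg-+ (Deg-weaken (ℕ.+-monoˡ-≤ 0 (ℕ.m≤m+n d _)) (D 0))
    (Deg-weaken (ℕ.≤-reflexive (≡.cong (ℕ._+ 0) (≡.trans (≡.sym (ℕ.+-assoc q d _))
      (≡.trans (≡.cong (ℕ._+ n ℕ.* q) (ℕ.+-comm q d)) (ℕ.+-assoc d q _)))))
      (Deg-* Deg-X (Deg-horner n (λ k → D (suc k)))))

  module _ (f p : Poly) (length-f : length f ℕ.≤ 11) (89≤q : 89 ℕ.≤ q)
    (Deg-p : Deg 0 5 p) (f∼p² : Deg 6 10 (f +ₚ (-ₚ (p *ₚ p)))) where

    Deg-f : Deg 0 10 f
    Deg-f = Deg-weaken (ℕ.≤-reflexive ≡.refl) (Deg-length f length-f)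

    open SqrtExpansion polyRing (C h) half (λ k → hasse k f)
    private module Ŝ = SqrtExpansion polyRing (C h) half (λ k → hasse k (p *ₚ p))

    private
      close-f : ∀ k → Close (k ℕ.+ 0) 10 (hasse k f) (hasse k (p *ₚ p))
      close-f k = Close-hasse k (close Deg-f (Deg-* Deg-p Deg-p) f∼p²)

      close-h : Close 0 0 (C h) (C h)
      close-h = Close-refl (Deg-C h)
      close-2 : Close 0 0 (P.1# P.+ P.1#) (P.1# P.+ P.1#)
      close-2 = Close-refl (Deg-+ {p = P.1#} {P.1#} (Deg-C 1#) (Deg-C 1#))

      -- In these indices every factor `f` contributes 10 to n and every derivative 1 to s; thus p_k
      -- has degree at most 9k.
      close-p₁ : Close 1 10 p₁ Ŝ.p₁
      close-p₁ = Close-* close-h (close-f 1)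
      close-p₂ : Close 2 20 p₂ Ŝ.p₂
      close-p₂ = Close-* close-h (Close-+ (Close-* (close-f 0) (close-f 2)) (Close-neg (Close-* close-p₁ close-p₁)))
      close-p₃ : Close 3 30 p₃ Ŝ.p₃
      close-p₃ = Close-* close-h (Close-+ (Close-* (Close-^ 2 (close-f 0)) (close-f 3))
        (Close-neg (Close-* close-2 (Close-* close-p₁ close-p₂))))
      close-p₄ : Close 4 40 p₄ Ŝ.p₄
      close-p₄ = Close-* close-h (Close-+ (Close-* (Close-^ 3 (close-f 0)) (close-f 4))
        (Close-neg (Close-+ (Close-* close-2 (Close-* close-p₁ close-p₃)) (Close-* close-p₂ close-p₂))))
      close-p₅ : Close 5 50 p₅ Ŝ.p₅
      close-p₅ = Close-* close-h (Close-+ (Close-* (Close-^ 4 (close-f 0)) (close-f 5))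
        (Close-neg (Close-* close-2 (Close-+ (Close-* close-p₁ close-p₄) (Close-* close-p₂ close-p₃)))))

      close-u₀ : Close 6 100 (u 0) (Ŝ.u 0)
      close-u₀ = Close-+ (Close-* (Close-^ 9 (close-f 0)) (close-f 6)) (Close-neg (Close-* (Close-^ 4 (close-f 0))
        (Close-+ (Close-* close-2 (Close-+ (Close-* close-p₁ close-p₅) (Close-* close-p₂ close-p₄))) (Close-* close-p₃ close-p₃))))
      close-u₁ : Close 7 100 (u 1) (Ŝ.u 1)
      close-u₁ = Close-+ (Close-* (Close-^ 9 (close-f 0)) (close-f 7)) (Close-neg (Close-* (Close-^ 3 (close-f 0))
        (Close-* close-2 (Close-+ (Close-* close-p₂ close-p₅) (Close-* close-p₃ close-p₄)))))
      close-u₂ : Close 8 100 (u 2) (Ŝ.u 2)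
      close-u₂ = Close-+ (Close-* (Close-^ 9 (close-f 0)) (close-f 8)) (Close-neg (Close-* (Close-^ 2 (close-f 0))
        (Close-+ (Close-* close-2 (Close-* close-p₃ close-p₅)) (Close-* close-p₄ close-p₄))))
      close-u₃ : Close 9 100 (u 3) (Ŝ.u 3)
      close-u₃ = Close-+ (Close-* (Close-^ 9 (close-f 0)) (close-f 9)) (Close-neg (Close-* (close-f 0)
        (Close-* close-2 (Close-* close-p₄ close-p₅))))
      close-u₄ : Close 10 100 (u 4) (Ŝ.u 4)
      close-u₄ = Close-+ (Close-* (Close-^ 9 (close-f 0)) (close-f 10)) (Close-neg (Close-* close-p₅ close-p₅))

      -- The Hasse derivatives of `p`, with those beyond its degree 5 replaced by the literal zero
      -- polynomial, so that the solver can treat them as 0.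
      g : ℕ → Poly
      g 0 = p
      g 1 = hasse 1 p
      g 2 = hasse 2 p
      g 3 = hasse 3 p
      g 4 = hasse 4 p
      g 5 = hasse 5 p
      g (suc (suc (suc (suc (suc (suc k)))))) = []

      g≈ : ∀ i → hasse i p ≈ₚ g i
      g≈ 0 = ≈ₚ.refl
      g≈ 1 = ≈ₚ.refl
      g≈ 2 = ≈ₚ.refl
      g≈ 3 = ≈ₚ.refl
      g≈ 4 = ≈ₚ.refl
      g≈ 5 = ≈ₚ.refl
      g≈ (suc (suc (suc (suc (suc (suc k)))))) = Deg-zero (Deg-weaken
        (ℕ.s≤s (ℕ.s≤s (ℕ.s≤s (ℕ.s≤s (ℕ.s≤s (ℕ.s≤s ℕ.z≤n)))))) (Deg-hasse (6 ℕ.+ k) p Deg-p))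

      hasse-p² : ∀ k → hasse k (p *ₚ p) ≈ₚ conv k g g
      hasse-p² k = ≈ₚ.trans (hasse-* k p p) (conv-cong k g≈ g≈)

      module Sq = Ŝ.OfSquare (g 0) (g 1) (g 2) (g 3) (g 4) (g 5)
        ≈ₚ.refl
        (≈ₚ.trans (hasse-p² 1) (PS.solve 2 (λ a b → a ⊗ b ⊕ b ⊗ a ⊜ κ 2 ⊗ (a ⊗ b)) ≈ₚ.refl (g 0) (g 1)))
        (≈ₚ.trans (hasse-p² 2) (PS.solve 3 (λ a b c → a ⊗ c ⊕ (b ⊗ b ⊕ c ⊗ a) ⊜ κ 2 ⊗ (a ⊗ c) ⊕ b ⊗ b) ≈ₚ.refl (g 0) (g 1) (g 2)))
        (≈ₚ.trans (hasse-p² 3) (PS.solve 4 (λ a b c d → a ⊗ d ⊕ (b ⊗ c ⊕ (c ⊗ b ⊕ d ⊗ a)) ⊜ κ 2 ⊗ (a ⊗ d ⊕ b ⊗ c)) ≈ₚ.refl (g 0) (g 1) (g 2) (g 3)))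
        (≈ₚ.trans (hasse-p² 4) (PS.solve 5 (λ a b c d e → a ⊗ e ⊕ (b ⊗ d ⊕ (c ⊗ c ⊕ (d ⊗ b ⊕ e ⊗ a))) ⊜ κ 2 ⊗ (a ⊗ e ⊕ b ⊗ d) ⊕ c ⊗ c)
          ≈ₚ.refl (g 0) (g 1) (g 2) (g 3) (g 4)))
        (≈ₚ.trans (hasse-p² 5) (PS.solve 6 (λ a b c d e f → a ⊗ f ⊕ (b ⊗ e ⊕ (c ⊗ d ⊕ (d ⊗ c ⊕ (e ⊗ b ⊕ f ⊗ a)))) ⊜ κ 2 ⊗ (a ⊗ f ⊕ b ⊗ e ⊕ c ⊗ d))
          ≈ₚ.refl (g 0) (g 1) (g 2) (g 3) (g 4) (g 5)))

      û₀≈0 : Ŝ.u 0 ≈ₚ []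
      û₀≈0 = Sq.u₀≈0 (≈ₚ.trans (hasse-p² 6) (PS.solve 6 (λ a b c d e f →
        a ⊗ κ 0 ⊕ (b ⊗ f ⊕ (c ⊗ e ⊕ (d ⊗ d ⊕ (e ⊗ c ⊕ (f ⊗ b ⊕ κ 0 ⊗ a))))) ⊜ κ 2 ⊗ (b ⊗ f ⊕ c ⊗ e) ⊕ d ⊗ d)
          ≈ₚ.refl (g 0) (g 1) (g 2) (g 3) (g 4) (g 5)))
      û₁≈0 : Ŝ.u 1 ≈ₚ []
      û₁≈0 = Sq.u₁≈0 (≈ₚ.trans (hasse-p² 7) (PS.solve 6 (λ a b c d e f →
        a ⊗ κ 0 ⊕ (b ⊗ κ 0 ⊕ (c ⊗ f ⊕ (d ⊗ e ⊕ (e ⊗ d ⊕ (f ⊗ c ⊕ (κ 0 ⊗ b ⊕ κ 0 ⊗ a)))))) ⊜ κ 2 ⊗ (c ⊗ f ⊕ d ⊗ e))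
          ≈ₚ.refl (g 0) (g 1) (g 2) (g 3) (g 4) (g 5)))
      û₂≈0 : Ŝ.u 2 ≈ₚ []
      û₂≈0 = Sq.u₂≈0 (≈ₚ.trans (hasse-p² 8) (PS.solve 6 (λ a b c d e f →
        a ⊗ κ 0 ⊕ (b ⊗ κ 0 ⊕ (c ⊗ κ 0 ⊕ (d ⊗ f ⊕ (e ⊗ e ⊕ (f ⊗ d ⊕ (κ 0 ⊗ c ⊕ (κ 0 ⊗ b ⊕ κ 0 ⊗ a))))))) ⊜ κ 2 ⊗ (d ⊗ f) ⊕ e ⊗ e)
          ≈ₚ.refl (g 0) (g 1) (g 2) (g 3) (g 4) (g 5)))
      û₃≈0 : Ŝ.u 3 ≈ₚ []
      û₃≈0 = Sq.u₃≈0 (≈ₚ.trans (hasse-p² 9) (PS.solve 6 (λ a b c d e f →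
        a ⊗ κ 0 ⊕ (b ⊗ κ 0 ⊕ (c ⊗ κ 0 ⊕ (d ⊗ κ 0 ⊕ (e ⊗ f ⊕ (f ⊗ e ⊕ (κ 0 ⊗ d ⊕ (κ 0 ⊗ c ⊕ (κ 0 ⊗ b ⊕ κ 0 ⊗ a)))))))) ⊜ κ 2 ⊗ (e ⊗ f))
          ≈ₚ.refl (g 0) (g 1) (g 2) (g 3) (g 4) (g 5)))
      û₄≈0 : Ŝ.u 4 ≈ₚ []
      û₄≈0 = Sq.u₄≈0 (≈ₚ.trans (hasse-p² 10) (PS.solve 6 (λ a b c d e f →
        a ⊗ κ 0 ⊕ (b ⊗ κ 0 ⊕ (c ⊗ κ 0 ⊕ (d ⊗ κ 0 ⊕ (e ⊗ κ 0 ⊕ (f ⊗ f ⊕ (κ 0 ⊗ e ⊕ (κ 0 ⊗ d ⊕ (κ 0 ⊗ c ⊕ (κ 0 ⊗ b ⊕ κ 0 ⊗ a))))))))) ⊜ f ⊗ f)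
          ≈ₚ.refl (g 0) (g 1) (g 2) (g 3) (g 4) (g 5)))

      -- For s = 6 the requirement is 100 + 1 ≤ q + 6 + 6, that is, q ≥ 89. No other estimate of the
      -- argument needs q so large.
      Deg-close-0 : ∀ {s v v̂} → 6 ℕ.≤ s → Close s 100 v v̂ → v̂ ≈ₚ [] → Deg 1 q v
      Deg-close-0 {s} {v} {v̂} 6≤s d e = Deg-weaken (ℕ.+-mono-≤ 89≤q (ℕ.+-monoʳ-≤ 6 6≤s))
        (Deg-resp (≈ₚ.trans (+ₚ-cong (≈ₚ.refl {v}) (-ₚ-cong e)) (+ₚ-identityʳ v)) (diff d))

    -- For the perfect square p² every u k is zero; since f and p² agree in their top six coefficients,
    -- this lowers the degree of u k for f from the expected 94 − k to 88 − k, which is below q.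
    Deg-u : ∀ k → Deg 1 q (u k)
    Deg-u 0 = Deg-close-0 (ℕ.m≤m+n 6 0) close-u₀ û₀≈0
    Deg-u 1 = Deg-close-0 (ℕ.m≤m+n 6 1) close-u₁ û₁≈0
    Deg-u 2 = Deg-close-0 (ℕ.m≤m+n 6 2) close-u₂ û₂≈0
    Deg-u 3 = Deg-close-0 (ℕ.m≤m+n 6 3) close-u₃ û₃≈0
    Deg-u 4 = Deg-close-0 (ℕ.m≤m+n 6 4) close-u₄ û₄≈0
    Deg-u (suc (suc (suc (suc (suc _))))) = Deg-[]

    f^[m+5] : Poly
    f^[m+5] = f ^ₚ (m ℕ.+ 5)

    -- As q = 2m + 1, the exponent 2(m + 5) is 9 + q, and by Frobenius f^q is `f` evaluated at t^q =
    -- t + X, which Taylor's formula expands.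
    f^[m+5]² : f^[m+5] *ₚ f^[m+5] ≈ₚ f ^ₚ 9 *ₚ H.horner 11 (λ k → hasse k f) X
    f^[m+5]² = begin
      f^[m+5] *ₚ f^[m+5] ≈⟨ ^ₚ-homo-* f (m ℕ.+ 5) (m ℕ.+ 5) ⟨
      f ^ₚ (m ℕ.+ 5 ℕ.+ (m ℕ.+ 5)) ≡⟨ ≡.cong (f ^ₚ_) (≡.trans (arith m) (≡.cong (9 ℕ.+_) (≡.sym q≡1+2m))) ⟩
      f ^ₚ (9 ℕ.+ q) ≈⟨ ^ₚ-homo-* f 9 q ⟩
      f ^ₚ 9 *ₚ f ^ₚ q ≈⟨ *ₚ-cong (≈ₚ.refl {f ^ₚ 9}) f^q ⟩
      f ^ₚ 9 *ₚ H.horner 11 (λ k → hasse k f) X ∎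
      where
      open ≈ₚ-Reasoning
      arith : ∀ m → m ℕ.+ 5 ℕ.+ (m ℕ.+ 5) ≡ 9 ℕ.+ suc (m ℕ.+ m)
      arith = solve-∀
      f^q : f ^ₚ q ≈ₚ H.horner 11 (λ k → hasse k f) X
      f^q = begin
        f ^ₚ q ≈⟨ frobenius f ⟩
        comp f (var ^ₚ q) ≈⟨ Comp.ev-congʳ f {var ^ₚ q} {var +ₚ X} (PS.solve 2 (λ u v → u ⊜ v ⊕ (u ⊕ ⊝ v)) ≈ₚ.refl (var ^ₚ q) var) ⟩
        comp f (var +ₚ X) ≈⟨ Taylor.taylor commutativeRing polyRing constHom 11 f var X length-f ⟩
        H.horner 11 (λ k → comp (hasse k f) var) X ≈⟨ H.horner-cong 11 X (λ k → comp-var (hasse k f)) ⟩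
        H.horner 11 (λ k → hasse k f) X ∎

    Ψ Ψ⁺ : Poly
    Ψ = f^[m+5] +ₚ (-ₚ T X)
    Ψ⁺ = f^[m+5] +ₚ T X

    Ψ*Ψ⁺ : Ψ *ₚ Ψ⁺ ≈ₚ X ^ₚ 6 *ₚ H.horner 5 u X
    Ψ*Ψ⁺ = begin
      Ψ *ₚ Ψ⁺ ≈⟨ PS.solve 2 (λ a b → (a ⊕ ⊝ b) ⊗ (a ⊕ b) ⊜ a ⊗ a ⊕ ⊝ (b ⊗ b)) ≈ₚ.refl f^[m+5] (T X) ⟩
      f^[m+5] *ₚ f^[m+5] +ₚ (-ₚ (T X *ₚ T X)) ≈⟨ +ₚ-cong f^[m+5]² (≈ₚ.refl { -ₚ (T X *ₚ T X)}) ⟩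
      f ^ₚ 9 *ₚ H.horner 11 (λ k → hasse k f) X +ₚ (-ₚ (T X *ₚ T X)) ≈⟨ T² X ⟩
      X ^ₚ 6 *ₚ H.horner 5 u X ∎
      where open ≈ₚ-Reasoning

    private
      Deg-τ : ∀ k → Deg 0 50 (τ k)
      Deg-τ 0 = Deg-^ 5 Deg-f
      Deg-τ 1 = Deg-forget (Deg-* (deg₁ close-p₁) (Deg-^ 4 Deg-f))
      Deg-τ 2 = Deg-forget (Deg-* (deg₁ close-p₂) (Deg-^ 3 Deg-f))
      Deg-τ 3 = Deg-forget (Deg-* (deg₁ close-p₃) (Deg-^ 2 Deg-f))
      Deg-τ 4 = Deg-forget (Deg-* (deg₁ close-p₄) Deg-f)
      Deg-τ 5 = Deg-forget (deg₁ close-p₅)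
      Deg-τ (suc (suc (suc (suc (suc (suc _)))))) = Deg-[]

    -- The power of `f` has degree at most 10(m + 5) = 5q + 45, and T at X at most 50 + 5q. With the
    -- factor `f` this is 60 + 5q, below 6q as soon as q > 60.
    Deg-fΨ : Deg 1 (q ℕ.* 6) (f *ₚ Ψ)
    Deg-fΨ = Deg-weaken {0} {10 ℕ.+ (50 ℕ.+ 5 ℕ.* q)} {1} {q ℕ.* 6} bound (Deg-* {0} {10} {0} {50 ℕ.+ 5 ℕ.* q} Deg-f (Deg-+
        (Deg-weaken {(m ℕ.+ 5) ℕ.* 0} {(m ℕ.+ 5) ℕ.* 10} {0} {50 ℕ.+ 5 ℕ.* q} bound′ (Deg-^ (m ℕ.+ 5) Deg-f))
        (Deg-neg (Deg-horner 5 {50} {τ} Deg-τ))))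
      where
      bound : 10 ℕ.+ (50 ℕ.+ 5 ℕ.* q) ℕ.+ 1 ℕ.≤ q ℕ.* 6 ℕ.+ 0
      bound = ≡.subst₂ ℕ._≤_ (lhs q) (rhs q) (ℕ.+-monoˡ-≤ (5 ℕ.* q) (ℕ.≤-trans (ℕ.m≤m+n 61 28) 89≤q))
        where
        lhs : ∀ q → 61 ℕ.+ 5 ℕ.* q ≡ 10 ℕ.+ (50 ℕ.+ 5 ℕ.* q) ℕ.+ 1
        lhs = solve-∀
        rhs : ∀ q → q ℕ.+ 5 ℕ.* q ≡ q ℕ.* 6 ℕ.+ 0
        rhs = solve-∀
      bound′ : (m ℕ.+ 5) ℕ.* 10 ℕ.+ 0 ℕ.≤ 50 ℕ.+ 5 ℕ.* q ℕ.+ (m ℕ.+ 5) ℕ.* 0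
      bound′ = ≡.subst (λ q → (m ℕ.+ 5) ℕ.* 10 ℕ.+ 0 ℕ.≤ 50 ℕ.+ 5 ℕ.* q ℕ.+ (m ℕ.+ 5) ℕ.* 0) {suc (m ℕ.+ m)} {q} (≡.sym q≡1+2m)
          (≡.subst ((m ℕ.+ 5) ℕ.* 10 ℕ.+ 0 ℕ.≤_) (rhs m) (ℕ.m≤m+n _ 5))
        where
        rhs : ∀ m → (m ℕ.+ 5) ℕ.* 10 ℕ.+ 0 ℕ.+ 5 ≡ 50 ℕ.+ 5 ℕ.* suc (m ℕ.+ m) ℕ.+ (m ℕ.+ 5) ℕ.* 0
        rhs = solve-∀

    module _ (f^m : ∀ a → ev f a ≈ 0# ⊎ ev f a ^ m ≈ 1#) (a₀ : Carrier) (f[a₀]≉0 : ev f a₀ ≉0) where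

      ev-T : ∀ a → ev (T X) a ≈ ev f a ^ 5
      ev-T a = begin
        ev (f ^ₚ 5 +ₚ X *ₚ W) a ≈⟨ ev-+ (f ^ₚ 5) (X *ₚ W) a ⟩
        ev (f ^ₚ 5) a + ev (X *ₚ W) a ≈⟨ +-cong (ev-^ f 5 a) (trans (ev-* X W a) (trans (*-congʳ (ev-X a)) (zeroˡ _))) ⟩
        ev f a ^ 5 + 0# ≈⟨ +-identityʳ _ ⟩
        ev f a ^ 5 ∎
        where
        open import Relation.Binary.Reasoning.Setoid setoid
        W = H.horner 5 (λ k → τ (suc k)) X

      X∣ : ∀ a → linear a ∣ₚ X
      X∣ a = ev-root⇒∣ a X (ev-X a)

      -- Both parts of f Ψ = f⁶ f^m - f T have the sixth power of the linear factor: the first since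
      -- `f` has the factor, the second by `F*T-divisible`, since X has it too.
      fΨ-divisible-root : ∀ a → ev f a ≈ 0# → linear a ^ₚ 6 ∣ₚ f *ₚ Ψ
      fΨ-divisible-root a e with ev-root⇒∣ a f e | X∣ a
      ... | f′ , f≈lf′ | X′ , X≈lX′ = f′ ^ₚ 6 *ₚ f ^ₚ m +ₚ (-ₚ (f′ *ₚ W)) , eq
        where
        l = linear a
        W = f′ ^ₚ 5 +ₚ X′ *ₚ (p₁ *ₚ f′ ^ₚ 4 +ₚ X′ *ₚ (p₂ *ₚ f′ ^ₚ 3 +ₚ X′ *ₚ (p₃ *ₚ f′ ^ₚ 2 +ₚ X′ *ₚ (p₄ *ₚ f′ +ₚ X′ *ₚ p₅))))
        T-congX : T X ≈ₚ T (l *ₚ X′)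
        T-congX = horner-congʳ 6 {τ} X≈lX′
          where
          horner-congʳ : ∀ n {τ y z} → y ≈ₚ z → H.horner n τ y ≈ₚ H.horner n τ z
          horner-congʳ zero e = ≈ₚ.refl
          horner-congʳ (suc n) {τ} e = +ₚ-cong (≈ₚ.refl {τ 0}) (*ₚ-cong e (horner-congʳ n e))
        eq : f *ₚ Ψ ≈ₚ l ^ₚ 6 *ₚ (f′ ^ₚ 6 *ₚ f ^ₚ m +ₚ (-ₚ (f′ *ₚ W)))
        eq = begin
          f *ₚ (f^[m+5] +ₚ (-ₚ T X)) ≈⟨ *ₚ-cong (≈ₚ.refl {f}) (+ₚ-cong (^ₚ-homo-* f m 5) (-ₚ-cong T-congX)) ⟩
          f *ₚ (f ^ₚ m *ₚ f ^ₚ 5 +ₚ (-ₚ T (l *ₚ X′)))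
            ≈⟨ PS.solve 3 (λ f u t → f ⊗ (u ⊗ f ⊛ 5 ⊕ ⊝ t) ⊜ f ⊛ 6 ⊗ u ⊕ ⊝ (f ⊗ t)) ≈ₚ.refl f (f ^ₚ m) (T (l *ₚ X′)) ⟩
          f ^ₚ 6 *ₚ f ^ₚ m +ₚ (-ₚ (f *ₚ T (l *ₚ X′)))
            ≈⟨ +ₚ-cong (*ₚ-cong (≈ₚ.trans (^ₚ-congˡ 6 f≈lf′) (^ₚ-distrib-* l f′ 6)) (≈ₚ.refl {f ^ₚ m}))
                 (-ₚ-cong (F*T-divisible l f′ X′ f≈lf′)) ⟩
          (l ^ₚ 6 *ₚ f′ ^ₚ 6) *ₚ f ^ₚ m +ₚ (-ₚ (l ^ₚ 6 *ₚ (f′ *ₚ W)))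
            ≈⟨ PS.solve 4 (λ l f u v → (l ⊗ f) ⊗ u ⊕ ⊝ (l ⊗ v) ⊜ l ⊗ (f ⊗ u ⊕ ⊝ v)) ≈ₚ.refl (l ^ₚ 6) (f′ ^ₚ 6) (f ^ₚ m) (f′ *ₚ W) ⟩
          l ^ₚ 6 *ₚ (f′ ^ₚ 6 *ₚ f ^ₚ m +ₚ (-ₚ (f′ *ₚ W))) ∎
          where open ≈ₚ-Reasoning

      -- X⁶ divides Ψ Ψ⁺, and Ψ⁺(a) = f(a)^m f(a)⁵ + f(a)⁵ = 2 f(a)⁵ is nonzero, so the sixth power
      -- of the linear factor passes to Ψ.
      fΨ-divisible-nonroot : ∀ a → ev f a ≉0 → ev f a ^ m ≈ 1# → linear a ^ₚ 6 ∣ₚ f *ₚ Ψ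
      fΨ-divisible-nonroot a f≉0 e with X∣ a
      ... | X′ , X≈lX′ = f *ₚ proj₁ divΨ , ≈ₚ.trans (*ₚ-cong (≈ₚ.refl {f}) (proj₂ divΨ))
          (PS.solve 3 (λ f l d → f ⊗ (l ⊗ d) ⊜ l ⊗ (f ⊗ d)) ≈ₚ.refl f (linear a ^ₚ 6) (proj₁ divΨ))
        where
        Ψ⁺≉0 : ev Ψ⁺ a ≉0
        Ψ⁺≉0 = ≉0-resp (sym (begin
          ev Ψ⁺ a ≈⟨ ev-+ f^[m+5] (T X) a ⟩
          ev f^[m+5] a + ev (T X) a ≈⟨ +-cong (trans (ev-^ f (m ℕ.+ 5) a) (^-homo-* (ev f a) m 5)) (ev-T a) ⟩
          ev f a ^ m * ev f a ^ 5 + ev f a ^ 5 ≈⟨ +-congʳ (*-congʳ e) ⟩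
          1# * ev f a ^ 5 + ev f a ^ 5 ≈⟨ solve 1 (λ x → κ 1 ⊗ x ⊕ x ⊜ κ 2 ⊗ x) refl (ev f a ^ 5) ⟩
          (1# + 1#) * ev f a ^ 5 ∎)) (*-≉0 2≉0 (^-≉0 5 f≉0))
          where open import Relation.Binary.Reasoning.Setoid setoid
        divΨ : linear a ^ₚ 6 ∣ₚ Ψ
        divΨ = linear^-∣-cancel a 6 {Ψ} {Ψ⁺} Ψ⁺≉0 (X′ ^ₚ 6 *ₚ H.horner 5 u X , ≈ₚ.trans Ψ*Ψ⁺
          (≈ₚ.trans (*ₚ-cong (≈ₚ.trans (^ₚ-congˡ 6 X≈lX′) (^ₚ-distrib-* (linear a) X′ 6)) (≈ₚ.refl {H.horner 5 u X}))
            (*ₚ-assoc (linear a ^ₚ 6) (X′ ^ₚ 6) (H.horner 5 u X))))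

      fΨ-divisible : ∀ a → linear a ^ₚ 6 ∣ₚ f *ₚ Ψ
      fΨ-divisible a with ev f a ≟ 0# | f^m a
      ... | yes e | _ = fΨ-divisible-root a e
      ... | no ne | inj₁ e = fΨ-divisible-root a e
      ... | no ne | inj₂ e = fΨ-divisible-nonroot a ne e

      f≉[] : ¬ f ≈ₚ []
      f≉[] e = f[a₀]≉0 (ev-zero f a₀ e)

      Ψ≈[] : Ψ ≈ₚ []
      Ψ≈[] = *ₚ-cancel-0 f Ψ f≉[] (roots⇒zero-everywhere 6 fΨ-divisible Deg-fΨ)

      X≉[] : ¬ X ≈ₚ []
      X≉[] e = 1≉0 (begin
        1# ≈⟨ solve 0 (κ 1 ⊜ ⊝ (κ 0 ⊕ ⊝ κ 1)) refl ⟩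
        -- The coefficient of t in t^q - t is -1, because q is at least 2.
        - (0# + - 1#) ≈⟨ -‿cong (+-congʳ (coeff-var^ q (ℕ.≤-trans (ℕ.m≤m+n 2 87) 89≤q))) ⟨
        - (coeff (var ^ₚ q) 1 + - 1#) ≈⟨ -‿cong (coeff-+ (var ^ₚ q) (-ₚ var) 1) ⟨
        - coeff X 1 ≈⟨ -‿cong (at e 1) ⟩
        - 0# ≈⟨ solve 0 (⊝ κ 0 ⊜ κ 0) refl ⟩
        0# ∎)
        where
        open import Relation.Binary.Reasoning.Setoid setoid
        coeff-var^ : ∀ n → 2 ℕ.≤ n → coeff (var ^ₚ n) 1 ≈ 0#
        coeff-var^ (suc zero) (ℕ.s≤s ())
        coeff-var^ (suc (suc n)) _ = at (≈ₚ.trans (^ₚ-suc var (suc n)) (≈ₚ.trans (var-* (var ^ₚ suc n))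
          (∷-cong refl (≈ₚ.trans (^ₚ-suc var n) (var-* (var ^ₚ n)))))) 1

      -- Uniqueness of base-X digits of degree below q: at field elements X vanishes, so v₀ has q
      -- zeros and is zero; then X is cancelled and the next digit follows.
      digits-zero : ∀ n v → (∀ k → Deg 1 q (v k)) → H.horner n v X ≈ₚ [] → ∀ k → k ℕ.< n → v k ≈ₚ []
      digits-zero (suc n) v Deg-v e = λ where
          zero _ → v₀≈[]
          (suc k) (ℕ.s≤s lt) → digits-zero n (λ k → v (suc k)) (λ k → Deg-v (suc k)) rest≈[] k lt
        where
        rest = H.horner n (λ k → v (suc k)) X
        v₀≈[] : v 0 ≈ₚ []
        v₀≈[] = vanishing⇒zero (λ a → begin
          ev (v 0) a ≈⟨ solve 2 (λ u w → u ⊜ (u ⊕ κ 0 ⊗ w)) refl (ev (v 0) a) (ev rest a) ⟩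
          ev (v 0) a + 0# * ev rest a ≈⟨ +-congˡ (*-congʳ (ev-X a)) ⟨
          ev (v 0) a + ev X a * ev rest a ≈⟨ +-congˡ (ev-* X rest a) ⟨
          ev (v 0) a + ev (X *ₚ rest) a ≈⟨ ev-+ (v 0) (X *ₚ rest) a ⟨
          ev (v 0 +ₚ X *ₚ rest) a ≈⟨ ev-zero (v 0 +ₚ X *ₚ rest) a e ⟩
          0# ∎) (Deg-v 0)
          where open import Relation.Binary.Reasoning.Setoid setoid
        rest≈[] : rest ≈ₚ []
        rest≈[] = *ₚ-cancel-0 X rest X≉[] (≈ₚ.trans (+ₚ-cong (≈ₚ.sym v₀≈[]) (≈ₚ.refl {X *ₚ rest})) e)

      -- Ψ = 0 leaves X⁶ (u₀ + u₁ X + ⋯ + u₄ X⁴) = 0, an equation between base-X digits.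
      u≈[] : ∀ k → u k ≈ₚ []
      u≈[] k with k ℕ.<? 5
      ... | yes k<5 = digits-zero 5 u Deg-u (cancel-X^ 6 (≈ₚ.trans (≈ₚ.sym Ψ*Ψ⁺) (*ₚ-cong Ψ≈[] (≈ₚ.refl {Ψ⁺})))) k k<5
        where
        cancel-X^ : ∀ n {w} → X ^ₚ n *ₚ w ≈ₚ [] → w ≈ₚ []
        cancel-X^ zero {w} e = ≈ₚ.trans (≈ₚ.sym (*ₚ-identityˡ w)) e
        cancel-X^ (suc n) {w} e = cancel-X^ n (*ₚ-cancel-0 X (X ^ₚ n *ₚ w) X≉[] (≈ₚ.trans (≈ₚ.sym (*ₚ-assoc X (X ^ₚ n) w))
          (≈ₚ.trans (*ₚ-cong (≈ₚ.sym (^ₚ-suc X n)) (≈ₚ.refl {w})) e)))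
      ... | no k≮5 = large k k≮5
        where
        large : ∀ k → ¬ k ℕ.< 5 → u k ≈ₚ []
        large (suc (suc (suc (suc (suc k))))) _ = ≈ₚ.refl
        large 0 n = ⊥-elim (n (ℕ.s≤s ℕ.z≤n))
        large 1 n = ⊥-elim (n (ℕ.s≤s (ℕ.s≤s ℕ.z≤n)))
        large 2 n = ⊥-elim (n (ℕ.s≤s (ℕ.s≤s (ℕ.s≤s ℕ.z≤n))))
        large 3 n = ⊥-elim (n (ℕ.s≤s (ℕ.s≤s (ℕ.s≤s (ℕ.s≤s ℕ.z≤n)))))
        large 4 n = ⊥-elim (n (ℕ.s≤s (ℕ.s≤s (ℕ.s≤s (ℕ.s≤s (ℕ.s≤s ℕ.z≤n))))))

      t : ℕ → Carrier
      t k = ev (τ k) a₀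

      -- The polynomial z ↦ T(z - a₀), with the coefficients of T evaluated at `a₀`.
      root : Poly
      root = comp (t 0 ∷ t 1 ∷ t 2 ∷ t 3 ∷ t 4 ∷ t 5 ∷ []) (linear a₀)

      private
        module HK = Horner commutativeRing

        ev-horner : ∀ n v y a → ev (H.horner n v y) a ≈ HK.horner n (λ k → ev (v k) a) (ev y a)
        ev-horner zero v y a = refl
        ev-horner (suc n) v y a = trans (ev-+ (v 0) (y *ₚ H.horner n (λ k → v (suc k)) y) a)
          (+-congˡ (trans (ev-* y (H.horner n (λ k → v (suc k)) y) a) (*-congˡ (ev-horner n (λ k → v (suc k)) y a))))

        -- With all `u k` zero, F⁹ f(t + y) = T(y)² holds for every y. Taking y = z - t makes the
        -- left argument constant, and evaluation at t = `a₀` gives the claim.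
        value : ∀ z → ev f a₀ ^ 9 * ev f z ≈ ev root z * ev root z
        value z = begin
          ev f a₀ ^ 9 * ev f z ≈⟨ *-cong (sym (ev-^ f 9 a₀)) f[z] ⟩
          ev (f ^ₚ 9) a₀ * ev Fz a₀ ≈⟨ ev-* (f ^ₚ 9) Fz a₀ ⟨
          ev (f ^ₚ 9 *ₚ Fz) a₀ ≈⟨ ev-cong {f ^ₚ 9 *ₚ Fz} {T y *ₚ T y} a₀ square ⟩
          ev (T y *ₚ T y) a₀ ≈⟨ ev-* (T y) (T y) a₀ ⟩
          ev (T y) a₀ * ev (T y) a₀ ≈⟨ *-cong T[a₀] T[a₀] ⟩
          ev root z * ev root z ∎
          where
          open import Relation.Binary.Reasoning.Setoid setoid
          y = C z +ₚ (-ₚ var)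
          Fz = H.horner 11 (λ k → hasse k f) y
          f[z] : ev f z ≈ ev Fz a₀
          f[z] = sym (trans (ev-cong {Fz} {comp f (C z)} a₀ (≈ₚ.trans (≈ₚ.sym (H.horner-cong 11 y (λ k → comp-var (hasse k f))))
              (≈ₚ.trans (≈ₚ.sym (Taylor.taylor commutativeRing polyRing constHom 11 f var y length-f))
                (Comp.ev-congʳ f {var +ₚ y} {C z} (PS.solve 2 (λ u v → u ⊕ (v ⊕ ⊝ u) ⊜ v) ≈ₚ.refl var (C z))))))
            (trans (ev-comp f (C z) a₀) (ev-congʳ f (ev-C z a₀))))
          square : f ^ₚ 9 *ₚ Fz ≈ₚ T y *ₚ T y
          square = ≈ₚ.trans (PS.solve 2 (λ u v → u ⊜ (u ⊕ ⊝ v) ⊕ v) ≈ₚ.refl (f ^ₚ 9 *ₚ Fz) (T y *ₚ T y))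
            (+ₚ-cong (≈ₚ.trans (T² y) (≈ₚ.trans (*ₚ-cong (≈ₚ.refl {y ^ₚ 6}) (H.horner-zero 5 y u≈[])) (*ₚ-zeroʳ (y ^ₚ 6))))
              (≈ₚ.refl {T y *ₚ T y}))
          T[a₀] : ev (T y) a₀ ≈ ev root z
          T[a₀] = trans (ev-horner 6 τ y a₀) (trans (horner-congʳ 6 {t} ev-y)
              (sym (ev-comp (t 0 ∷ t 1 ∷ t 2 ∷ t 3 ∷ t 4 ∷ t 5 ∷ []) (linear a₀) z)))
            where
            horner-congʳ : ∀ n {τ y z} → y ≈ z → HK.horner n τ y ≈ HK.horner n τ z
            horner-congʳ zero e = refl
            horner-congʳ (suc n) e = +-congˡ (*-cong e (horner-congʳ n e))
            ev-y : ev y a₀ ≈ ev (linear a₀) z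
            ev-y = trans (ev-+ (C z) (-ₚ var) a₀) (trans (+-cong (ev-C z a₀) (trans (ev-neg var a₀) (-‿cong (ev-var a₀))))
              (sym (ev-linear a₀ z)))

        Deg-comp-linear : ∀ r n → length r ℕ.≤ suc n → Deg 0 n (comp r (linear a₀))
        Deg-comp-linear [] n _ = Deg-[]
        Deg-comp-linear (b ∷ []) n _ = Deg-+ (Deg-weaken ℕ.z≤n (Deg-C b)) (Deg-resp (≈ₚ.sym (*ₚ-zeroʳ (linear a₀))) Deg-[])
        Deg-comp-linear (b ∷ r@(_ ∷ _)) (suc n) (ℕ.s≤s le) = Deg-+ (Deg-weaken ℕ.z≤n (Deg-C b))
          (Deg-* (Deg-∷ ℕ.z≤n (Deg-∷ ℕ.≤-refl Deg-[])) (Deg-comp-linear r n le))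

      Deg-root : Deg 0 5 root
      Deg-root = Deg-comp-linear (t 0 ∷ t 1 ∷ t 2 ∷ t 3 ∷ t 4 ∷ t 5 ∷ []) 5 ℕ.≤-refl

      multiple-square : (ev f a₀ ^ 9) ·ₚ f ≈ₚ root *ₚ root
      multiple-square = ≈ₚ.trans (PS.solve 2 (λ u v → u ⊜ (u ⊕ ⊝ v) ⊕ v) ≈ₚ.refl ef (root *ₚ root))
          (+ₚ-cong (vanishing⇒zero vanishes (Deg-weaken {0} {10} {1} {q}
            (ℕ.≤-trans (ℕ.≤-trans (ℕ.m≤m+n 11 78) 89≤q) (ℕ.m≤m+n q 0)) (Deg-+ (Deg-· e Deg-f) (Deg-neg (Deg-* Deg-root Deg-root)))))
            (≈ₚ.refl {root *ₚ root}))
        where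
        e = ev f a₀ ^ 9
        ef = e ·ₚ f
        vanishes : ∀ z → ev (ef +ₚ (-ₚ (root *ₚ root))) z ≈ 0#
        vanishes z = trans (ev-+ ef (-ₚ (root *ₚ root)) z) (trans (+-cong (ev-· e f z) (trans (ev-neg (root *ₚ root) z) (-‿cong (ev-* root root z))))
          (x≈y⇒x-y≈0 (value z)))

-- The polynomial of degree 10, and when it is a multiple of a square.

module Decic {c ℓ} (K : Field c ℓ) (q : ℕ) (card : HasCardinality K q) (89≤q : 89 ℕ.≤ q) (3-nonsquare : ¬ ThreeIsSquare K) where
  open Field K hiding (zero)
  open IntegerSolver commutativeRing using (solve; ⟦_⟧ℤ)
  open Polynomial commutativeRing
  open Degree commutativeRing
  open FieldLemmas K
  open FiniteField K q card
  open import Algebra.Properties.CommutativeSemiring.Exp.TCOptimised commutativeSemiring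
    using (_^_)
  open import Relation.Binary.Reasoning.Setoid setoid

  #_ : ℕ → Carrier
  # n = ⟦ + n ⟧ℤ

  -- If 2 were 0, then 3 = 1 would be a square; likewise 3 = 0 would be one. So 2 and 3 are
  -- invertible.
  2≉0 : # 2 ≉0
  2≉0 e = 3-nonsquare (1# , (begin
    1# * 1# ≈⟨ solve 0 (κ 1 ⊗ κ 1 ⊜ κ 3 ⊕ ⊝ κ 2) refl ⟩
    # 3 + - # 2 ≈⟨ +-congˡ (-‿cong e) ⟩
    # 3 + - 0# ≈⟨ solve 0 (κ 3 ⊕ ⊝ κ 0 ⊜ κ 3) refl ⟩
    # 3 ∎))

  3≉0 : # 3 ≉0
  3≉0 e = 3-nonsquare (0# , trans (zeroˡ 0#) (sym e))

  h : Carrier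
  h = proj₁ (inverse (# 2) 2≉0)

  2h≈1 : # 2 * h ≈ 1#
  2h≈1 = proj₂ (inverse (# 2) 2≉0)

  h+h≈1 : h + h ≈ 1#
  h+h≈1 = trans (solve 1 (λ h → h ⊕ h ⊜ κ 2 ⊗ h) refl h) 2h≈1

  θ : Carrier
  θ = proj₁ (inverse (# 3) 3≉0)

  3θ≈1 : # 3 * θ ≈ 1#
  3θ≈1 = proj₂ (inverse (# 3) 3≉0)

  6≉0 : # 6 ≉0
  6≉0 = ≉0-resp (solve 0 (κ 2 ⊗ κ 3 ⊜ κ 6) refl) (*-≉0 2≉0 3≉0)

  nonroot : ∀ p → ¬ p ≈ₚ [] → Deg 1 q p → ∃ λ a → ev p a ≉0
  nonroot p p≉[] d with ∃? {P = λ a → ev p a ≉0} (λ e → ≉0-resp (ev-congʳ p e)) (λ a → ¬? (ev p a ≟ 0#))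
  ... | yes found = found
  ... | no none = ⊥-elim (p≉[] (vanishing⇒zero vanishes d))
    where
    vanishes : ∀ a → ev p a ≈ 0#
    vanishes a with ev p a ≟ 0#
    ... | yes e = e
    ... | no ne = ⊥-elim (none (a , ne))

  module _ (b c d : Carrier) where

    -- One third of 9γ² - 6φη for the `φ`, `γ`, `η` attached to the point (1, 0, b, c, d). These are
    -- monic of degrees 4, 5 and 6, so the combination has leading coefficient 3 and the quotient is
    -- monic.
    decic : Poly
    decic = (# 54 * (b * b * b * d) + - (# 36 * (b * b * c * c)))
          ∷ (# 108 * (b * c * d) + - (# 64 * (c * c * c)))
          ∷ (# 27 * (d * d) + - (# 162 * (b * b * d)) + # 72 * (b * c * c))
          ∷ (# 72 * (b * b * c) + - (# 108 * (c * d)))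
          ∷ (# 156 * (c * c) + - (# 54 * (b * b * b)) + # 54 * (b * d))
          ∷ (- (# 252 * (b * c)))
          ∷ (# 126 * (b * b))
          ∷ (- (# 12 * c))
          ∷ (# 18 * b)
          ∷ 0#
          ∷ 1# ∷ []

    Deg-decic : Deg 1 q decic
    Deg-decic = Deg-length decic (ℕ.≤-trans (ℕ.m≤m+n 11 78) 89≤q)

    w : Carrier
    w = h * (# 45 * (b * b))

    2w≈ : w + w ≈ # 45 * (b * b)
    2w≈ = trans (solve 2 (λ h x → h ⊗ x ⊕ h ⊗ x ⊜ κ 2 ⊗ h ⊗ x) refl h (# 45 * (b * b))) (trans (*-congʳ 2h≈1) (*-identityˡ _))

    -- The polynomial part of the square root of `decic`: its coefficients are determined in turn by
    -- those of degrees 9 down to 5. The remainder therefore has degree at most 4, as the Stepanov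
    -- argument demands.
    quintic : Poly
    quintic = (- (# 72 * (b * c))) ∷ w ∷ (- (# 6 * c)) ∷ (# 9 * b) ∷ 0# ∷ 1# ∷ []

    remainder : Poly
    remainder = (# 54 * (b * b * b * d) + - (# 5220 * (b * b * c * c)))
              ∷ (# 108 * (b * c * d) + - (# 64 * (c * c * c)) + # 144 * (b * c * w))
              ∷ (# 27 * (d * d) + - (# 162 * (b * b * d)) + - (# 792 * (b * c * c)) + - (w * w))
              ∷ (# 1368 * (b * b * c) + - (# 108 * (c * d)) + # 12 * (c * w))
              ∷ (# 120 * (c * c) + - (# 54 * (b * b * b)) + # 54 * (b * d) + - (# 18 * (b * w)))
              ∷ []

    decic≈ : decic ≈ₚ quintic *ₚ quintic +ₚ remainder
    decic≈ = ≈ₚ.trans (PS.solve 2 (λ u v → u ⊜ (u ⊕ ⊝ v) ⊕ v) ≈ₚ.refl decic (quintic *ₚ quintic +ₚ remainder))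
        (+ₚ-cong (vanishing⇒zero vanishes (Deg-+ Deg-decic (Deg-neg (Deg-+ Deg-sq Deg-rem)))) (≈ₚ.refl {quintic *ₚ quintic +ₚ remainder}))
      where
      module PS = IntegerSolver polyRing
      Deg-quintic : Deg 0 5 quintic
      Deg-quintic = Deg-weaken (ℕ.≤-reflexive ≡.refl) (Deg-length quintic {6} ℕ.≤-refl)
      Deg-sq : Deg 1 q (quintic *ₚ quintic)
      Deg-sq = Deg-weaken (ℕ.≤-trans (ℕ.≤-trans (ℕ.m≤m+n 11 78) 89≤q) (ℕ.m≤m+n q 0)) (Deg-* Deg-quintic Deg-quintic)
      Deg-rem : Deg 1 q remainder
      Deg-rem = Deg-length remainder (ℕ.≤-trans (ℕ.m≤m+n 5 84) 89≤q)
      expand : ∀ s → ev decic s ≈ ev quintic s * ev quintic s + ev remainder s + s ^ 6 * (# 45 * (b * b) + - (w + w))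
      expand s = solve 5 (λ b c d w s →
        let r0 = κ 54 ⊗ (b ⊗ b ⊗ b ⊗ d) ⊕ ⊝ (κ 36 ⊗ (b ⊗ b ⊗ c ⊗ c))
            r1 = κ 108 ⊗ (b ⊗ c ⊗ d) ⊕ ⊝ (κ 64 ⊗ (c ⊗ c ⊗ c))
            r2 = κ 27 ⊗ (d ⊗ d) ⊕ ⊝ (κ 162 ⊗ (b ⊗ b ⊗ d)) ⊕ κ 72 ⊗ (b ⊗ c ⊗ c)
            r3 = κ 72 ⊗ (b ⊗ b ⊗ c) ⊕ ⊝ (κ 108 ⊗ (c ⊗ d))
            r4 = κ 156 ⊗ (c ⊗ c) ⊕ ⊝ (κ 54 ⊗ (b ⊗ b ⊗ b)) ⊕ κ 54 ⊗ (b ⊗ d)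
            p = ⊝ (κ 72 ⊗ (b ⊗ c)) ⊕ s ⊗ (w ⊕ s ⊗ (⊝ (κ 6 ⊗ c) ⊕ s ⊗ (κ 9 ⊗ b ⊕ s ⊗ (κ 0 ⊕ s ⊗ (κ 1 ⊕ s ⊗ κ 0)))))
            t0 = κ 54 ⊗ (b ⊗ b ⊗ b ⊗ d) ⊕ ⊝ (κ 5220 ⊗ (b ⊗ b ⊗ c ⊗ c))
            t1 = κ 108 ⊗ (b ⊗ c ⊗ d) ⊕ ⊝ (κ 64 ⊗ (c ⊗ c ⊗ c)) ⊕ κ 144 ⊗ (b ⊗ c ⊗ w)
            t2 = κ 27 ⊗ (d ⊗ d) ⊕ ⊝ (κ 162 ⊗ (b ⊗ b ⊗ d)) ⊕ ⊝ (κ 792 ⊗ (b ⊗ c ⊗ c)) ⊕ ⊝ (w ⊗ w)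
            t3 = κ 1368 ⊗ (b ⊗ b ⊗ c) ⊕ ⊝ (κ 108 ⊗ (c ⊗ d)) ⊕ κ 12 ⊗ (c ⊗ w)
            t4 = κ 120 ⊗ (c ⊗ c) ⊕ ⊝ (κ 54 ⊗ (b ⊗ b ⊗ b)) ⊕ κ 54 ⊗ (b ⊗ d) ⊕ ⊝ (κ 18 ⊗ (b ⊗ w))
        in r0 ⊕ s ⊗ (r1 ⊕ s ⊗ (r2 ⊕ s ⊗ (r3 ⊕ s ⊗ (r4 ⊕ s ⊗ (⊝ (κ 252 ⊗ (b ⊗ c)) ⊕ s ⊗ (κ 126 ⊗ (b ⊗ b)
             ⊕ s ⊗ (⊝ (κ 12 ⊗ c) ⊕ s ⊗ (κ 18 ⊗ b ⊕ s ⊗ (κ 0 ⊕ s ⊗ (κ 1 ⊕ s ⊗ κ 0))))))))))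
          ⊜ p ⊗ p ⊕ (t0 ⊕ s ⊗ (t1 ⊕ s ⊗ (t2 ⊕ s ⊗ (t3 ⊕ s ⊗ (t4 ⊕ s ⊗ κ 0))))) ⊕ s ⊛ 6 ⊗ (κ 45 ⊗ (b ⊗ b) ⊕ ⊝ (w ⊕ w)))
        refl b c d w s
      vanishes : ∀ s → ev (decic +ₚ (-ₚ (quintic *ₚ quintic +ₚ remainder))) s ≈ 0#
      vanishes s = trans (ev-+ decic (-ₚ (quintic *ₚ quintic +ₚ remainder)) s) (trans (+-congˡ (ev-neg (quintic *ₚ quintic +ₚ remainder) s)) (x≈y⇒x-y≈0 (begin
        ev decic s ≈⟨ expand s ⟩
        ev quintic s * ev quintic s + ev remainder s + s ^ 6 * (# 45 * (b * b) + - (w + w))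
          ≈⟨ +-cong (+-congʳ (sym (ev-* quintic quintic s))) (trans (*-congˡ (x≈y⇒x-y≈0 (sym 2w≈))) (zeroʳ _)) ⟩
        ev (quintic *ₚ quintic) s + ev remainder s + 0# ≈⟨ +-identityʳ _ ⟩
        ev (quintic *ₚ quintic) s + ev remainder s ≈⟨ ev-+ (quintic *ₚ quintic) remainder s ⟨
        ev (quintic *ₚ quintic +ₚ remainder) s ∎)))

    module Square (r₀ r₁ r₂ r₃ r₄ : Carrier)
      (square : ∀ s → ev decic s ≈ ev (r₀ ∷ r₁ ∷ r₂ ∷ r₃ ∷ r₄ ∷ 1# ∷ []) s * ev (r₀ ∷ r₁ ∷ r₂ ∷ r₃ ∷ r₄ ∷ 1# ∷ []) s) where

      squareList : Poly
      squareList = (r₀ * r₀) ∷ (# 2 * (r₀ * r₁)) ∷ (# 2 * (r₀ * r₂) + r₁ * r₁) ∷ (# 2 * (r₀ * r₃ + r₁ * r₂))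
        ∷ (# 2 * (r₀ * r₄ + r₁ * r₃) + r₂ * r₂) ∷ (# 2 * (r₀ + r₁ * r₄ + r₂ * r₃)) ∷ (# 2 * (r₁ + r₂ * r₄) + r₃ * r₃)
        ∷ (# 2 * (r₂ + r₃ * r₄)) ∷ (# 2 * r₃ + r₄ * r₄) ∷ (# 2 * r₄) ∷ 1# ∷ []

      decic≈squareList : decic ≈ₚ squareList
      decic≈squareList = ≈ₚ.trans (PS.solve 2 (λ u v → u ⊜ (u ⊕ ⊝ v) ⊕ v) ≈ₚ.refl decic squareList)
          (+ₚ-cong (vanishing⇒zero vanishes (Deg-+ Deg-decic (Deg-neg (Deg-length squareList (ℕ.≤-trans (ℕ.m≤m+n 11 78) 89≤q))))) (≈ₚ.refl {squareList}))
        where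
        module PS = IntegerSolver polyRing
        vanishes : ∀ s → ev (decic +ₚ (-ₚ squareList)) s ≈ 0#
        vanishes s = trans (ev-+ decic (-ₚ squareList) s) (trans (+-congˡ (ev-neg squareList s)) (x≈y⇒x-y≈0 (trans (square s)
          (solve 6 (λ r0 r1 r2 r3 r4 s →
            let p = r0 ⊕ s ⊗ (r1 ⊕ s ⊗ (r2 ⊕ s ⊗ (r3 ⊕ s ⊗ (r4 ⊕ s ⊗ (κ 1 ⊕ s ⊗ κ 0)))))
            in p ⊗ p ⊜ r0 ⊗ r0 ⊕ s ⊗ (κ 2 ⊗ (r0 ⊗ r1) ⊕ s ⊗ (κ 2 ⊗ (r0 ⊗ r2) ⊕ r1 ⊗ r1 ⊕ s ⊗ (κ 2 ⊗ (r0 ⊗ r3 ⊕ r1 ⊗ r2)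
              ⊕ s ⊗ (κ 2 ⊗ (r0 ⊗ r4 ⊕ r1 ⊗ r3) ⊕ r2 ⊗ r2 ⊕ s ⊗ (κ 2 ⊗ (r0 ⊕ r1 ⊗ r4 ⊕ r2 ⊗ r3) ⊕ s ⊗ (κ 2 ⊗ (r1 ⊕ r2 ⊗ r4) ⊕ r3 ⊗ r3
              ⊕ s ⊗ (κ 2 ⊗ (r2 ⊕ r3 ⊗ r4) ⊕ s ⊗ (κ 2 ⊗ r3 ⊕ r4 ⊗ r4 ⊕ s ⊗ (κ 2 ⊗ r4 ⊕ s ⊗ (κ 1 ⊕ s ⊗ κ 0))))))))))) refl r₀ r₁ r₂ r₃ r₄ s))))

      private
        eq : ∀ k → coeff squareList k ≈ coeff decic k
        eq k = sym (at decic≈squareList k)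

        halve : ∀ {x y} → # 2 * x ≈ # 2 * y → x ≈ y
        halve = *-cancelˡ 2≉0

        -- The coefficients of degrees 9 to 5 determine the root, with r₁ known through 2 r₁. Those
        -- of degrees 4 to 0 then become the conditions `E₄`, ..., `E₀` on b, c and d.
        r₄≈ : r₄ ≈ 0#
        r₄≈ = *-cancelˡ-0 2≉0 (eq 9)
        r₃≈ : r₃ ≈ # 9 * b
        r₃≈ = halve (begin
          # 2 * r₃ ≈⟨ solve 1 (λ x → x ⊜ x ⊕ κ 0 ⊗ κ 0) refl _ ⟩
          # 2 * r₃ + 0# * 0# ≈⟨ +-congˡ (*-cong r₄≈ r₄≈) ⟨
          # 2 * r₃ + r₄ * r₄ ≈⟨ eq 8 ⟩
          # 18 * b ≈⟨ solve 1 (λ b → κ 18 ⊗ b ⊜ κ 2 ⊗ (κ 9 ⊗ b)) refl b ⟩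
          # 2 * (# 9 * b) ∎)
        r₂≈ : r₂ ≈ - (# 6 * c)
        r₂≈ = halve (begin
          # 2 * r₂ ≈⟨ solve 2 (λ x y → κ 2 ⊗ x ⊜ κ 2 ⊗ (x ⊕ y ⊗ κ 0)) refl r₂ r₃ ⟩
          # 2 * (r₂ + r₃ * 0#) ≈⟨ *-congˡ (+-congˡ (*-congˡ r₄≈)) ⟨
          # 2 * (r₂ + r₃ * r₄) ≈⟨ eq 7 ⟩
          - (# 12 * c) ≈⟨ solve 1 (λ b → ⊝ (κ 12 ⊗ b) ⊜ κ 2 ⊗ ⊝ (κ 6 ⊗ b)) refl c ⟩
          # 2 * - (# 6 * c) ∎)
        2r₁≈ : # 2 * r₁ ≈ # 45 * (b * b)
        2r₁≈ = begin
          # 2 * r₁ ≈⟨ solve 3 (λ x y b → κ 2 ⊗ x ⊜ (κ 2 ⊗ (x ⊕ y ⊗ κ 0) ⊕ (κ 9 ⊗ b) ⊗ (κ 9 ⊗ b)) ⊕ ⊝ (κ 81 ⊗ (b ⊗ b))) refl r₁ r₂ b ⟩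
          (# 2 * (r₁ + r₂ * 0#) + (# 9 * b) * (# 9 * b)) + - (# 81 * (b * b))
            ≈⟨ +-congʳ (+-cong (*-congˡ (+-congˡ (*-congˡ r₄≈))) (*-cong r₃≈ r₃≈)) ⟨
          (# 2 * (r₁ + r₂ * r₄) + r₃ * r₃) + - (# 81 * (b * b)) ≈⟨ +-congʳ (eq 6) ⟩
          # 126 * (b * b) + - (# 81 * (b * b)) ≈⟨ solve 1 (λ b → κ 126 ⊗ (b ⊗ b) ⊕ ⊝ (κ 81 ⊗ (b ⊗ b)) ⊜ κ 45 ⊗ (b ⊗ b)) refl b ⟩
          # 45 * (b * b) ∎
        r₀≈ : r₀ ≈ - (# 72 * (b * c))
        r₀≈ = halve (begin
          # 2 * r₀ ≈⟨ solve 4 (λ x y b c → κ 2 ⊗ x ⊜ κ 2 ⊗ (x ⊕ y ⊗ κ 0 ⊕ ⊝ (κ 6 ⊗ c) ⊗ (κ 9 ⊗ b)) ⊕ κ 108 ⊗ (b ⊗ c)) refl r₀ r₁ b c ⟩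
          # 2 * (r₀ + r₁ * 0# + - (# 6 * c) * (# 9 * b)) + # 108 * (b * c)
            ≈⟨ +-congʳ (*-congˡ (+-cong (+-congˡ (*-congˡ r₄≈)) (*-cong r₂≈ r₃≈))) ⟨
          # 2 * (r₀ + r₁ * r₄ + r₂ * r₃) + # 108 * (b * c) ≈⟨ +-congʳ (eq 5) ⟩
          - (# 252 * (b * c)) + # 108 * (b * c)
            ≈⟨ solve 2 (λ b c → ⊝ (κ 252 ⊗ (b ⊗ c)) ⊕ κ 108 ⊗ (b ⊗ c) ⊜ κ 2 ⊗ ⊝ (κ 72 ⊗ (b ⊗ c))) refl b c ⟩
          # 2 * - (# 72 * (b * c)) ∎)

        3·_ : ∀ {x} → # 3 * x ≈ 0# → x ≈ 0#
        3· e = *-cancelˡ-0 3≉0 e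
        2·_ : ∀ {x} → # 2 * x ≈ 0# → x ≈ 0#
        2· e = *-cancelˡ-0 2≉0 e

        E₄ : # 40 * (c * c) + - (# 153 * (b * b * b)) + # 18 * (b * d) ≈ 0#
        E₄ = 3· (begin
          # 3 * (# 40 * (c * c) + - (# 153 * (b * b * b)) + # 18 * (b * d))
            ≈⟨ solve 4 (λ b c d x → κ 3 ⊗ (κ 40 ⊗ (c ⊗ c) ⊕ ⊝ (κ 153 ⊗ (b ⊗ b ⊗ b)) ⊕ κ 18 ⊗ (b ⊗ d))
              ⊜ (κ 156 ⊗ (c ⊗ c) ⊕ ⊝ (κ 54 ⊗ (b ⊗ b ⊗ b)) ⊕ κ 54 ⊗ (b ⊗ d))
                ⊕ ⊝ (κ 2 ⊗ (x ⊗ κ 0) ⊕ (κ 45 ⊗ (b ⊗ b)) ⊗ (κ 9 ⊗ b) ⊕ ⊝ (κ 6 ⊗ c) ⊗ ⊝ (κ 6 ⊗ c))) refl b c d r₀ ⟩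
          coeff decic 4 + - (# 2 * (r₀ * 0#) + (# 45 * (b * b)) * (# 9 * b) + - (# 6 * c) * - (# 6 * c))
            ≈⟨ +-congˡ (-‿cong (+-cong (+-cong (*-congˡ (*-congˡ r₄≈)) (*-cong 2r₁≈ r₃≈)) (*-cong r₂≈ r₂≈))) ⟨
          coeff decic 4 + - (# 2 * (r₀ * r₄) + (# 2 * r₁) * r₃ + r₂ * r₂)
            ≈⟨ +-cong (sym (eq 4)) (-‿cong (+-congʳ (solve 3 (λ x y z → κ 2 ⊗ x ⊕ κ 2 ⊗ y ⊗ z ⊜ κ 2 ⊗ (x ⊕ y ⊗ z)) refl _ _ _))) ⟩
          coeff squareList 4 + - coeff squareList 4 ≈⟨ -‿inverseʳ _ ⟩
          0# ∎)

        E₃ : c * (# 91 * (b * b) + - (# 6 * d)) ≈ 0#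
        E₃ = 2· (3· (3· (begin
          # 3 * (# 3 * (# 2 * (c * (# 91 * (b * b) + - (# 6 * d)))))
            ≈⟨ solve 3 (λ b c d → κ 3 ⊗ (κ 3 ⊗ (κ 2 ⊗ (c ⊗ (κ 91 ⊗ (b ⊗ b) ⊕ ⊝ (κ 6 ⊗ d)))))
               ⊜ (κ 72 ⊗ (b ⊗ b ⊗ c) ⊕ ⊝ (κ 108 ⊗ (c ⊗ d)))
                 ⊕ ⊝ (κ 2 ⊗ (⊝ (κ 72 ⊗ (b ⊗ c)) ⊗ (κ 9 ⊗ b)) ⊕ (κ 45 ⊗ (b ⊗ b)) ⊗ ⊝ (κ 6 ⊗ c))) refl b c d ⟩
          coeff decic 3 + - (# 2 * (- (# 72 * (b * c)) * (# 9 * b)) + (# 45 * (b * b)) * - (# 6 * c))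
            ≈⟨ +-congˡ (-‿cong (+-cong (*-congˡ (*-cong r₀≈ r₃≈)) (*-cong 2r₁≈ r₂≈))) ⟨
          coeff decic 3 + - (# 2 * (r₀ * r₃) + (# 2 * r₁) * r₂)
            ≈⟨ +-cong (sym (eq 3)) (-‿cong (solve 3 (λ x y z → κ 2 ⊗ x ⊕ κ 2 ⊗ y ⊗ z ⊜ κ 2 ⊗ (x ⊕ y ⊗ z)) refl _ _ _)) ⟩
          coeff squareList 3 + - coeff squareList 3 ≈⟨ -‿inverseʳ _ ⟩
          0# ∎)))

        -- The coefficient of degree 2 is taken four times, so that r₁² enters as (2 r₁)².
        E₂ : # 12 * (d * d) + - (# 225 * (b * b * b * b)) + - (# 72 * (b * b * d)) + - (# 352 * (b * c * c)) ≈ 0#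
        E₂ = 3· (3· (begin
          # 3 * (# 3 * (# 12 * (d * d) + - (# 225 * (b * b * b * b)) + - (# 72 * (b * b * d)) + - (# 352 * (b * c * c))))
            ≈⟨ solve 3 (λ b c d → κ 3 ⊗ (κ 3 ⊗ (κ 12 ⊗ (d ⊗ d) ⊕ ⊝ (κ 225 ⊗ (b ⊗ b ⊗ b ⊗ b)) ⊕ ⊝ (κ 72 ⊗ (b ⊗ b ⊗ d)) ⊕ ⊝ (κ 352 ⊗ (b ⊗ c ⊗ c))))
               ⊜ κ 4 ⊗ (κ 27 ⊗ (d ⊗ d) ⊕ ⊝ (κ 162 ⊗ (b ⊗ b ⊗ d)) ⊕ κ 72 ⊗ (b ⊗ c ⊗ c))
                 ⊕ ⊝ (κ 8 ⊗ (⊝ (κ 72 ⊗ (b ⊗ c)) ⊗ ⊝ (κ 6 ⊗ c)) ⊕ (κ 45 ⊗ (b ⊗ b)) ⊗ (κ 45 ⊗ (b ⊗ b)))) refl b c d ⟩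
          # 4 * coeff decic 2 + - (# 8 * (- (# 72 * (b * c)) * - (# 6 * c)) + (# 45 * (b * b)) * (# 45 * (b * b)))
            ≈⟨ +-congˡ (-‿cong (+-cong (*-congˡ (*-cong r₀≈ r₂≈)) (*-cong 2r₁≈ 2r₁≈))) ⟨
          # 4 * coeff decic 2 + - (# 8 * (r₀ * r₂) + (# 2 * r₁) * (# 2 * r₁))
            ≈⟨ +-cong (*-congˡ (sym (eq 2))) (-‿cong (solve 2 (λ x y → κ 8 ⊗ x ⊕ κ 2 ⊗ y ⊗ (κ 2 ⊗ y) ⊜ κ 4 ⊗ (κ 2 ⊗ x ⊕ y ⊗ y)) refl _ _)) ⟩
          # 4 * coeff squareList 2 + - (# 4 * coeff squareList 2) ≈⟨ -‿inverseʳ _ ⟩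
          0# ∎))

        E₁ : c * (# 810 * (b * b * b) + # 27 * (b * d) + - (# 16 * (c * c))) ≈ 0#
        E₁ = 2· (2· (begin
          # 2 * (# 2 * (c * (# 810 * (b * b * b) + # 27 * (b * d) + - (# 16 * (c * c)))))
            ≈⟨ solve 3 (λ b c d → κ 2 ⊗ (κ 2 ⊗ (c ⊗ (κ 810 ⊗ (b ⊗ b ⊗ b) ⊕ κ 27 ⊗ (b ⊗ d) ⊕ ⊝ (κ 16 ⊗ (c ⊗ c)))))
               ⊜ (κ 108 ⊗ (b ⊗ c ⊗ d) ⊕ ⊝ (κ 64 ⊗ (c ⊗ c ⊗ c))) ⊕ ⊝ (⊝ (κ 72 ⊗ (b ⊗ c)) ⊗ (κ 45 ⊗ (b ⊗ b)))) refl b c d ⟩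
          coeff decic 1 + - (- (# 72 * (b * c)) * (# 45 * (b * b))) ≈⟨ +-congˡ (-‿cong (*-cong r₀≈ 2r₁≈)) ⟨
          coeff decic 1 + - (r₀ * (# 2 * r₁))
            ≈⟨ +-cong (sym (eq 1)) (-‿cong (solve 2 (λ x y → x ⊗ (κ 2 ⊗ y) ⊜ κ 2 ⊗ (x ⊗ y)) refl _ _)) ⟩
          coeff squareList 1 + - coeff squareList 1 ≈⟨ -‿inverseʳ _ ⟩
          0# ∎))

        E₀ : b * (b * (# 3 * (b * d) + - (# 290 * (c * c)))) ≈ 0#
        E₀ = 2· (3· (3· (begin
          # 3 * (# 3 * (# 2 * (b * (b * (# 3 * (b * d) + - (# 290 * (c * c)))))))
            ≈⟨ solve 3 (λ b c d → κ 3 ⊗ (κ 3 ⊗ (κ 2 ⊗ (b ⊗ (b ⊗ (κ 3 ⊗ (b ⊗ d) ⊕ ⊝ (κ 290 ⊗ (c ⊗ c)))))))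
               ⊜ (κ 54 ⊗ (b ⊗ b ⊗ b ⊗ d) ⊕ ⊝ (κ 36 ⊗ (b ⊗ b ⊗ c ⊗ c))) ⊕ ⊝ (⊝ (κ 72 ⊗ (b ⊗ c)) ⊗ ⊝ (κ 72 ⊗ (b ⊗ c)))) refl b c d ⟩
          coeff decic 0 + - (- (# 72 * (b * c)) * - (# 72 * (b * c))) ≈⟨ +-cong (sym (eq 0)) (-‿cong (sym (*-cong r₀≈ r₀≈))) ⟩
          coeff squareList 0 + - coeff squareList 0 ≈⟨ -‿inverseʳ _ ⟩
          0# ∎)))

      -- Eliminating d and c² from the five equations leaves 4225 b³ = 0 and 1831 b³ = 0, and 4225, 1831 are coprime.
      c≈0 : c ≈ 0#
      c≈0 with c ≟ 0#
      ... | yes e = e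
      ... | no c≉0 with b ≟ 0#
      ...   | yes b≈0 = *-cancelˡ-0 c≉0 (2· (2· (2· (2· (begin
          # 2 * (# 2 * (# 2 * (# 2 * (c * c))))
            ≈⟨ solve 2 (λ c d → κ 2 ⊗ (κ 2 ⊗ (κ 2 ⊗ (κ 2 ⊗ (c ⊗ c)))) ⊜ ⊝ (κ 810 ⊗ (κ 0 ⊗ κ 0 ⊗ κ 0) ⊕ κ 27 ⊗ (κ 0 ⊗ d) ⊕ ⊝ (κ 16 ⊗ (c ⊗ c)))) refl c d ⟩
          - (# 810 * (0# * 0# * 0#) + # 27 * (0# * d) + - (# 16 * (c * c)))
            ≈⟨ -‿cong (+-congʳ (+-cong (*-congˡ (*-cong (*-cong b≈0 b≈0) b≈0)) (*-congˡ (*-congʳ b≈0)))) ⟨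
          - (# 810 * (b * b * b) + # 27 * (b * d) + - (# 16 * (c * c))) ≈⟨ -‿cong (*-cancelˡ-0 c≉0 E₁) ⟩
          - 0# ≈⟨ solve 0 (⊝ κ 0 ⊜ κ 0) refl ⟩
          0# ∎)))))
      ...   | no b≉0 = ⊥-elim (*-≉0 (*-≉0 b≉0 b≉0) b≉0 (begin
          -- Bézout: 1696 · 1831 - 735 · 4225 = 1.
          b * b * b ≈⟨ solve 1 (λ x → x ⊜ κ 1696 ⊗ (κ 1831 ⊗ x) ⊕ ⊝ (κ 735 ⊗ (κ 4225 ⊗ x))) refl _ ⟩
          # 1696 * (# 1831 * (b * b * b)) + - (# 735 * (# 4225 * (b * b * b)))
            ≈⟨ +-cong (*-congˡ 1831b³≈0) (-‿cong (*-congˡ 4225b³≈0)) ⟩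
          # 1696 * 0# + - (# 735 * 0#) ≈⟨ solve 2 (λ x y → x ⊗ κ 0 ⊕ ⊝ (y ⊗ κ 0) ⊜ κ 0) refl _ _ ⟩
          0# ∎))
        where
        A₃ : # 91 * (b * b) + - (# 6 * d) ≈ 0#
        A₃ = *-cancelˡ-0 c≉0 E₃
        A₁ : # 810 * (b * b * b) + # 27 * (b * d) + - (# 16 * (c * c)) ≈ 0#
        A₁ = *-cancelˡ-0 c≉0 E₁
        A₀ : # 3 * (b * d) + - (# 290 * (c * c)) ≈ 0#
        A₀ = *-cancelˡ-0 b≉0 (*-cancelˡ-0 b≉0 E₀)
        4225b³≈0 : # 4225 * (b * b * b) ≈ 0#
        4225b³≈0 = 3· (begin
          # 3 * (# 4225 * (b * b * b)) ≈⟨ solve 3 (λ b c d → κ 3 ⊗ (κ 4225 ⊗ (b ⊗ b ⊗ b))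
            ⊜ κ 4 ⊗ (κ 40 ⊗ (c ⊗ c) ⊕ ⊝ (κ 153 ⊗ (b ⊗ b ⊗ b)) ⊕ κ 18 ⊗ (b ⊗ d))
              ⊕ κ 10 ⊗ (κ 810 ⊗ (b ⊗ b ⊗ b) ⊕ κ 27 ⊗ (b ⊗ d) ⊕ ⊝ (κ 16 ⊗ (c ⊗ c)))
              ⊕ κ 57 ⊗ b ⊗ (κ 91 ⊗ (b ⊗ b) ⊕ ⊝ (κ 6 ⊗ d))) refl b c d ⟩
          _ ≈⟨ +-cong (+-cong (*-congˡ E₄) (*-congˡ A₁)) (*-congˡ A₃) ⟩
          # 4 * 0# + # 10 * 0# + # 57 * b * 0# ≈⟨ solve 3 (λ x y z → x ⊗ κ 0 ⊕ y ⊗ κ 0 ⊕ z ⊗ κ 0 ⊜ κ 0) refl _ _ _ ⟩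
          0# ∎)
        1831b³≈0 : # 1831 * (b * b * b) ≈ 0#
        1831b³≈0 = 2· (begin
          # 2 * (# 1831 * (b * b * b)) ≈⟨ solve 3 (λ b c d → κ 2 ⊗ (κ 1831 ⊗ (b ⊗ b ⊗ b))
            ⊜ κ 29 ⊗ (κ 40 ⊗ (c ⊗ c) ⊕ ⊝ (κ 153 ⊗ (b ⊗ b ⊗ b)) ⊕ κ 18 ⊗ (b ⊗ d))
              ⊕ κ 4 ⊗ (κ 3 ⊗ (b ⊗ d) ⊕ ⊝ (κ 290 ⊗ (c ⊗ c)))
              ⊕ κ 89 ⊗ b ⊗ (κ 91 ⊗ (b ⊗ b) ⊕ ⊝ (κ 6 ⊗ d))) refl b c d ⟩
          _ ≈⟨ +-cong (+-cong (*-congˡ E₄) (*-congˡ A₀)) (*-congˡ A₃) ⟩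
          # 29 * 0# + # 4 * 0# + # 89 * b * 0# ≈⟨ solve 3 (λ x y z → x ⊗ κ 0 ⊕ y ⊗ κ 0 ⊕ z ⊗ κ 0 ⊜ κ 0) refl _ _ _ ⟩
          0# ∎)

      b≈0 : b ≈ 0#
      b≈0 with b ≟ 0#
      ... | yes e = e
      ... | no b≉0 = ⊥-elim (*-≉0 (*-≉0 (*-≉0 b≉0 b≉0) b≉0) b≉0 (3· (3· (begin
          -- With c = d = 0 the equations `E₄` and `E₂` read -153 b³ = 0 and -225 b⁴ = 0. Since 17
          -- or 5 may be zero in the field, the gcd 9 = 3 · 153 - 2 · 225 is used.
          # 3 * (# 3 * (b * b * b * b)) ≈⟨ solve 3 (λ b c d → κ 3 ⊗ (κ 3 ⊗ (b ⊗ b ⊗ b ⊗ b))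
            ⊜ ⊝ (κ 3 ⊗ b) ⊗ (κ 40 ⊗ (c ⊗ c) ⊕ ⊝ (κ 153 ⊗ (b ⊗ b ⊗ b)) ⊕ κ 18 ⊗ (b ⊗ d))
              ⊕ κ 2 ⊗ (κ 12 ⊗ (d ⊗ d) ⊕ ⊝ (κ 225 ⊗ (b ⊗ b ⊗ b ⊗ b)) ⊕ ⊝ (κ 72 ⊗ (b ⊗ b ⊗ d)) ⊕ ⊝ (κ 352 ⊗ (b ⊗ c ⊗ c)))
              ⊕ (κ 198 ⊗ b ⊗ b ⊕ ⊝ (κ 24 ⊗ d)) ⊗ d ⊕ κ 824 ⊗ b ⊗ c ⊗ c) refl b c d ⟩
          _ ≈⟨ +-cong (+-cong (+-cong (*-congˡ E₄) (*-congˡ E₂)) (*-congˡ d≈0)) (*-congˡ c≈0) ⟩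
          - (# 3 * b) * 0# + # 2 * 0# + (# 198 * b * b + - (# 24 * d)) * 0# + # 824 * b * c * 0#
            ≈⟨ solve 4 (λ x y z w → x ⊗ κ 0 ⊕ y ⊗ κ 0 ⊕ z ⊗ κ 0 ⊕ w ⊗ κ 0 ⊜ κ 0) refl _ _ _ _ ⟩
          0# ∎))))
        where
        d≈0 : d ≈ 0#
        d≈0 = *-cancelˡ-0 b≉0 (3· (begin
          # 3 * (b * d) ≈⟨ solve 2 (λ x y → x ⊜ (x ⊕ ⊝ (κ 290 ⊗ (y ⊗ y))) ⊕ κ 290 ⊗ y ⊗ y) refl _ c ⟩
          (# 3 * (b * d) + - (# 290 * (c * c))) + # 290 * c * c
            ≈⟨ +-cong (*-cancelˡ-0 b≉0 (*-cancelˡ-0 b≉0 E₀)) (*-congˡ c≈0) ⟩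
          0# + # 290 * c * 0# ≈⟨ solve 1 (λ x → κ 0 ⊕ x ⊗ κ 0 ⊜ κ 0) refl _ ⟩
          0# ∎))

      d≈0 : d ≈ 0#
      d≈0 with d ≟ 0#
      ... | yes e = e
      ... | no d≉0 = ⊥-elim (*-≉0 d≉0 d≉0 (2· (2· (3· (begin
          # 3 * (# 2 * (# 2 * (d * d))) ≈⟨ solve 3 (λ b c d → κ 3 ⊗ (κ 2 ⊗ (κ 2 ⊗ (d ⊗ d)))
            ⊜ (κ 12 ⊗ (d ⊗ d) ⊕ ⊝ (κ 225 ⊗ (b ⊗ b ⊗ b ⊗ b)) ⊕ ⊝ (κ 72 ⊗ (b ⊗ b ⊗ d)) ⊕ ⊝ (κ 352 ⊗ (b ⊗ c ⊗ c)))
              ⊕ (κ 225 ⊗ b ⊗ b ⊗ b ⊕ κ 72 ⊗ b ⊗ d ⊕ κ 352 ⊗ c ⊗ c) ⊗ b) refl b c d ⟩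
          _ ≈⟨ +-cong E₂ (*-congˡ b≈0) ⟩
          0# + (# 225 * b * b * b + # 72 * b * d + # 352 * c * c) * 0# ≈⟨ solve 1 (λ x → κ 0 ⊕ x ⊗ κ 0 ⊜ κ 0) refl _ ⟩
          0# ∎)))))

  open Stepanov K q card h h+h≈1 using (multiple-square; Deg-root; root)
  open Odd 2≉0 using (m)

  decic-power⇒zero : ∀ b c d → (∀ a → ev (decic b c d) a ≈ 0# ⊎ ev (decic b c d) a ^ m ≈ 1#) →
    b ≈ 0# × c ≈ 0# × d ≈ 0#
  decic-power⇒zero b c d powers = S.b≈0 , S.c≈0 , S.d≈0
    where
    f = decic b c d
    f≉[] : ¬ f ≈ₚ []
    f≉[] e = 1≉0 (at e 10)
    a₀ = proj₁ (nonroot f f≉[] (Deg-decic b c d))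
    f[a₀]≉0 = proj₂ (nonroot f f≉[] (Deg-decic b c d))
    Deg-quintic : Deg 0 5 (quintic b c d)
    Deg-quintic = Deg-weaken (ℕ.≤-reflexive ≡.refl) (Deg-length (quintic b c d) {6} ℕ.≤-refl)
    f∼p² : Deg 6 10 (f +ₚ (-ₚ (quintic b c d *ₚ quintic b c d)))
    f∼p² = Deg-resp (≈ₚ.trans (PS.solve 2 (λ u v → v ⊜ (u ⊕ v) ⊕ ⊝ u) ≈ₚ.refl (quintic b c d *ₚ quintic b c d) (remainder b c d))
        (+ₚ-cong (≈ₚ.sym (decic≈ b c d)) (≈ₚ.refl { -ₚ (quintic b c d *ₚ quintic b c d)})))
      (Deg-weaken (ℕ.≤-reflexive ≡.refl) (Deg-length (remainder b c d) {5} ℕ.≤-refl))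
      where module PS = IntegerSolver polyRing
    Q : Poly
    Q = root f (quintic b c d) ℕ.≤-refl 89≤q Deg-quintic f∼p² powers a₀ f[a₀]≉0
    Q²≈ : (ev f a₀ ^ 9) ·ₚ f ≈ₚ Q *ₚ Q
    Q²≈ = multiple-square f (quintic b c d) ℕ.≤-refl 89≤q Deg-quintic f∼p² powers a₀ f[a₀]≉0
    Deg-Q : Deg 0 5 Q
    Deg-Q = Deg-root f (quintic b c d) ℕ.≤-refl 89≤q Deg-quintic f∼p² powers a₀ f[a₀]≉0
    e = ev f a₀ ^ 9

    -- Comparing leading coefficients in e f = Q² shows that the one of Q has square e. Division by
    -- it yields a monic square root of `f` itself.
    module Monic (Q : Poly) (Deg-Q : Deg 0 5 Q) (Q²≈ : e ·ₚ f ≈ₚ Q *ₚ Q) where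
      x : ℕ → Carrier
      x = coeff Q
      Q≈ : Q ≈ₚ x 0 ∷ x 1 ∷ x 2 ∷ x 3 ∷ x 4 ∷ x 5 ∷ []
      Q≈ = coeffwise λ where
        0 → refl
        1 → refl
        2 → refl
        3 → refl
        4 → refl
        5 → refl
        (suc (suc (suc (suc (suc (suc k)))))) → vanish Deg-Q _ (ℕ.s≤s (ℕ.s≤s (ℕ.s≤s (ℕ.s≤s (ℕ.s≤s (ℕ.s≤s ℕ.z≤n))))))
      x₅²≈e : x 5 * x 5 ≈ e
      x₅²≈e = trans (at (≈ₚ.trans (*ₚ-cong (≈ₚ.sym Q≈) (≈ₚ.sym Q≈)) (≈ₚ.sym Q²≈)) 10) (*-identityʳ e)
      x₅≉0 : x 5 ≉0
      x₅≉0 z = ^-≉0 9 f[a₀]≉0 (trans (sym x₅²≈e) (trans (*-congʳ z) (zeroˡ _)))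
      i = proj₁ (inverse (x 5) x₅≉0)
      x₅i≈1 = proj₂ (inverse (x 5) x₅≉0)
      r : ℕ → Carrier
      r k = i * x k
      monic : Carrier → Carrier
      monic = ev (r 0 ∷ r 1 ∷ r 2 ∷ r 3 ∷ r 4 ∷ 1# ∷ [])
      x₅*monic : ∀ s → x 5 * monic s ≈ ev Q s
      x₅*monic s = begin
        x 5 * monic s ≈⟨ solve 8 (λ a b c d e f i s →
          f ⊗ (i ⊗ a ⊕ s ⊗ (i ⊗ b ⊕ s ⊗ (i ⊗ c ⊕ s ⊗ (i ⊗ d ⊕ s ⊗ (i ⊗ e ⊕ s ⊗ (κ 1 ⊕ s ⊗ κ 0))))))
          ⊜ (a ⊕ s ⊗ (b ⊕ s ⊗ (c ⊕ s ⊗ (d ⊕ s ⊗ (e ⊕ s ⊗ (f ⊕ s ⊗ κ 0))))))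
            ⊕ (f ⊗ i ⊕ ⊝ κ 1) ⊗ (a ⊕ s ⊗ (b ⊕ s ⊗ (c ⊕ s ⊗ (d ⊕ s ⊗ e)))))
          refl (x 0) (x 1) (x 2) (x 3) (x 4) (x 5) i s ⟩
        ev Q′ s + (x 5 * i + - 1#) * (x 0 + s * (x 1 + s * (x 2 + s * (x 3 + s * x 4))))
          ≈⟨ +-congˡ (*-congʳ (x≈y⇒x-y≈0 x₅i≈1)) ⟩
        ev Q′ s + 0# * (x 0 + s * (x 1 + s * (x 2 + s * (x 3 + s * x 4)))) ≈⟨ +-congˡ (zeroˡ _) ⟩
        ev Q′ s + 0# ≈⟨ +-identityʳ _ ⟩
        ev Q′ s ≈⟨ ev-cong {Q} {Q′} s Q≈ ⟨
        ev Q s ∎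
        where Q′ = x 0 ∷ x 1 ∷ x 2 ∷ x 3 ∷ x 4 ∷ x 5 ∷ []
      square : ∀ s → ev f s ≈ monic s * monic s
      square s = *-cancelˡ (^-≉0 9 f[a₀]≉0) (begin
        e * ev f s ≈⟨ ev-· e f s ⟨
        ev (e ·ₚ f) s ≈⟨ ev-cong {e ·ₚ f} {Q *ₚ Q} s Q²≈ ⟩
        ev (Q *ₚ Q) s ≈⟨ ev-* Q Q s ⟩
        ev Q s * ev Q s ≈⟨ *-cong (x₅*monic s) (x₅*monic s) ⟨
        x 5 * monic s * (x 5 * monic s) ≈⟨ solve 2 (λ x y → x ⊗ y ⊗ (x ⊗ y) ⊜ (x ⊗ x) ⊗ (y ⊗ y)) refl (x 5) (monic s) ⟩
        x 5 * x 5 * (monic s * monic s) ≈⟨ *-congʳ x₅²≈e ⟩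
        e * (monic s * monic s) ∎)
    open Monic Q Deg-Q Q²≈ using (r; square)
    module S = Square b c d (r 0) (r 1) (r 2) (r 3) (r 4) square

-- Every point lies in a plane through three points of the set.

module Coverage {ℓ₀ ℓ} (K : Field ℓ₀ ℓ) (q : ℕ) (card : HasCardinality K q) (89≤q : 89 ℕ.≤ q) (3-nonsquare : ¬ ThreeIsSquare K) where
  open Field K hiding (zero)
  open IntegerSolver commutativeRing using (solve)
  open Polynomial commutativeRing
  open Degree commutativeRing
  open FieldLemmas K
  open FiniteField K q card
  open Decic K q card 89≤q 3-nonsquare
  open Projective K
  open Odd 2≉0 using (m; nonsquare^m)
  open Stepanov K q card h h+h≈1 using (*ₚ-cancel-0)
  open import Algebra.Properties.CommutativeSemiring.Exp.TCOptimised commutativeSemiring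
    using (_^_; ^-congˡ; ^-distrib-*)
  open import Relation.Binary.Reasoning.Setoid setoid

  data Pt : Set ℓ₀ where
    curve tangent : Carrier → Pt
    infinity : Pt

  ⟪_⟫ : Pt → V5
  ⟪ curve t ⟫ = vec 1# t (t * t) (t * (t * t)) (t * (t * (t * t)))
  ⟪ tangent t ⟫ = vec 0# 1# (two * t) (three * (t * t)) (four * (t * (t * t)))
  ⟪ infinity ⟫ = vec 0# 0# 0# 0# 1#

  infix 4 _≐_
  _≐_ : Pt → Pt → Set ℓ
  curve s ≐ curve t = s ≈ t
  tangent s ≐ tangent t = s ≈ t
  infinity ≐ infinity = Lift ℓ ⊤
  _ ≐ _ = Lift ℓ ⊥

  coordinatewise : ∀ {v w : V5} → v zero ≈ w zero → v (suc zero) ≈ w (suc zero) →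
    v (suc (suc zero)) ≈ w (suc (suc zero)) → v (suc (suc (suc zero))) ≈ w (suc (suc (suc zero))) →
    v (suc (suc (suc (suc zero)))) ≈ w (suc (suc (suc (suc zero)))) → v ≋ w
  coordinatewise e₀ e₁ e₂ e₃ e₄ zero = e₀
  coordinatewise e₀ e₁ e₂ e₃ e₄ (suc zero) = e₁
  coordinatewise e₀ e₁ e₂ e₃ e₄ (suc (suc zero)) = e₂
  coordinatewise e₀ e₁ e₂ e₃ e₄ (suc (suc (suc zero))) = e₃
  coordinatewise e₀ e₁ e₂ e₃ e₄ (suc (suc (suc (suc zero)))) = e₄

  -- The weights are unrestricted, so `v` may itself be one of the three points; that case is
  -- separated only in the proof of completeness.
  record Spanned (v : V5) : Set (ℓ₀ ⊔ ℓ) where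
    constructor spanned
    field
      {w₁ w₂ w₃} : Pt
      w₁≠w₂ : ¬ w₁ ≐ w₂
      w₁≠w₃ : ¬ w₁ ≐ w₃
      w₂≠w₃ : ¬ w₂ ≐ w₃
      α β γ : Carrier
      combination : v ≋ lin3 α β γ ⟪ w₁ ⟫ ⟪ w₂ ⟫ ⟪ w₃ ⟫

  Covered : V5 → Set (ℓ₀ ⊔ ℓ)
  Covered v = (∃ λ w → ∃ λ a → a ≉0 × (∀ i → v i ≈ a * ⟪ w ⟫ i)) ⊎ Spanned v

  -- A point (y₀, y₁, y₂, y₃) of ℙ³ lies on the chord through t and u of the twisted cubic (1, t, t², t³)
  -- as soon as y is annihilated by (T − t)(T − u) and its multiple by T.
  chord : ∀ {y₀ y₁ y₂ y₃ t u} → ¬ t ≈ u →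
    y₂ ≈ (t + u) * y₁ + - (t * u * y₀) → y₃ ≈ (t + u) * y₂ + - (t * u * y₁) →
    ∃ λ α → ∃ λ β → y₀ ≈ α + β × y₁ ≈ α * t + β * u × y₂ ≈ α * (t * t) + β * (u * u)
      × y₃ ≈ α * (t * (t * t)) + β * (u * (u * u))
  chord {y₀} {y₁} {y₂} {y₃} {t} {u} t≉u e₂ e₃ = α , β , s₀ , s₁ , s₂ , s₃
    where
    t-u≉0 : (t + - u) ≉0
    t-u≉0 z = t≉u (x-y≈0⇒x≈y z)
    i = proj₁ (inverse (t + - u) t-u≉0)
    α = (y₁ + - (u * y₀)) * i
    β = (t * y₀ + - y₁) * i
    times-i : ∀ {x y} → y ≈ (t + - u) * x * i → x ≈ y
    times-i {x} {y} e = sym (trans e (trans (solve 3 (λ d x i → d ⊗ x ⊗ i ⊜ x ⊗ (d ⊗ i)) refl _ x i)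
      (trans (*-congˡ (proj₂ (inverse (t + - u) t-u≉0))) (*-identityʳ x))))
    s₀ : y₀ ≈ α + β
    s₀ = times-i (solve 5 (λ t u i y0 y1 → (y1 ⊕ ⊝ (u ⊗ y0)) ⊗ i ⊕ (t ⊗ y0 ⊕ ⊝ y1) ⊗ i ⊜ (t ⊕ ⊝ u) ⊗ y0 ⊗ i) refl t u i y₀ y₁)
    s₁ : y₁ ≈ α * t + β * u
    s₁ = times-i (solve 5 (λ t u i y0 y1 → (y1 ⊕ ⊝ (u ⊗ y0)) ⊗ i ⊗ t ⊕ (t ⊗ y0 ⊕ ⊝ y1) ⊗ i ⊗ u ⊜ (t ⊕ ⊝ u) ⊗ y1 ⊗ i) refl t u i y₀ y₁)
    s₂ : y₂ ≈ α * (t * t) + β * (u * u)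
    s₂ = trans e₂ (times-i (solve 5 (λ t u i y0 y1 → (y1 ⊕ ⊝ (u ⊗ y0)) ⊗ i ⊗ (t ⊗ t) ⊕ (t ⊗ y0 ⊕ ⊝ y1) ⊗ i ⊗ (u ⊗ u)
      ⊜ (t ⊕ ⊝ u) ⊗ ((t ⊕ u) ⊗ y1 ⊕ ⊝ (t ⊗ u ⊗ y0)) ⊗ i) refl t u i y₀ y₁))
    s₃ : y₃ ≈ α * (t * (t * t)) + β * (u * (u * u))
    s₃ = begin
      y₃ ≈⟨ e₃ ⟩
      (t + u) * y₂ + - (t * u * y₁) ≈⟨ +-cong (*-congˡ s₂) (-‿cong (*-congˡ s₁)) ⟩
      (t + u) * (α * (t * t) + β * (u * u)) + - (t * u * (α * t + β * u))
        ≈⟨ solve 4 (λ t u a b → (t ⊕ u) ⊗ (a ⊗ (t ⊗ t) ⊕ b ⊗ (u ⊗ u)) ⊕ ⊝ (t ⊗ u ⊗ (a ⊗ t ⊕ b ⊗ u))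
           ⊜ a ⊗ (t ⊗ (t ⊗ t)) ⊕ b ⊗ (u ⊗ (u ⊗ u))) refl t u α β ⟩
      α * (t * (t * t)) + β * (u * (u * u)) ∎

  module Affine (b c d : Carrier) where

    n : V5
    n = vec 1# 0# b c d

    -- The chord of the twisted cubic through the projection of n − ⟪ curve s ⟫ is cut out by
    -- 6 φ T² − 6 γ T + η, whose discriminant is 12 times the value of the decic at s.
    φ γ η : Carrier → Carrier
    φ s = s ^ 4 + # 6 * (b * s ^ 2) + - (# 4 * (c * s)) + - (# 3 * (b * b))
    γ s = - (# 3 * (s * (d + - s ^ 4))) + - (# 2 * ((b + - s ^ 2) * (c + - s ^ 3)))
    η s = # 9 * ((b + - s ^ 2) * (d + - s ^ 4)) + - (# 8 * ((c + - s ^ 3) * (c + - s ^ 3)))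

    f : Carrier → Carrier
    f = ev (decic b c d)

    f≈ : ∀ s → # 3 * f s ≈ # 9 * (γ s * γ s) + - (# 6 * (φ s * η s))
    f≈ s = solve 4 (λ b c d s →
      let r0 = κ 54 ⊗ (b ⊗ b ⊗ b ⊗ d) ⊕ ⊝ (κ 36 ⊗ (b ⊗ b ⊗ c ⊗ c))
          r1 = κ 108 ⊗ (b ⊗ c ⊗ d) ⊕ ⊝ (κ 64 ⊗ (c ⊗ c ⊗ c))
          r2 = κ 27 ⊗ (d ⊗ d) ⊕ ⊝ (κ 162 ⊗ (b ⊗ b ⊗ d)) ⊕ κ 72 ⊗ (b ⊗ c ⊗ c)
          r3 = κ 72 ⊗ (b ⊗ b ⊗ c) ⊕ ⊝ (κ 108 ⊗ (c ⊗ d))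
          r4 = κ 156 ⊗ (c ⊗ c) ⊕ ⊝ (κ 54 ⊗ (b ⊗ b ⊗ b)) ⊕ κ 54 ⊗ (b ⊗ d)
          φ = s ⊛ 4 ⊕ κ 6 ⊗ (b ⊗ s ⊛ 2) ⊕ ⊝ (κ 4 ⊗ (c ⊗ s)) ⊕ ⊝ (κ 3 ⊗ (b ⊗ b))
          γ = ⊝ (κ 3 ⊗ (s ⊗ (d ⊕ ⊝ s ⊛ 4))) ⊕ ⊝ (κ 2 ⊗ ((b ⊕ ⊝ s ⊛ 2) ⊗ (c ⊕ ⊝ s ⊛ 3)))
          η = κ 9 ⊗ ((b ⊕ ⊝ s ⊛ 2) ⊗ (d ⊕ ⊝ s ⊛ 4)) ⊕ ⊝ (κ 8 ⊗ ((c ⊕ ⊝ s ⊛ 3) ⊗ (c ⊕ ⊝ s ⊛ 3)))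
      in κ 3 ⊗ (r0 ⊕ s ⊗ (r1 ⊕ s ⊗ (r2 ⊕ s ⊗ (r3 ⊕ s ⊗ (r4 ⊕ s ⊗ (⊝ (κ 252 ⊗ (b ⊗ c)) ⊕ s ⊗ (κ 126 ⊗ (b ⊗ b)
             ⊕ s ⊗ (⊝ (κ 12 ⊗ c) ⊕ s ⊗ (κ 18 ⊗ b ⊕ s ⊗ (κ 0 ⊕ s ⊗ (κ 1 ⊕ s ⊗ κ 0)))))))))))
         ⊜ κ 9 ⊗ (γ ⊗ γ) ⊕ ⊝ (κ 6 ⊗ (φ ⊗ η))) refl b c d s

    module Secant (s e : Carrier) (φ≉0 : φ s ≉0) (e≉0 : e ≉0) (e² : e * e ≈ # 3 * f s) where
      6φ≉0 : (# 6 * φ s) ≉0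
      6φ≉0 = *-≉0 6≉0 φ≉0
      k = proj₁ (inverse (# 6 * φ s) 6φ≉0)
      6φk≈1 : # 6 * φ s * k ≈ 1#
      6φk≈1 = proj₂ (inverse (# 6 * φ s) 6φ≉0)
      k≉0 : k ≉0
      k≉0 z = 1≉0 (trans (sym 6φk≈1) (trans (*-congˡ z) (zeroʳ _)))

      t u y₀ y₁ y₂ y₃ : Carrier
      -- The roots (3γ ± e) / (6φ) of the quadratic; they differ because e ≠ 0.
      t = (# 3 * γ s + e) * k
      u = (# 3 * γ s + - e) * k
      y₀ = - s
      y₁ = h * (b + - s ^ 2)
      y₂ = θ * (c + - s ^ 3)
      y₃ = h * (h * (d + - s ^ 4))

      t≉u : ¬ t ≈ u
      t≉u z = *-≉0 (*-≉0 2≉0 e≉0) k≉0 (begin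
        # 2 * e * k ≈⟨ solve 3 (λ g e k → κ 2 ⊗ e ⊗ k ⊜ (κ 3 ⊗ g ⊕ e) ⊗ k ⊕ ⊝ ((κ 3 ⊗ g ⊕ ⊝ e) ⊗ k)) refl (γ s) e k ⟩
        t + - u ≈⟨ x≈y⇒x-y≈0 z ⟩
        0# ∎)

      t+u : t + u ≈ # 6 * γ s * k
      t+u = solve 3 (λ g e k → (κ 3 ⊗ g ⊕ e) ⊗ k ⊕ (κ 3 ⊗ g ⊕ ⊝ e) ⊗ k ⊜ κ 6 ⊗ g ⊗ k) refl (γ s) e k

      t*u : t * u ≈ η s * k
      t*u = begin
        t * u ≈⟨ solve 3 (λ g e k → (κ 3 ⊗ g ⊕ e) ⊗ k ⊗ ((κ 3 ⊗ g ⊕ ⊝ e) ⊗ k) ⊜ (κ 9 ⊗ (g ⊗ g) ⊕ ⊝ (e ⊗ e)) ⊗ k ⊗ k) refl (γ s) e k ⟩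
        (# 9 * (γ s * γ s) + - (e * e)) * k * k ≈⟨ *-congʳ (*-congʳ (+-congˡ (-‿cong (trans e² (f≈ s))))) ⟩
        (# 9 * (γ s * γ s) + - (# 9 * (γ s * γ s) + - (# 6 * (φ s * η s)))) * k * k
          ≈⟨ solve 4 (λ g p x k → (κ 9 ⊗ (g ⊗ g) ⊕ ⊝ (κ 9 ⊗ (g ⊗ g) ⊕ ⊝ (κ 6 ⊗ (p ⊗ x)))) ⊗ k ⊗ k ⊜ κ 6 ⊗ p ⊗ k ⊗ (x ⊗ k)) refl (γ s) (φ s) (η s) k ⟩
        # 6 * φ s * k * (η s * k) ≈⟨ *-congʳ 6φk≈1 ⟩
        1# * (η s * k) ≈⟨ *-identityˡ _ ⟩
        η s * k ∎

      2y₁ : # 2 * y₁ ≈ b + - s ^ 2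
      2y₁ = trans (sym (*-assoc _ _ _)) (trans (*-congʳ 2h≈1) (*-identityˡ _))
      3y₂ : # 3 * y₂ ≈ c + - s ^ 3
      3y₂ = trans (sym (*-assoc _ _ _)) (trans (*-congʳ 3θ≈1) (*-identityˡ _))
      4y₃ : # 4 * y₃ ≈ d + - s ^ 4
      4y₃ = trans (solve 2 (λ h x → κ 4 ⊗ (h ⊗ (h ⊗ x)) ⊜ (κ 2 ⊗ h) ⊗ ((κ 2 ⊗ h) ⊗ x)) refl h _)
        (trans (*-cong 2h≈1 (*-congʳ 2h≈1)) (trans (*-identityˡ _) (*-identityˡ _)))

      -- Division by 6φ: t + u and t u are the normalised coefficients of the quadratic, in the form
      -- that `chord` expects.
      recurrence : ∀ {y y′ y″} → # 6 * φ s * y ≈ # 6 * γ s * y′ + - (η s * y″) → y ≈ (t + u) * y′ + - (t * u * y″)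
      recurrence {y} {y′} {y″} e = begin
        y ≈⟨ *-identityʳ y ⟨
        y * 1# ≈⟨ *-congˡ 6φk≈1 ⟨
        y * (# 6 * φ s * k) ≈⟨ solve 3 (λ y p k → y ⊗ (p ⊗ k) ⊜ p ⊗ y ⊗ k) refl y (# 6 * φ s) k ⟩
        # 6 * φ s * y * k ≈⟨ *-congʳ e ⟩
        (# 6 * γ s * y′ + - (η s * y″)) * k
          ≈⟨ solve 5 (λ g x k y′ y″ → (g ⊗ y′ ⊕ ⊝ (x ⊗ y″)) ⊗ k ⊜ g ⊗ k ⊗ y′ ⊕ ⊝ (x ⊗ k ⊗ y″)) refl (# 6 * γ s) (η s) k y′ y″ ⟩
        # 6 * γ s * k * y′ + - (η s * k * y″) ≈⟨ +-cong (*-congʳ t+u) (-‿cong (*-congʳ t*u)) ⟨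
        (t + u) * y′ + - (t * u * y″) ∎

      -- Up to constants, `φ`, `γ`, `η` are the 2 × 2 minors of the matrix with rows (y₀, y₁, y₂)
      -- and (y₁, y₂, y₃). Hence `e₂` and `e₃` express that a determinant with a repeated row
      -- vanishes.
      e₂ : # 6 * φ s * y₂ ≈ # 6 * γ s * y₁ + - (η s * y₀)
      e₂ = begin
        # 6 * φ s * y₂ ≈⟨ solve 2 (λ p y → κ 6 ⊗ p ⊗ y ⊜ κ 2 ⊗ p ⊗ (κ 3 ⊗ y)) refl (φ s) y₂ ⟩
        # 2 * φ s * (# 3 * y₂) ≈⟨ *-congˡ 3y₂ ⟩
        # 2 * φ s * (c + - s ^ 3) ≈⟨ solve 4 (λ b c d s →
          let φ = s ⊛ 4 ⊕ κ 6 ⊗ (b ⊗ s ⊛ 2) ⊕ ⊝ (κ 4 ⊗ (c ⊗ s)) ⊕ ⊝ (κ 3 ⊗ (b ⊗ b))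
              γ = ⊝ (κ 3 ⊗ (s ⊗ (d ⊕ ⊝ s ⊛ 4))) ⊕ ⊝ (κ 2 ⊗ ((b ⊕ ⊝ s ⊛ 2) ⊗ (c ⊕ ⊝ s ⊛ 3)))
              η = κ 9 ⊗ ((b ⊕ ⊝ s ⊛ 2) ⊗ (d ⊕ ⊝ s ⊛ 4)) ⊕ ⊝ (κ 8 ⊗ ((c ⊕ ⊝ s ⊛ 3) ⊗ (c ⊕ ⊝ s ⊛ 3)))
          in κ 2 ⊗ φ ⊗ (c ⊕ ⊝ s ⊛ 3) ⊜ κ 3 ⊗ γ ⊗ (b ⊕ ⊝ s ⊛ 2) ⊕ ⊝ (η ⊗ ⊝ s)) refl b c d s ⟩
        # 3 * γ s * (b + - s ^ 2) + - (η s * - s) ≈⟨ +-congʳ (*-congˡ 2y₁) ⟨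
        # 3 * γ s * (# 2 * y₁) + - (η s * - s) ≈⟨ +-congʳ (solve 2 (λ g y → κ 3 ⊗ g ⊗ (κ 2 ⊗ y) ⊜ κ 6 ⊗ g ⊗ y) refl (γ s) y₁) ⟩
        # 6 * γ s * y₁ + - (η s * y₀) ∎

      e₃ : # 6 * φ s * y₃ ≈ # 6 * γ s * y₂ + - (η s * y₁)
      e₃ = *-cancelˡ 2≉0 (begin
        # 2 * (# 6 * φ s * y₃) ≈⟨ solve 2 (λ p y → κ 2 ⊗ (κ 6 ⊗ p ⊗ y) ⊜ κ 3 ⊗ p ⊗ (κ 4 ⊗ y)) refl (φ s) y₃ ⟩
        # 3 * φ s * (# 4 * y₃) ≈⟨ *-congˡ 4y₃ ⟩
        # 3 * φ s * (d + - s ^ 4) ≈⟨ solve 4 (λ b c d s →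
          let φ = s ⊛ 4 ⊕ κ 6 ⊗ (b ⊗ s ⊛ 2) ⊕ ⊝ (κ 4 ⊗ (c ⊗ s)) ⊕ ⊝ (κ 3 ⊗ (b ⊗ b))
              γ = ⊝ (κ 3 ⊗ (s ⊗ (d ⊕ ⊝ s ⊛ 4))) ⊕ ⊝ (κ 2 ⊗ ((b ⊕ ⊝ s ⊛ 2) ⊗ (c ⊕ ⊝ s ⊛ 3)))
              η = κ 9 ⊗ ((b ⊕ ⊝ s ⊛ 2) ⊗ (d ⊕ ⊝ s ⊛ 4)) ⊕ ⊝ (κ 8 ⊗ ((c ⊕ ⊝ s ⊛ 3) ⊗ (c ⊕ ⊝ s ⊛ 3)))
          in κ 3 ⊗ φ ⊗ (d ⊕ ⊝ s ⊛ 4) ⊜ κ 4 ⊗ γ ⊗ (c ⊕ ⊝ s ⊛ 3) ⊕ ⊝ (η ⊗ (b ⊕ ⊝ s ⊛ 2))) refl b c d s ⟩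
        # 4 * γ s * (c + - s ^ 3) + - (η s * (b + - s ^ 2)) ≈⟨ +-cong (*-congˡ 3y₂) (-‿cong (*-congˡ 2y₁)) ⟨
        # 4 * γ s * (# 3 * y₂) + - (η s * (# 2 * y₁))
          ≈⟨ solve 4 (λ g x y y′ → κ 4 ⊗ g ⊗ (κ 3 ⊗ y) ⊕ ⊝ (x ⊗ (κ 2 ⊗ y′)) ⊜ κ 2 ⊗ (κ 6 ⊗ g ⊗ y ⊕ ⊝ (x ⊗ y′))) refl (γ s) (η s) y₂ y₁ ⟩
        # 2 * (# 6 * γ s * y₂ + - (η s * y₁)) ∎)

      covered : Covered n
      covered = onChord (chord {y₀} {y₁} {y₂} {y₃} t≉u (recurrence e₂) (recurrence e₃))
        where
        onChord : (∃ λ α → ∃ λ β → y₀ ≈ α + β × y₁ ≈ α * t + β * u × y₂ ≈ α * (t * t) + β * (u * u)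
          × y₃ ≈ α * (t * (t * t)) + β * (u * (u * u))) → Covered n
        onChord (α , β , s₀ , s₁ , s₂ , s₃) = inj₂ (spanned {w₁ = curve s} {tangent t} {tangent u} (λ ()) (λ ()) t≉u 1# α β (coordinatewise
          (solve 2 (λ a b → κ 1 ⊜ κ 1 ⊗ κ 1 ⊕ a ⊗ κ 0 ⊕ b ⊗ κ 0) refl α β)
          (begin
            0# ≈⟨ solve 1 (λ s → κ 0 ⊜ s ⊕ ⊝ s) refl s ⟩
            s + - s ≈⟨ +-congˡ s₀ ⟩
            s + (α + β) ≈⟨ solve 3 (λ s a b → s ⊕ (a ⊕ b) ⊜ κ 1 ⊗ s ⊕ a ⊗ κ 1 ⊕ b ⊗ κ 1) refl s α β ⟩
            1# * s + α * 1# + β * 1# ∎)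
          (begin
            b ≈⟨ solve 2 (λ b s → b ⊜ s ⊗ s ⊕ (b ⊕ ⊝ s ⊛ 2)) refl b s ⟩
            s * s + (b + - s ^ 2) ≈⟨ +-congˡ 2y₁ ⟨
            s * s + # 2 * y₁ ≈⟨ +-congˡ (*-congˡ s₁) ⟩
            s * s + # 2 * (α * t + β * u) ≈⟨ solve 5 (λ s a b t u → s ⊗ s ⊕ κ 2 ⊗ (a ⊗ t ⊕ b ⊗ u)
              ⊜ κ 1 ⊗ (s ⊗ s) ⊕ a ⊗ (κ 2 ⊗ t) ⊕ b ⊗ (κ 2 ⊗ u)) refl s α β t u ⟩
            1# * (s * s) + α * (two * t) + β * (two * u) ∎)
          (begin
            c ≈⟨ solve 2 (λ c s → c ⊜ s ⊗ (s ⊗ s) ⊕ (c ⊕ ⊝ s ⊛ 3)) refl c s ⟩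
            s * (s * s) + (c + - s ^ 3) ≈⟨ +-congˡ 3y₂ ⟨
            s * (s * s) + # 3 * y₂ ≈⟨ +-congˡ (*-congˡ s₂) ⟩
            s * (s * s) + # 3 * (α * (t * t) + β * (u * u)) ≈⟨ solve 5 (λ s a b t u → s ⊗ (s ⊗ s) ⊕ κ 3 ⊗ (a ⊗ (t ⊗ t) ⊕ b ⊗ (u ⊗ u))
              ⊜ κ 1 ⊗ (s ⊗ (s ⊗ s)) ⊕ a ⊗ (κ 3 ⊗ (t ⊗ t)) ⊕ b ⊗ (κ 3 ⊗ (u ⊗ u))) refl s α β t u ⟩
            1# * (s * (s * s)) + α * (three * (t * t)) + β * (three * (u * u)) ∎)
          (begin
            d ≈⟨ solve 2 (λ d s → d ⊜ s ⊗ (s ⊗ (s ⊗ s)) ⊕ (d ⊕ ⊝ s ⊛ 4)) refl d s ⟩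
            s * (s * (s * s)) + (d + - s ^ 4) ≈⟨ +-congˡ 4y₃ ⟨
            s * (s * (s * s)) + # 4 * y₃ ≈⟨ +-congˡ (*-congˡ s₃) ⟩
            s * (s * (s * s)) + # 4 * (α * (t * (t * t)) + β * (u * (u * u))) ≈⟨ solve 5 (λ s a b t u →
              s ⊗ (s ⊗ (s ⊗ s)) ⊕ κ 4 ⊗ (a ⊗ (t ⊗ (t ⊗ t)) ⊕ b ⊗ (u ⊗ (u ⊗ u)))
              ⊜ κ 1 ⊗ (s ⊗ (s ⊗ (s ⊗ s))) ⊕ a ⊗ (κ 4 ⊗ (t ⊗ (t ⊗ t))) ⊕ b ⊗ (κ 4 ⊗ (u ⊗ (u ⊗ u)))) refl s α β t u ⟩
            1# * (s * (s * (s * s))) + α * (four * (t * (t * t))) + β * (four * (u * (u * u))) ∎)))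

    -- When φ(s) = 0 one end of the chord moves to infinity, so `infinity` replaces the second
    -- tangent point. Coordinate x₁ forces the weight -s, and x₂ gives 2 s t = s² - b, solvable as s
    -- ≠ 0. Coordinate x₃ is then φ(s) = 0, and `infinity` corrects x₄.
    φ-root-covered : ∀ s → s ≉0 → φ s ≈ 0# → Covered n
    φ-root-covered s s≉0 φ≈0 = inj₂ (spanned {w₁ = curve s} {tangent t} {infinity} (λ ()) (λ ()) (λ ()) 1# (- s) (d + - s ^ 4 + # 4 * (s * t ^ 3)) (coordinatewise
        (solve 2 (λ a b → κ 1 ⊜ κ 1 ⊗ κ 1 ⊕ a ⊗ κ 0 ⊕ b ⊗ κ 0) refl _ _)
        (solve 2 (λ s b → κ 0 ⊜ κ 1 ⊗ s ⊕ ⊝ s ⊗ κ 1 ⊕ b ⊗ κ 0) refl s _)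
        (begin
          b ≈⟨ solve 2 (λ b s → b ⊜ s ⊗ s ⊕ ⊝ (s ⊛ 2 ⊕ ⊝ b)) refl b s ⟩
          s * s + - (s ^ 2 + - b) ≈⟨ +-congˡ (-‿cong 2st) ⟨
          s * s + - (# 2 * (s * t)) ≈⟨ solve 3 (λ s t a → s ⊗ s ⊕ ⊝ (κ 2 ⊗ (s ⊗ t)) ⊜ κ 1 ⊗ (s ⊗ s) ⊕ ⊝ s ⊗ (κ 2 ⊗ t) ⊕ a ⊗ κ 0) refl s t _ ⟩
          1# * (s * s) + - s * (two * t) + (d + - s ^ 4 + # 4 * (s * t ^ 3)) * 0# ∎)
        (begin
          c ≈⟨ third ⟩
          s ^ 3 + - (# 3 * (s * t ^ 2)) ≈⟨ solve 3 (λ s t a → s ⊛ 3 ⊕ ⊝ (κ 3 ⊗ (s ⊗ t ⊛ 2)) ⊜ κ 1 ⊗ (s ⊗ (s ⊗ s)) ⊕ ⊝ s ⊗ (κ 3 ⊗ (t ⊗ t)) ⊕ a ⊗ κ 0) refl s t _ ⟩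
          1# * (s * (s * s)) + - s * (three * (t * t)) + (d + - s ^ 4 + # 4 * (s * t ^ 3)) * 0# ∎)
        (solve 3 (λ s t d → d ⊜ κ 1 ⊗ (s ⊗ (s ⊗ (s ⊗ s))) ⊕ ⊝ s ⊗ (κ 4 ⊗ (t ⊗ (t ⊗ t))) ⊕ (d ⊕ ⊝ s ⊛ 4 ⊕ κ 4 ⊗ (s ⊗ t ⊛ 3)) ⊗ κ 1) refl s t d)))
      where
      i = proj₁ (inverse s s≉0)
      t = h * ((s ^ 2 + - b) * i)
      2st : # 2 * (s * t) ≈ s ^ 2 + - b
      2st = begin
        # 2 * (s * (h * ((s ^ 2 + - b) * i))) ≈⟨ solve 4 (λ h s x i → κ 2 ⊗ (s ⊗ (h ⊗ (x ⊗ i))) ⊜ κ 2 ⊗ h ⊗ (s ⊗ i) ⊗ x) refl h s _ i ⟩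
        # 2 * h * (s * i) * (s ^ 2 + - b) ≈⟨ *-congʳ (*-cong 2h≈1 (proj₂ (inverse s s≉0))) ⟩
        1# * 1# * (s ^ 2 + - b) ≈⟨ solve 1 (λ x → κ 1 ⊗ κ 1 ⊗ x ⊜ x) refl _ ⟩
        s ^ 2 + - b ∎
      third : c ≈ s ^ 3 + - (# 3 * (s * t ^ 2))
      third = *-cancelˡ (*-≉0 (*-≉0 2≉0 2≉0) s≉0) (begin
        # 2 * # 2 * s * c ≈⟨ solve 3 (λ b c s → κ 2 ⊗ κ 2 ⊗ s ⊗ c ⊜ κ 4 ⊗ s ⊛ 4 ⊕ ⊝ (κ 3 ⊗ ((s ⊛ 2 ⊕ ⊝ b) ⊗ (s ⊛ 2 ⊕ ⊝ b)))
          ⊕ ⊝ (s ⊛ 4 ⊕ κ 6 ⊗ (b ⊗ s ⊛ 2) ⊕ ⊝ (κ 4 ⊗ (c ⊗ s)) ⊕ ⊝ (κ 3 ⊗ (b ⊗ b)))) refl b c s ⟩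
        # 4 * s ^ 4 + - (# 3 * ((s ^ 2 + - b) * (s ^ 2 + - b))) + - φ s
          ≈⟨ +-cong (+-congˡ (-‿cong (*-congˡ (sym (*-cong 2st 2st))))) (-‿cong φ≈0) ⟩
        # 4 * s ^ 4 + - (# 3 * (# 2 * (s * t) * (# 2 * (s * t)))) + - 0#
          ≈⟨ solve 2 (λ s t → κ 4 ⊗ s ⊛ 4 ⊕ ⊝ (κ 3 ⊗ (κ 2 ⊗ (s ⊗ t) ⊗ (κ 2 ⊗ (s ⊗ t)))) ⊕ ⊝ κ 0 ⊜ κ 2 ⊗ κ 2 ⊗ s ⊗ (s ⊛ 3 ⊕ ⊝ (κ 3 ⊗ (s ⊗ t ⊛ 2)))) refl s t ⟩
        # 2 * # 2 * s * (s ^ 3 + - (# 3 * (s * t ^ 2))) ∎)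

    -- The point is on the line joining `curve 0#` and `infinity`; `tangent 0#` has weight 0 and
    -- only completes the plane.
    b≈0×c≈0⇒covered : b ≈ 0# → c ≈ 0# → Covered n
    b≈0×c≈0⇒covered b≈0 c≈0 = inj₂ (spanned {w₁ = curve 0#} {infinity} {tangent 0#} (λ ()) (λ ()) (λ ()) 1# d 0# (coordinatewise
      (solve 1 (λ d → κ 1 ⊜ κ 1 ⊗ κ 1 ⊕ d ⊗ κ 0 ⊕ κ 0 ⊗ κ 0) refl d)
      (solve 1 (λ d → κ 0 ⊜ κ 1 ⊗ κ 0 ⊕ d ⊗ κ 0 ⊕ κ 0 ⊗ κ 1) refl d)
      (trans b≈0 (solve 1 (λ d → κ 0 ⊜ κ 1 ⊗ (κ 0 ⊗ κ 0) ⊕ d ⊗ κ 0 ⊕ κ 0 ⊗ (κ 2 ⊗ κ 0)) refl d))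
      (trans c≈0 (solve 1 (λ d → κ 0 ⊜ κ 1 ⊗ (κ 0 ⊗ (κ 0 ⊗ κ 0)) ⊕ d ⊗ κ 0 ⊕ κ 0 ⊗ (κ 3 ⊗ (κ 0 ⊗ κ 0))) refl d))
      (solve 1 (λ d → d ⊜ κ 1 ⊗ (κ 0 ⊗ (κ 0 ⊗ (κ 0 ⊗ κ 0))) ⊕ d ⊗ κ 1 ⊕ κ 0 ⊗ (κ 4 ⊗ (κ 0 ⊗ (κ 0 ⊗ κ 0)))) refl d)))

    φ-cong : ∀ {x y} → x ≈ y → φ x ≈ φ y
    φ-cong e = +-congʳ (+-cong (+-cong (^-congˡ 4 e) (*-congˡ (*-congˡ (^-congˡ 2 e)))) (-‿cong (*-congˡ (*-congˡ e))))

    HasSecant : Carrier → Set (ℓ₀ ⊔ ℓ)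
    HasSecant s = φ s ≉0 × ∃ λ e → e ≉0 × e * e ≈ # 3 * f s

    hasSecant? : ∀ s → Dec (HasSecant s)
    hasSecant? s = ¬? (φ s ≟ 0#) ×-dec ∃? (λ e (e≉0 , e²) → ≉0-resp e e≉0 , trans (sym (*-cong e e)) e²)
      (λ e → ¬? (e ≟ 0#) ×-dec (e * e ≟ # 3 * f s))

    -- Where f and φ are nonzero, 3 f(s) is a nonsquare, so (3f)^m = -1 = 3^m and f^m = 1. A zero of
    -- φ can only be s = 0; there φ(0) = -3b² gives b = 0, and the constant term of the decic is
    -- divisible by b.
    no-secant⇒power : (∀ s → ¬ HasSecant s) → (∀ s → φ s ≈ 0# → s ≈ 0#) → ∀ s → f s ≈ 0# ⊎ f s ^ m ≈ 1#
    no-secant⇒power no-secant φ-root s with f s ≟ 0#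
    ... | yes e = inj₁ e
    ... | no f≉0 with φ s ≟ 0#
    ...   | yes φ≈0 = inj₁ (trans (ev-congʳ (decic b c d) s≈0) (begin
        f 0# ≈⟨ solve 2 (λ x y → x ⊕ κ 0 ⊗ y ⊜ x) refl (coeff (decic b c d) 0) _ ⟩
        # 54 * (b * b * b * d) + - (# 36 * (b * b * c * c))
          ≈⟨ solve 3 (λ b c d → κ 54 ⊗ (b ⊗ b ⊗ b ⊗ d) ⊕ ⊝ (κ 36 ⊗ (b ⊗ b ⊗ c ⊗ c)) ⊜ (κ 54 ⊗ (b ⊗ b ⊗ d) ⊕ ⊝ (κ 36 ⊗ (b ⊗ c ⊗ c))) ⊗ b) refl b c d ⟩
        (# 54 * (b * b * d) + - (# 36 * (b * c * c))) * b ≈⟨ *-congˡ b≈0 ⟩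
        (# 54 * (b * b * d) + - (# 36 * (b * c * c))) * 0# ≈⟨ zeroʳ _ ⟩
        0# ∎))
      where
      s≈0 = φ-root s φ≈0
      b²≈0 : b * b ≈ 0#
      b²≈0 = *-cancelˡ-0 3≉0 (begin
        # 3 * (b * b) ≈⟨ solve 2 (λ b c → κ 3 ⊗ (b ⊗ b) ⊜ ⊝ (κ 0 ⊛ 4 ⊕ κ 6 ⊗ (b ⊗ κ 0 ⊛ 2) ⊕ ⊝ (κ 4 ⊗ (c ⊗ κ 0)) ⊕ ⊝ (κ 3 ⊗ (b ⊗ b)))) refl b c ⟩
        - φ 0# ≈⟨ -‿cong (trans (φ-cong (sym s≈0)) φ≈0) ⟩
        - 0# ≈⟨ solve 0 (⊝ κ 0 ⊜ κ 0) refl ⟩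
        0# ∎)
      b≈0 : b ≈ 0#
      b≈0 with b ≟ 0#
      ... | yes e = e
      ... | no b≉0 = *-cancelˡ-0 b≉0 b²≈0
    ...   | no φ≉0 = inj₂ (begin
        f s ^ m ≈⟨ solve 1 (λ x → x ⊜ ⊝ (⊝ κ 1 ⊗ x)) refl _ ⟩
        - (- 1# * f s ^ m) ≈⟨ -‿cong (*-congʳ (nonsquare^m λ x e → 3-nonsquare (x , e))) ⟨
        - (# 3 ^ m * f s ^ m) ≈⟨ -‿cong (^-distrib-* (# 3) (f s) m) ⟨
        - ((# 3 * f s) ^ m) ≈⟨ -‿cong (nonsquare^m λ x e → no-secant s (φ≉0 , x , (λ x≈0 →
             *-≉0 3≉0 f≉0 (trans (sym e) (trans (*-congʳ x≈0) (zeroˡ x)))) , e)) ⟩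
        - - 1# ≈⟨ solve 0 (⊝ ⊝ κ 1 ⊜ κ 1) refl ⟩
        1# ∎)

    covered : Covered n
    covered = onSecant (∃? respects hasSecant?)
      where
      IsRoot : Carrier → Set ℓ
      IsRoot s = s ≉0 × φ s ≈ 0#
      respects : ∀ {x y} → x ≈ y → HasSecant x → HasSecant y
      respects e (φ≉0 , r , r≉0 , r²) = ≉0-resp (φ-cong e) φ≉0 , r , r≉0 , trans r² (*-congˡ (ev-congʳ (decic b c d) e))
      respectsRoot : ∀ {x y} → x ≈ y → IsRoot x → IsRoot y
      respectsRoot e (s≉0 , φ≈0) = ≉0-resp e s≉0 , trans (φ-cong (sym e)) φ≈0
      onRoot : ¬ ∃ HasSecant → Dec (∃ IsRoot) → Covered n
      onRoot _ (yes (s , s≉0 , φ≈0)) = φ-root-covered s s≉0 φ≈0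
      onRoot no-secant (no no-root) = b≈0×c≈0⇒covered (proj₁ zeros) (proj₁ (proj₂ zeros))
        where
        φ-root : ∀ s → φ s ≈ 0# → s ≈ 0#
        φ-root s φ≈0 with s ≟ 0#
        ... | yes e = e
        ... | no s≉0 = ⊥-elim (no-root (s , s≉0 , φ≈0))
        zeros = decic-power⇒zero b c d (no-secant⇒power (λ s p → no-secant (s , p)) φ-root)
      onSecant : Dec (∃ HasSecant) → Covered n
      onSecant (yes (s , φ≉0 , e , e≉0 , e²)) = Secant.covered s e φ≉0 e≉0 e²
      onSecant (no no-secant) = onRoot no-secant (∃? respectsRoot (λ s → ¬? (s ≟ 0#) ×-dec (φ s ≟ 0#)))

  -- The linear map of ℙ⁴ induced by t ↦ t + a on the curve. It carries tangent points to tangent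
  -- points and fixes `infinity`, so it preserves the set.
  shift : Carrier → V5 → V5
  shift a v = vec v₀ (v₁ + a * v₀) (v₂ + # 2 * (a * v₁) + a * a * v₀)
      (v₃ + # 3 * (a * v₂) + # 3 * (a * a * v₁) + a * a * a * v₀)
      (v₄ + # 4 * (a * v₃) + # 6 * (a * a * v₂) + # 4 * (a * a * a * v₁) + a * a * a * a * v₀)
    where
    v₀ = v zero
    v₁ = v (suc zero)
    v₂ = v (suc (suc zero))
    v₃ = v (suc (suc (suc zero)))
    v₄ = v (suc (suc (suc (suc zero))))

  shiftPt : Carrier → Pt → Pt
  shiftPt a (curve t) = curve (t + a)
  shiftPt a (tangent t) = tangent (t + a)
  shiftPt a infinity = infinity

  shiftPt-injective : ∀ a w w′ → shiftPt a w ≐ shiftPt a w′ → w ≐ w′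
  shiftPt-injective a (curve s) (curve t) e = +-cancelʳ a s t e
    where open import Algebra.Properties.Group +-group using () renaming (∙-cancelʳ to +-cancelʳ)
  shiftPt-injective a (tangent s) (tangent t) e = +-cancelʳ a s t e
    where open import Algebra.Properties.Group +-group using () renaming (∙-cancelʳ to +-cancelʳ)
  shiftPt-injective a infinity infinity e = e

  shift-⟪⟫ : ∀ a w → shift a ⟪ w ⟫ ≋ ⟪ shiftPt a w ⟫
  shift-⟪⟫ a (curve t) = coordinatewise refl
    (solve 2 (λ a t → t ⊕ a ⊗ κ 1 ⊜ t ⊕ a) refl a t)
    (solve 2 (λ a t → t ⊗ t ⊕ κ 2 ⊗ (a ⊗ t) ⊕ a ⊗ a ⊗ κ 1 ⊜ (t ⊕ a) ⊗ (t ⊕ a)) refl a t)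
    (solve 2 (λ a t → t ⊗ (t ⊗ t) ⊕ κ 3 ⊗ (a ⊗ (t ⊗ t)) ⊕ κ 3 ⊗ (a ⊗ a ⊗ t) ⊕ a ⊗ a ⊗ a ⊗ κ 1 ⊜ (t ⊕ a) ⊗ ((t ⊕ a) ⊗ (t ⊕ a))) refl a t)
    (solve 2 (λ a t → t ⊗ (t ⊗ (t ⊗ t)) ⊕ κ 4 ⊗ (a ⊗ (t ⊗ (t ⊗ t))) ⊕ κ 6 ⊗ (a ⊗ a ⊗ (t ⊗ t)) ⊕ κ 4 ⊗ (a ⊗ a ⊗ a ⊗ t)
      ⊕ a ⊗ a ⊗ a ⊗ a ⊗ κ 1 ⊜ (t ⊕ a) ⊗ ((t ⊕ a) ⊗ ((t ⊕ a) ⊗ (t ⊕ a)))) refl a t)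
  shift-⟪⟫ a (tangent t) = coordinatewise refl
    (solve 1 (λ a → κ 1 ⊕ a ⊗ κ 0 ⊜ κ 1) refl a)
    (solve 2 (λ a t → κ 2 ⊗ t ⊕ κ 2 ⊗ (a ⊗ κ 1) ⊕ a ⊗ a ⊗ κ 0 ⊜ κ 2 ⊗ (t ⊕ a)) refl a t)
    (solve 2 (λ a t → κ 3 ⊗ (t ⊗ t) ⊕ κ 3 ⊗ (a ⊗ (κ 2 ⊗ t)) ⊕ κ 3 ⊗ (a ⊗ a ⊗ κ 1) ⊕ a ⊗ a ⊗ a ⊗ κ 0 ⊜ κ 3 ⊗ ((t ⊕ a) ⊗ (t ⊕ a))) refl a t)
    (solve 2 (λ a t → κ 4 ⊗ (t ⊗ (t ⊗ t)) ⊕ κ 4 ⊗ (a ⊗ (κ 3 ⊗ (t ⊗ t))) ⊕ κ 6 ⊗ (a ⊗ a ⊗ (κ 2 ⊗ t)) ⊕ κ 4 ⊗ (a ⊗ a ⊗ a ⊗ κ 1)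
      ⊕ a ⊗ a ⊗ a ⊗ a ⊗ κ 0 ⊜ κ 4 ⊗ ((t ⊕ a) ⊗ ((t ⊕ a) ⊗ (t ⊕ a)))) refl a t)
  shift-⟪⟫ a infinity = coordinatewise refl
    (solve 1 (λ a → κ 0 ⊕ a ⊗ κ 0 ⊜ κ 0) refl a)
    (solve 1 (λ a → κ 0 ⊕ κ 2 ⊗ (a ⊗ κ 0) ⊕ a ⊗ a ⊗ κ 0 ⊜ κ 0) refl a)
    (solve 1 (λ a → κ 0 ⊕ κ 3 ⊗ (a ⊗ κ 0) ⊕ κ 3 ⊗ (a ⊗ a ⊗ κ 0) ⊕ a ⊗ a ⊗ a ⊗ κ 0 ⊜ κ 0) refl a)
    (solve 1 (λ a → κ 1 ⊕ κ 4 ⊗ (a ⊗ κ 0) ⊕ κ 6 ⊗ (a ⊗ a ⊗ κ 0) ⊕ κ 4 ⊗ (a ⊗ a ⊗ a ⊗ κ 0) ⊕ a ⊗ a ⊗ a ⊗ a ⊗ κ 0 ⊜ κ 1) refl a)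

  shift-cong : ∀ a {v w} → v ≋ w → shift a v ≋ shift a w
  shift-cong a e = coordinatewise (e zero)
    (+-cong (e (suc zero)) (*-congˡ (e zero)))
    (+-cong (+-cong (e (suc (suc zero))) (*-congˡ (*-congˡ (e (suc zero))))) (*-congˡ (e zero)))
    (+-cong (+-cong (+-cong (e (suc (suc (suc zero)))) (*-congˡ (*-congˡ (e (suc (suc zero)))))) (*-congˡ (*-congˡ (e (suc zero))))) (*-congˡ (e zero)))
    (+-cong (+-cong (+-cong (+-cong (e (suc (suc (suc (suc zero))))) (*-congˡ (*-congˡ (e (suc (suc (suc zero)))))))
      (*-congˡ (*-congˡ (e (suc (suc zero)))))) (*-congˡ (*-congˡ (e (suc zero))))) (*-congˡ (e zero)))

  shift-lin3 : ∀ a α β γ u v w → shift a (lin3 α β γ u v w) ≋ lin3 α β γ (shift a u) (shift a v) (shift a w)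
  shift-lin3 a α β γ u v w = coordinatewise refl
    (solve 10 (λ a α β γ u0 v0 w0 u1 v1 w1 → l α β γ u1 v1 w1 ⊕ a ⊗ l α β γ u0 v0 w0
      ⊜ l α β γ (u1 ⊕ a ⊗ u0) (v1 ⊕ a ⊗ v0) (w1 ⊕ a ⊗ w0)) refl a α β γ u₀ v₀ w₀ u₁ v₁ w₁)
    (solve 13 (λ a α β γ u0 v0 w0 u1 v1 w1 u2 v2 w2 →
      let s = λ x0 x1 x2 → x2 ⊕ κ 2 ⊗ (a ⊗ x1) ⊕ a ⊗ a ⊗ x0
      in s (l α β γ u0 v0 w0) (l α β γ u1 v1 w1) (l α β γ u2 v2 w2) ⊜ l α β γ (s u0 u1 u2) (s v0 v1 v2) (s w0 w1 w2))
      refl a α β γ u₀ v₀ w₀ u₁ v₁ w₁ u₂ v₂ w₂)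
    (solve 16 (λ a α β γ u0 v0 w0 u1 v1 w1 u2 v2 w2 u3 v3 w3 →
      let s = λ x0 x1 x2 x3 → x3 ⊕ κ 3 ⊗ (a ⊗ x2) ⊕ κ 3 ⊗ (a ⊗ a ⊗ x1) ⊕ a ⊗ a ⊗ a ⊗ x0
      in s (l α β γ u0 v0 w0) (l α β γ u1 v1 w1) (l α β γ u2 v2 w2) (l α β γ u3 v3 w3)
        ⊜ l α β γ (s u0 u1 u2 u3) (s v0 v1 v2 v3) (s w0 w1 w2 w3))
      refl a α β γ u₀ v₀ w₀ u₁ v₁ w₁ u₂ v₂ w₂ u₃ v₃ w₃)
    (solve 19 (λ a α β γ u0 v0 w0 u1 v1 w1 u2 v2 w2 u3 v3 w3 u4 v4 w4 →
      let s = λ x0 x1 x2 x3 x4 → x4 ⊕ κ 4 ⊗ (a ⊗ x3) ⊕ κ 6 ⊗ (a ⊗ a ⊗ x2) ⊕ κ 4 ⊗ (a ⊗ a ⊗ a ⊗ x1) ⊕ a ⊗ a ⊗ a ⊗ a ⊗ x0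
      in s (l α β γ u0 v0 w0) (l α β γ u1 v1 w1) (l α β γ u2 v2 w2) (l α β γ u3 v3 w3) (l α β γ u4 v4 w4)
        ⊜ l α β γ (s u0 u1 u2 u3 u4) (s v0 v1 v2 v3 v4) (s w0 w1 w2 w3 w4))
      refl a α β γ u₀ v₀ w₀ u₁ v₁ w₁ u₂ v₂ w₂ u₃ v₃ w₃ u₄ v₄ w₄)
    where
    u₀ = u zero
    v₀ = v zero
    w₀ = w zero
    u₁ = u (suc zero)
    v₁ = v (suc zero)
    w₁ = w (suc zero)
    u₂ = u (suc (suc zero))
    v₂ = v (suc (suc zero))
    w₂ = w (suc (suc zero))
    u₃ = u (suc (suc (suc zero)))
    v₃ = v (suc (suc (suc zero)))
    w₃ = w (suc (suc (suc zero)))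
    u₄ = u (suc (suc (suc (suc zero))))
    v₄ = v (suc (suc (suc (suc zero))))
    w₄ = w (suc (suc (suc (suc zero))))
    l : ∀ {n} → (α β γ x y z : Expr ℤ.ℤ n) → Expr ℤ.ℤ n
    l α β γ x y z = α ⊗ x ⊕ β ⊗ y ⊕ γ ⊗ z

  Covered-shift : ∀ a μ {v n} → μ ≉0 → (∀ i → v i ≈ μ * shift a n i) → Covered n → Covered v
  Covered-shift a μ {v} {n} μ≉0 e (inj₁ (w , λ′ , λ≉0 , n≋)) = inj₁ (shiftPt a w , μ * λ′ , *-≉0 μ≉0 λ≉0 , λ i → begin
      v i ≈⟨ e i ⟩
      μ * shift a n i ≈⟨ *-congˡ (trans (shift-cong a {n} {lin3 λ′ 0# 0# ⟪ w ⟫ ⟪ w ⟫ ⟪ w ⟫} (λ j → trans (n≋ j) (pad _ _)) i)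
           (shift-lin3 a λ′ 0# 0# ⟪ w ⟫ ⟪ w ⟫ ⟪ w ⟫ i)) ⟩
      μ * lin3 λ′ 0# 0# (shift a ⟪ w ⟫) (shift a ⟪ w ⟫) (shift a ⟪ w ⟫) i ≈⟨ *-congˡ (pad _ _) ⟨
      μ * (λ′ * shift a ⟪ w ⟫ i) ≈⟨ *-assoc _ _ _ ⟨
      μ * λ′ * shift a ⟪ w ⟫ i ≈⟨ *-congˡ (shift-⟪⟫ a w i) ⟩
      μ * λ′ * ⟪ shiftPt a w ⟫ i ∎)
    where
    -- A multiple of one vector is written as a combination of three, so that `shift-lin3` also
    -- supplies homogeneity.
    pad : ∀ x y → x * y ≈ x * y + 0# * y + 0# * y
    pad = solve 2 (λ x y → x ⊗ y ⊜ x ⊗ y ⊕ κ 0 ⊗ y ⊕ κ 0 ⊗ y) refl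
  Covered-shift a μ {v} {n} μ≉0 e (inj₂ (spanned {w₁} {w₂} {w₃} d₁₂ d₁₃ d₂₃ α β γ n≋)) =
    inj₂ (spanned {w₁ = shiftPt a w₁} {shiftPt a w₂} {shiftPt a w₃} (λ z → d₁₂ (shiftPt-injective a w₁ w₂ z)) (λ z → d₁₃ (shiftPt-injective a w₁ w₃ z)) (λ z → d₂₃ (shiftPt-injective a w₂ w₃ z))
      (μ * α) (μ * β) (μ * γ) λ i → begin
        v i ≈⟨ e i ⟩
        μ * shift a n i ≈⟨ *-congˡ (trans (shift-cong a n≋ i) (shift-lin3 a α β γ ⟪ w₁ ⟫ ⟪ w₂ ⟫ ⟪ w₃ ⟫ i)) ⟩
        μ * lin3 α β γ (shift a ⟪ w₁ ⟫) (shift a ⟪ w₂ ⟫) (shift a ⟪ w₃ ⟫) i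
          ≈⟨ *-congˡ (+-cong (+-cong (*-congˡ (shift-⟪⟫ a w₁ i)) (*-congˡ (shift-⟪⟫ a w₂ i))) (*-congˡ (shift-⟪⟫ a w₃ i))) ⟩
        μ * lin3 α β γ ⟪ shiftPt a w₁ ⟫ ⟪ shiftPt a w₂ ⟫ ⟪ shiftPt a w₃ ⟫ i
          ≈⟨ solve 7 (λ m a b c x y z → m ⊗ (a ⊗ x ⊕ b ⊗ y ⊕ c ⊗ z) ⊜ m ⊗ a ⊗ x ⊕ m ⊗ b ⊗ y ⊕ m ⊗ c ⊗ z) refl μ α β γ _ _ _ ⟩
        lin3 (μ * α) (μ * β) (μ * γ) ⟪ shiftPt a w₁ ⟫ ⟪ shiftPt a w₂ ⟫ ⟪ shiftPt a w₃ ⟫ i ∎)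

  covered-affine : ∀ v → v zero ≉0 → Covered v
  covered-affine v v₀≉0 = Covered-shift a v₀ v₀≉0 (coordinatewise
      (solve 1 (λ x → x ⊜ x ⊗ κ 1) refl v₀)
      (normalise v₁ (solve 1 (λ x → x ⊜ κ 0 ⊕ x ⊗ κ 1) refl a))
      (normalise v₂ (solve 2 (λ a x → x ⊜ x ⊕ ⊝ (a ⊗ a) ⊕ κ 2 ⊗ (a ⊗ κ 0) ⊕ a ⊗ a ⊗ κ 1) refl a (v₂ * i)))
      (normalise v₃ (solve 3 (λ a b x → x ⊜ (x ⊕ ⊝ (κ 3 ⊗ (a ⊗ b)) ⊕ ⊝ (a ⊗ a ⊗ a)) ⊕ κ 3 ⊗ (a ⊗ b) ⊕ κ 3 ⊗ (a ⊗ a ⊗ κ 0) ⊕ a ⊗ a ⊗ a ⊗ κ 1) refl a b (v₃ * i)))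
      (normalise v₄ (solve 4 (λ a b c x → x ⊜ (x ⊕ ⊝ (κ 4 ⊗ (a ⊗ c)) ⊕ ⊝ (κ 6 ⊗ (a ⊗ a ⊗ b)) ⊕ ⊝ (a ⊗ a ⊗ a ⊗ a))
        ⊕ κ 4 ⊗ (a ⊗ c) ⊕ κ 6 ⊗ (a ⊗ a ⊗ b) ⊕ κ 4 ⊗ (a ⊗ a ⊗ a ⊗ κ 0) ⊕ a ⊗ a ⊗ a ⊗ a ⊗ κ 1) refl a b c (v₄ * i))))
      (Affine.covered b c d)
    where
    v₀ = v zero
    v₁ = v (suc zero)
    v₂ = v (suc (suc zero))
    v₃ = v (suc (suc (suc zero)))
    v₄ = v (suc (suc (suc (suc zero))))
    i = proj₁ (inverse v₀ v₀≉0)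
    -- These values solve v = v₀ · shift a (1, 0, b, c, d), one coordinate after another.
    a = v₁ * i
    b = v₂ * i + - (a * a)
    c = v₃ * i + - (# 3 * (a * b)) + - (a * a * a)
    d = v₄ * i + - (# 4 * (a * c)) + - (# 6 * (a * a * b)) + - (a * a * a * a)
    normalise : ∀ x {y} → x * i ≈ y → x ≈ v₀ * y
    normalise x {y} e = begin
      x ≈⟨ *-identityʳ x ⟨
      x * 1# ≈⟨ *-congˡ (proj₂ (inverse v₀ v₀≉0)) ⟨
      x * (v₀ * i) ≈⟨ solve 3 (λ x u i → x ⊗ (u ⊗ i) ⊜ u ⊗ (x ⊗ i)) refl x v₀ i ⟩
      v₀ * (x * i) ≈⟨ *-congˡ e ⟩
      v₀ * y ∎

  -- Replacing the sequence y by y_(k+1) - t y_k removes the contribution of t and leaves a sequence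
  -- on the chord through r and s, with weights multiplied by r - t and s - t. Dividing by these
  -- recovers α and β.
  secantPlane : ∀ {y₀ y₁ y₂ y₃ r s t} → ¬ r ≈ s → ¬ r ≈ t → ¬ s ≈ t →
    y₃ + - (t * y₂) ≈ (r + s) * (y₂ + - (t * y₁)) + - (r * s * (y₁ + - (t * y₀))) →
    ∃ λ α → ∃ λ β → ∃ λ γ → y₀ ≈ α + β + γ × y₁ ≈ α * r + β * s + γ * t
      × y₂ ≈ α * (r * r) + β * (s * s) + γ * (t * t)
      × y₃ ≈ α * (r * (r * r)) + β * (s * (s * s)) + γ * (t * (t * t))
  -- The difference sequence has only three terms; the fourth coordinate asked for by `chord` is
  -- whatever the recurrence produces.
  secantPlane {y₀} {y₁} {y₂} {y₃} {r} {s} {t} r≉s r≉t s≉t e = lift-chord (chord {y₃ = _} r≉s e refl)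
    where
    r-t≉0 : (r + - t) ≉0
    r-t≉0 z = r≉t (x-y≈0⇒x≈y z)
    s-t≉0 : (s + - t) ≉0
    s-t≉0 z = s≉t (x-y≈0⇒x≈y z)
    i = proj₁ (inverse (r + - t) r-t≉0)
    j = proj₁ (inverse (s + - t) s-t≉0)
    divided : ∀ {x k} → x * k ≈ 1# → ∀ z → z ≈ z * k * x
    divided {x} {k} e z = sym (trans (solve 3 (λ z k x → z ⊗ k ⊗ x ⊜ z ⊗ (x ⊗ k)) refl z k x) (trans (*-congˡ e) (*-identityʳ z)))
    lift-chord : (∃ λ α → ∃ λ β → y₁ + - (t * y₀) ≈ α + β × y₂ + - (t * y₁) ≈ α * r + β * s
        × y₃ + - (t * y₂) ≈ α * (r * r) + β * (s * s) × _) → _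
    lift-chord (α′ , β′ , e₀ , e₁ , e₂ , _) = α , β , γ , s₀ , s₁ , s₂ , s₃
      where
      α = α′ * i
      β = β′ * j
      γ = y₀ + - (α + β)
      α′≈ : α′ ≈ α * (r + - t)
      α′≈ = divided (proj₂ (inverse (r + - t) r-t≉0)) α′
      β′≈ : β′ ≈ β * (s + - t)
      β′≈ = divided (proj₂ (inverse (s + - t) s-t≉0)) β′
      s₀ : y₀ ≈ α + β + γ
      s₀ = solve 2 (λ y u → y ⊜ u ⊕ (y ⊕ ⊝ u)) refl y₀ (α + β)
      next : ∀ {x y z ρ σ} → z + - (t * y) ≈ α′ * ρ + β′ * σ → y ≈ α * ρ + β * σ + γ * x →
        z ≈ α * (r * ρ) + β * (s * σ) + γ * (t * x)
      next {x} {y} {z} {ρ} {σ} e e′ = begin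
        z ≈⟨ solve 2 (λ z u → z ⊜ (z ⊕ ⊝ u) ⊕ u) refl z (t * y) ⟩
        (z + - (t * y)) + t * y ≈⟨ +-cong (trans e (+-cong (*-congʳ α′≈) (*-congʳ β′≈))) (*-congˡ e′) ⟩
        (α * (r + - t) * ρ + β * (s + - t) * σ) + t * (α * ρ + β * σ + γ * x)
          ≈⟨ solve 9 (λ a b c r s t ρ σ x → (a ⊗ (r ⊕ ⊝ t) ⊗ ρ ⊕ b ⊗ (s ⊕ ⊝ t) ⊗ σ) ⊕ t ⊗ (a ⊗ ρ ⊕ b ⊗ σ ⊕ c ⊗ x)
             ⊜ a ⊗ (r ⊗ ρ) ⊕ b ⊗ (s ⊗ σ) ⊕ c ⊗ (t ⊗ x)) refl α β γ r s t ρ σ x ⟩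
        α * (r * ρ) + β * (s * σ) + γ * (t * x) ∎
      units : ∀ a b → a + b ≈ a * 1# + b * 1#
      units a b = +-cong (sym (*-identityʳ a)) (sym (*-identityʳ b))
      s₁ : y₁ ≈ α * r + β * s + γ * t
      s₁ = trans (next {1#} {y₀} {y₁} {1#} {1#} (trans e₀ (units α′ β′)) (trans s₀ (+-cong (units α β) (sym (*-identityʳ γ)))))
        (+-cong (+-cong (*-congˡ (*-identityʳ r)) (*-congˡ (*-identityʳ s))) (*-congˡ (*-identityʳ t)))
      s₂ : y₂ ≈ α * (r * r) + β * (s * s) + γ * (t * t)
      s₂ = next e₁ s₁
      s₃ : y₃ ≈ α * (r * (r * r)) + β * (s * (s * s)) + γ * (t * (t * t))
      s₃ = next e₂ s₂

  -- The factors 1, 2, 3, 4 identify the hyperplane with ℙ³ so that `tangent t` becomes (1, t, t²,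
  -- t³) on the twisted cubic, and `infinity` its point at infinity.
  module Hyperplane (y₀ y₁ y₂ y₃ : Carrier) where

    n : V5
    n = vec 0# y₀ (# 2 * y₁) (# 3 * y₂) (# 4 * y₃)

    module _ (r : Carrier) (Q≉0 : (y₂ + r * (- (# 2 * y₁) + r * (y₀ + r * 0#))) ≉0) where

      -- B - s A as a polynomial in s, for the `A` and `B` below: its zeros are the s for which the
      -- third point of the plane coincides with s.
      tangentConditions : Poly
      tangentConditions = (y₃ + - (r * y₂)) ∷ (- (# 2 * (y₂ + - (r * y₁)))) ∷ (y₁ + - (r * y₀)) ∷ []

      -- The values of `B` and `A` at s = r. As a polynomial in s, r A - B equals -Pᵣ + s Qᵣ; it is
      -- not the zero polynomial because Qᵣ ≠ 0.
      Pᵣ Qᵣ : Carrier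
      Pᵣ = y₃ + - (# 2 * (r * y₂)) + r * r * y₁
      Qᵣ = y₂ + r * (- (# 2 * y₁) + r * (y₀ + r * 0#))

      -- Its roots are the s for which s = r or the third point t of the plane coincides with r or s.
      bad : Poly
      bad = linear r *ₚ (((- Pᵣ) ∷ Qᵣ ∷ []) *ₚ tangentConditions)

      on-tangent : tangentConditions ≈ₚ [] → Covered n
      on-tangent e = inj₁ (tangent r , y₀ , y₀≉0 , coordinatewise
          (sym (zeroʳ y₀))
          (sym (*-identityʳ y₀))
          (trans (*-congˡ y₁≈) (solve 2 (λ r y → κ 2 ⊗ (r ⊗ y) ⊜ y ⊗ (κ 2 ⊗ r)) refl r y₀))
          (trans (*-congˡ (trans y₂≈ (*-congˡ y₁≈))) (solve 2 (λ r y → κ 3 ⊗ (r ⊗ (r ⊗ y)) ⊜ y ⊗ (κ 3 ⊗ (r ⊗ r))) refl r y₀))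
          (trans (*-congˡ (trans y₃≈ (*-congˡ (trans y₂≈ (*-congˡ y₁≈)))))
            (solve 2 (λ r y → κ 4 ⊗ (r ⊗ (r ⊗ (r ⊗ y))) ⊜ y ⊗ (κ 4 ⊗ (r ⊗ (r ⊗ r)))) refl r y₀)))
        where
        y₁≈ : y₁ ≈ r * y₀
        y₁≈ = x-y≈0⇒x≈y (at e 2)
        y₃≈ : y₃ ≈ r * y₂
        y₃≈ = x-y≈0⇒x≈y (at e 0)
        y₂≈ : y₂ ≈ r * y₁
        y₂≈ = x-y≈0⇒x≈y (*-cancelˡ-0 2≉0 (begin
          # 2 * (y₂ + - (r * y₁)) ≈⟨ solve 1 (λ x → x ⊜ ⊝ ⊝ x) refl _ ⟩
          - - (# 2 * (y₂ + - (r * y₁))) ≈⟨ -‿cong (at e 1) ⟩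
          - 0# ≈⟨ solve 0 (⊝ κ 0 ⊜ κ 0) refl ⟩
          0# ∎))
        y₀≉0 : y₀ ≉0
        y₀≉0 z = Q≉0 (begin
          Qᵣ ≈⟨ +-congʳ (trans y₂≈ (*-congˡ y₁≈)) ⟩
          r * (r * y₀) + r * (- (# 2 * y₁) + r * (y₀ + r * 0#)) ≈⟨ +-congˡ (*-congˡ (+-congʳ (-‿cong (*-congˡ y₁≈)))) ⟩
          r * (r * y₀) + r * (- (# 2 * (r * y₀)) + r * (y₀ + r * 0#))
            ≈⟨ solve 2 (λ r y → r ⊗ (r ⊗ y) ⊕ r ⊗ (⊝ (κ 2 ⊗ (r ⊗ y)) ⊕ r ⊗ (y ⊕ r ⊗ κ 0)) ⊜ κ 0) refl r y₀ ⟩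
          0# ∎)

      module _ (s : Carrier) (s-r≉0 : (s + - r) ≉0) (PQ≉0 : (- Pᵣ + s * (Qᵣ + s * 0#)) ≉0) (tc≉0 : ev tangentConditions s ≉0) where
        -- The plane through the points r, s, t of the twisted cubic contains y exactly when y is
        -- annihilated by (T - r)(T - s)(T - t), which reads B = t A. So t = B / A, or the point at
        -- infinity if A = 0.
        A B : Carrier
        A = y₂ + - ((r + s) * y₁) + r * s * y₀
        B = y₃ + - ((r + s) * y₂) + r * s * y₁

        r≉s : ¬ r ≈ s
        r≉s e = s-r≉0 (x≈y⇒x-y≈0 (sym e))

        -- The fourth coordinate passed to `chord` is a dummy; the actual y₃ is adjusted by the
        -- weight of `infinity`.
        onChord : A ≈ 0# → Covered n
        onChord A≈0 = with-infinity (chord {y₃ = (r + s) * y₂ + - (r * s * y₁)} r≉s (x-y≈0⇒x≈y (trans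
            (solve 3 (λ y x z → y ⊕ ⊝ (x ⊕ ⊝ z) ⊜ y ⊕ ⊝ x ⊕ z) refl y₂ ((r + s) * y₁) (r * s * y₀)) A≈0)) refl)
          where
          with-infinity : (∃ λ α → ∃ λ β → y₀ ≈ α + β × y₁ ≈ α * r + β * s × y₂ ≈ α * (r * r) + β * (s * s) × _) → Covered n
          with-infinity (α , β , e₀ , e₁ , e₂ , _) = inj₂ (spanned {w₁ = tangent r} {tangent s} {infinity} r≉s (λ ()) (λ ())
            α β (# 4 * (y₃ + - (α * (r * (r * r)) + β * (s * (s * s))))) (coordinatewise
              (solve 3 (λ a b c → κ 0 ⊜ a ⊗ κ 0 ⊕ b ⊗ κ 0 ⊕ c ⊗ κ 0) refl α β _)
              (trans e₀ (solve 3 (λ a b c → a ⊕ b ⊜ a ⊗ κ 1 ⊕ b ⊗ κ 1 ⊕ c ⊗ κ 0) refl α β _))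
              (trans (*-congˡ e₁) (solve 5 (λ a b c r s → κ 2 ⊗ (a ⊗ r ⊕ b ⊗ s) ⊜ a ⊗ (κ 2 ⊗ r) ⊕ b ⊗ (κ 2 ⊗ s) ⊕ c ⊗ κ 0) refl α β _ r s))
              (trans (*-congˡ e₂) (solve 5 (λ a b c r s → κ 3 ⊗ (a ⊗ (r ⊗ r) ⊕ b ⊗ (s ⊗ s)) ⊜ a ⊗ (κ 3 ⊗ (r ⊗ r)) ⊕ b ⊗ (κ 3 ⊗ (s ⊗ s)) ⊕ c ⊗ κ 0) refl α β _ r s))
              (solve 5 (λ a b y r s → κ 4 ⊗ y ⊜ a ⊗ (κ 4 ⊗ (r ⊗ (r ⊗ r))) ⊕ b ⊗ (κ 4 ⊗ (s ⊗ (s ⊗ s)))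
                ⊕ κ 4 ⊗ (y ⊕ ⊝ (a ⊗ (r ⊗ (r ⊗ r)) ⊕ b ⊗ (s ⊗ (s ⊗ s)))) ⊗ κ 1) refl α β y₃ r s)))

        onSecantPlane : A ≉0 → Covered n
        onSecantPlane A≉0 = with-t (secantPlane r≉s r≉t s≉t (x-y≈0⇒x≈y (begin
              y₃ + - (t * y₂) + - ((r + s) * (y₂ + - (t * y₁)) + - (r * s * (y₁ + - (t * y₀))))
                ≈⟨ solve 7 (λ y0 y1 y2 y3 r s t → y3 ⊕ ⊝ (t ⊗ y2) ⊕ ⊝ ((r ⊕ s) ⊗ (y2 ⊕ ⊝ (t ⊗ y1)) ⊕ ⊝ (r ⊗ s ⊗ (y1 ⊕ ⊝ (t ⊗ y0))))
                  ⊜ y3 ⊕ ⊝ ((r ⊕ s) ⊗ y2) ⊕ r ⊗ s ⊗ y1 ⊕ ⊝ (t ⊗ (y2 ⊕ ⊝ ((r ⊕ s) ⊗ y1) ⊕ r ⊗ s ⊗ y0))) refl y₀ y₁ y₂ y₃ r s t ⟩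
              B + - (t * A) ≈⟨ x≈y⇒x-y≈0 (sym tA≈B) ⟩
              0# ∎)))
          where
          i = proj₁ (inverse A A≉0)
          t = B * i
          tA≈B : t * A ≈ B
          tA≈B = trans (solve 3 (λ b i a → b ⊗ i ⊗ a ⊜ b ⊗ (a ⊗ i)) refl B i A) (trans (*-congˡ (proj₂ (inverse A A≉0))) (*-identityʳ B))
          r≉t : ¬ r ≈ t
          r≉t e = PQ≉0 (begin
            - Pᵣ + s * (Qᵣ + s * 0#)
              ≈⟨ solve 6 (λ y0 y1 y2 y3 r s → ⊝ (y3 ⊕ ⊝ (κ 2 ⊗ (r ⊗ y2)) ⊕ r ⊗ r ⊗ y1) ⊕ s ⊗ (y2 ⊕ r ⊗ (⊝ (κ 2 ⊗ y1) ⊕ r ⊗ (y0 ⊕ r ⊗ κ 0)) ⊕ s ⊗ κ 0)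
                ⊜ r ⊗ (y2 ⊕ ⊝ ((r ⊕ s) ⊗ y1) ⊕ r ⊗ s ⊗ y0) ⊕ ⊝ (y3 ⊕ ⊝ ((r ⊕ s) ⊗ y2) ⊕ r ⊗ s ⊗ y1)) refl y₀ y₁ y₂ y₃ r s ⟩
            r * A + - B ≈⟨ x≈y⇒x-y≈0 (trans (*-congʳ e) tA≈B) ⟩
            0# ∎)
          s≉t : ¬ s ≈ t
          s≉t e = tc≉0 (begin
            ev tangentConditions s
              ≈⟨ solve 6 (λ y0 y1 y2 y3 r s → (y3 ⊕ ⊝ (r ⊗ y2)) ⊕ s ⊗ (⊝ (κ 2 ⊗ (y2 ⊕ ⊝ (r ⊗ y1))) ⊕ s ⊗ ((y1 ⊕ ⊝ (r ⊗ y0)) ⊕ s ⊗ κ 0))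
                ⊜ (y3 ⊕ ⊝ ((r ⊕ s) ⊗ y2) ⊕ r ⊗ s ⊗ y1) ⊕ ⊝ (s ⊗ (y2 ⊕ ⊝ ((r ⊕ s) ⊗ y1) ⊕ r ⊗ s ⊗ y0))) refl y₀ y₁ y₂ y₃ r s ⟩
            B + - (s * A) ≈⟨ x≈y⇒x-y≈0 (sym (trans (*-congʳ e) tA≈B)) ⟩
            0# ∎)
          with-t : (∃ λ α → ∃ λ β → ∃ λ γ → y₀ ≈ α + β + γ × y₁ ≈ α * r + β * s + γ * t
            × y₂ ≈ α * (r * r) + β * (s * s) + γ * (t * t)
            × y₃ ≈ α * (r * (r * r)) + β * (s * (s * s)) + γ * (t * (t * t))) → Covered n
          with-t (α , β , γ , e₀ , e₁ , e₂ , e₃) = inj₂ (spanned {w₁ = tangent r} {tangent s} {tangent t} r≉s r≉t s≉t α β γ (coordinatewise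
            (solve 3 (λ a b c → κ 0 ⊜ a ⊗ κ 0 ⊕ b ⊗ κ 0 ⊕ c ⊗ κ 0) refl α β γ)
            (trans e₀ (solve 3 (λ a b c → a ⊕ b ⊕ c ⊜ a ⊗ κ 1 ⊕ b ⊗ κ 1 ⊕ c ⊗ κ 1) refl α β γ))
            (trans (*-congˡ e₁) (scale (# 2) r s t))
            (trans (*-congˡ e₂) (scale (# 3) (r * r) (s * s) (t * t)))
            (trans (*-congˡ e₃) (scale (# 4) (r * (r * r)) (s * (s * s)) (t * (t * t))))))
            where
            scale : ∀ k x y z → k * (α * x + β * y + γ * z) ≈ α * (k * x) + β * (k * y) + γ * (k * z)
            scale k x y z = solve 7 (λ k a b c x y z → k ⊗ (a ⊗ x ⊕ b ⊗ y ⊕ c ⊗ z) ⊜ a ⊗ (k ⊗ x) ⊕ b ⊗ (k ⊗ y) ⊕ c ⊗ (k ⊗ z)) refl k α β γ x y z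

        covered-at : Covered n
        covered-at with A ≟ 0#
        ... | yes A≈0 = onChord A≈0
        ... | no A≉0 = onSecantPlane A≉0

      zero? : ∀ p → Dec (p ≈ₚ [])
      zero? [] = yes ≈ₚ.refl
      zero? (a ∷ p) with a ≟ 0# | zero? p
      ... | yes e | yes e′ = yes (≈ₚ.trans (∷-cong e e′) 0∷[])
      ... | no ne | _ = no λ e → ne (at e 0)
      ... | _ | no ne = no λ e → ne (coeffwise λ k → at e (suc k))

      covered-generic : Covered n
      covered-generic = decide (zero? tangentConditions)
        where
        decide : Dec (tangentConditions ≈ₚ []) → Covered n
        decide (yes e) = on-tangent e
        decide (no ne) = covered-at s (λ z → s-bad (trans (*-congʳ (trans (ev-linear r s) z)) (zeroˡ _)))
            (λ z → s-bad (trans (*-congˡ (trans (*-congʳ z) (zeroˡ _))) (zeroʳ _)))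
            (λ z → s-bad (trans (*-congˡ (trans (*-congˡ z) (zeroʳ _))) (zeroʳ _)))
          where
          L : Poly
          L = (- Pᵣ) ∷ Qᵣ ∷ []
          bad≉[] : ¬ bad ≈ₚ []
          bad≉[] e = ne (*ₚ-cancel-0 L tangentConditions
            (λ z → Q≉0 (at z 1)) (linear-cancel r (L *ₚ tangentConditions) e))
          Deg-bad : Deg 1 q bad
          Deg-bad = Deg-weaken {3} {7} {1} {q} (ℕ.≤-trans (ℕ.≤-trans (ℕ.m≤m+n 8 81) 89≤q) (ℕ.m≤m+n q 3))
            (Deg-* {1} {2} {2} {5} (Deg-length (linear r) ℕ.≤-refl)
              (Deg-* {1} {2} {1} {3} (Deg-length L ℕ.≤-refl) (Deg-length tangentConditions ℕ.≤-refl)))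
          s = proj₁ (nonroot bad bad≉[] Deg-bad)
          s-bad : ev (linear r) s * (ev L s * ev tangentConditions s) ≉0
          s-bad = ≉0-resp (trans (ev-* (linear r) (L *ₚ tangentConditions) s) (*-congˡ (ev-* L tangentConditions s)))
            (proj₂ (nonroot bad bad≉[] Deg-bad))

    covered-hyperplane : ¬ (y₀ ≈ 0# × y₁ ≈ 0# × y₂ ≈ 0# × y₃ ≈ 0#) → Covered n
    covered-hyperplane nonzero = decide (y₀ ≟ 0#) (y₁ ≟ 0#) (y₂ ≟ 0#)
      where
      -- Its value at r is Qᵣ, which must not vanish. It is the zero polynomial only when y₀ = y₁ =
      -- y₂ = 0, and then the point is `infinity`.
      osculating : Poly
      osculating = y₂ ∷ (- (# 2 * y₁)) ∷ y₀ ∷ []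
      generic : ¬ osculating ≈ₚ [] → Covered n
      generic ne = covered-generic (proj₁ r) (proj₂ r)
        where r = nonroot osculating ne (Deg-length osculating (ℕ.≤-trans (ℕ.m≤m+n 3 86) 89≤q))
      decide : Dec (y₀ ≈ 0#) → Dec (y₁ ≈ 0#) → Dec (y₂ ≈ 0#) → Covered n
      decide (no ne) _ _ = generic λ e → ne (at e 2)
      decide _ (no ne) _ = generic λ e → ne (*-cancelˡ-0 2≉0 (begin
          # 2 * y₁ ≈⟨ solve 1 (λ x → x ⊜ ⊝ ⊝ x) refl _ ⟩
          - - (# 2 * y₁) ≈⟨ -‿cong (at e 1) ⟩
          - 0# ≈⟨ solve 0 (⊝ κ 0 ⊜ κ 0) refl ⟩
          0# ∎))
      decide _ _ (no ne) = generic λ e → ne (at e 0)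
      decide (yes e₀) (yes e₁) (yes e₂) = inj₁ (infinity , # 4 * y₃ , 4y₃≉0 , coordinatewise
          (sym (zeroʳ _)) (trans e₀ (sym (zeroʳ _)))
          (trans (*-congˡ e₁) (trans (zeroʳ _) (sym (zeroʳ _))))
          (trans (*-congˡ e₂) (trans (zeroʳ _) (sym (zeroʳ _))))
          (sym (*-identityʳ _)))
        where
        4y₃≉0 : (# 4 * y₃) ≉0
        4y₃≉0 z = nonzero (e₀ , e₁ , e₂ , *-cancelˡ-0 2≉0 (*-cancelˡ-0 2≉0 (trans
          (solve 1 (λ y → κ 2 ⊗ (κ 2 ⊗ y) ⊜ κ 4 ⊗ y) refl y₃) z)))

  Covered-resp : ∀ {v w} → v ≋ w → Covered w → Covered v
  Covered-resp e (inj₁ (p , a , a≉0 , e′)) = inj₁ (p , a , a≉0 , λ i → trans (e i) (e′ i))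
  Covered-resp e (inj₂ (spanned {w₁} {w₂} {w₃} d₁ d₂ d₃ α β γ e′)) = inj₂ (spanned {w₁ = w₁} {w₂} {w₃} d₁ d₂ d₃ α β γ λ i → trans (e i) (e′ i))

  covered-all : ∀ v → ¬ IsZeroVec v → Covered v
  covered-all v v≉0 with v zero ≟ 0#
  ... | no v₀≉0 = covered-affine v v₀≉0
  ... | yes v₀≈0 = Covered-resp {v} {Hyperplane.n v₁ y₁ y₂ y₃} (coordinatewise v₀≈0 refl v₂≈ v₃≈ v₄≈)
      (Hyperplane.covered-hyperplane v₁ y₁ y₂ y₃ λ (e₀ , e₁ , e₂ , e₃) → v≉0 (λ where
        zero → v₀≈0
        (suc zero) → e₀
        (suc (suc zero)) → trans v₂≈ (trans (*-congˡ e₁) (zeroʳ _))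
        (suc (suc (suc zero))) → trans v₃≈ (trans (*-congˡ e₂) (zeroʳ _))
        (suc (suc (suc (suc zero)))) → trans v₄≈ (trans (*-congˡ e₃) (zeroʳ _))))
    where
    v₁ = v (suc zero)
    v₂ = v (suc (suc zero))
    v₃ = v (suc (suc (suc zero)))
    v₄ = v (suc (suc (suc (suc zero))))
    y₁ = h * v₂
    y₂ = θ * v₃
    y₃ = h * (h * v₄)
    v₂≈ : v₂ ≈ # 2 * y₁
    v₂≈ = sym (trans (sym (*-assoc _ _ _)) (trans (*-congʳ 2h≈1) (*-identityˡ _)))
    v₃≈ : v₃ ≈ # 3 * y₂
    v₃≈ = sym (trans (sym (*-assoc _ _ _)) (trans (*-congʳ 3θ≈1) (*-identityˡ _)))
    v₄≈ : v₄ ≈ # 4 * y₃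
    v₄≈ = sym (trans (solve 2 (λ h x → κ 4 ⊗ (h ⊗ (h ⊗ x)) ⊜ (κ 2 ⊗ h) ⊗ ((κ 2 ⊗ h) ⊗ x)) refl h _)
        (trans (*-cong 2h≈1 (*-congʳ 2h≈1)) (trans (*-identityˡ _) (*-identityˡ _))))

-- Linear dependence of n + 1 vectors in dimension n.

module LinearAlgebra {ℓ₀ ℓ} (K : Field ℓ₀ ℓ) (_≟_ : ∀ x y → Dec (Field._≈_ K x y)) where
  open Field K hiding (zero)
  open IntegerSolver commutativeRing using (solve)
  open FieldLemmas K
  open import Algebra.Properties.Semiring.Sum semiring
    using (sum; sum-cong-≋; sum-remove; ∑-distrib-+; *-distribʳ-sum)
  open import Relation.Binary.Reasoning.Setoid setoid

  sum-zero : ∀ {n} {f : Fin n → Carrier} → (∀ i → f i ≈ 0#) → sum f ≈ 0#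
  sum-zero {zero} e = refl
  sum-zero {suc n} e = trans (+-cong (e zero) (sum-zero (λ i → e (suc i)))) (+-identityˡ 0#)

  Dependent : ∀ m n → (Fin m → Fin n → Carrier) → Set (ℓ₀ ⊔ ℓ)
  Dependent m n v = ∃ λ (x : Fin m → Carrier) → (∃ λ i → x i ≉0) × (∀ j → sum (λ i → x i * v i j) ≈ 0#)

  -- Gaussian elimination on the first column. A pivot row is subtracted from the others, and its
  -- own weight is chosen afterwards to cancel that column; without a pivot the first row is given
  -- weight 0.
  kernel : ∀ n (v : Fin (suc n) → Fin n → Carrier) → Dependent (suc n) n v
  kernel zero v = (λ _ → 1#) , (zero , 1≉0) , λ ()
  kernel (suc n) v = pivot (Fin.any? (λ i → ≉0? (v i zero)))
    where
    ≉0? : ∀ y → Dec (y ≉0)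
    ≉0? y = ¬? (y ≟ 0#)
    pivot : Dec (∃ λ i → v i zero ≉0) → Dependent (suc (suc n)) (suc n) v
    pivot (no none) = x , (suc (proj₁ nz) , proj₂ nz) , λ where
        zero → sum-zero {f = λ i → x i * v i zero} λ i → trans (*-congˡ (column₀ i)) (zeroʳ (x i))
        (suc j) → trans (+-cong (zeroˡ (v zero (suc j))) (proj₂ (proj₂ ih) j)) (+-identityˡ 0#)
      where
      column₀ : ∀ i → v i zero ≈ 0#
      column₀ i with v i zero ≟ 0#
      ... | yes e = e
      ... | no ne = ⊥-elim (none (i , ne))
      ih = kernel n (λ i j → v (suc i) (suc j))
      nz = proj₁ (proj₂ ih)
      x : Fin (suc (suc n)) → Carrier
      x zero = 0#
      x (suc i) = proj₁ ih i
    pivot (yes (i , p≉0)) = x , (punchIn i (proj₁ nz) , λ z → proj₂ nz (trans (sym (reflexive (insertAt-punchIn y i _ _))) z)) , combination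
      where
      p = v i zero
      p⁻¹ = proj₁ (inverse p p≉0)
      pp⁻¹≈1 = proj₂ (inverse p p≉0)
      ratio : Fin (suc n) → Carrier
      ratio k = v (punchIn i k) zero * p⁻¹
      ih = kernel n (λ k j → v (punchIn i k) (suc j) + - (ratio k * v i (suc j)))
      y = proj₁ ih
      nz = proj₁ (proj₂ ih)
      pivotCoefficient : Carrier
      pivotCoefficient = - sum (λ k → y k * ratio k)
      x = insertAt y i pivotCoefficient
      split : ∀ j → sum (λ k → x k * v k j) ≈ - sum (λ k → y k * ratio k) * v i j + sum (λ k → y k * v (punchIn i k) j)
      split j = trans (sum-remove {i = i} (λ k → x k * v k j)) (+-cong
        (*-congʳ {v i j} (reflexive (insertAt-lookup y i pivotCoefficient)))
        (sum-cong-≋ λ k → *-congʳ {v (punchIn i k) j} (reflexive (insertAt-punchIn y i pivotCoefficient k))))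
      eliminated : ∀ j → sum (λ k → x k * v k j) ≈ sum (λ k → y k * (v (punchIn i k) j + - (ratio k * v i j)))
      eliminated j = begin
        sum (λ k → x k * v k j) ≈⟨ split j ⟩
        - sum (λ k → y k * ratio k) * v i j + sum (λ k → y k * v (punchIn i k) j)
          ≈⟨ +-congʳ (solve 2 (λ s v → ⊝ s ⊗ v ⊜ s ⊗ ⊝ v) refl _ (v i j)) ⟩
        sum (λ k → y k * ratio k) * - v i j + sum (λ k → y k * v (punchIn i k) j)
          ≈⟨ +-congʳ (*-distribʳ-sum (- v i j) (λ k → y k * ratio k)) ⟩
        sum (λ k → y k * ratio k * - v i j) + sum (λ k → y k * v (punchIn i k) j)
          ≈⟨ ∑-distrib-+ (λ k → y k * ratio k * - v i j) (λ k → y k * v (punchIn i k) j) ⟨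
        sum (λ k → y k * ratio k * - v i j + y k * v (punchIn i k) j)
          ≈⟨ sum-cong-≋ (λ k → solve 4 (λ y r v w → y ⊗ r ⊗ ⊝ v ⊕ y ⊗ w ⊜ y ⊗ (w ⊕ ⊝ (r ⊗ v))) refl (y k) (ratio k) (v i j) (v (punchIn i k) j)) ⟩
        sum (λ k → y k * (v (punchIn i k) j + - (ratio k * v i j))) ∎
      combination : ∀ j → sum (λ k → x k * v k j) ≈ 0#
      combination zero = trans (eliminated zero) (sum-zero {f = λ k → y k * (v (punchIn i k) zero + - (ratio k * v i zero))} λ k → begin
        y k * (v (punchIn i k) zero + - (v (punchIn i k) zero * p⁻¹ * p))
          ≈⟨ solve 4 (λ y v q p → y ⊗ (v ⊕ ⊝ (v ⊗ q ⊗ p)) ⊜ y ⊗ v ⊗ (κ 1 ⊕ ⊝ (p ⊗ q))) refl (y k) (v (punchIn i k) zero) p⁻¹ p ⟩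
        y k * v (punchIn i k) zero * (1# + - (p * p⁻¹)) ≈⟨ *-congˡ {y k * v (punchIn i k) zero} (x≈y⇒x-y≈0 (sym pp⁻¹≈1)) ⟩
        y k * v (punchIn i k) zero * 0# ≈⟨ zeroʳ _ ⟩
        0# ∎)
      combination (suc j) = trans (eliminated (suc j)) (proj₂ (proj₂ ih) j)

-- Linear independence of four distinct points of the set.

module Independence {ℓ₀ ℓ} (K : Field ℓ₀ ℓ) (q : ℕ) (card : HasCardinality K q) (89≤q : 89 ℕ.≤ q) (3-nonsquare : ¬ ThreeIsSquare K) where
  open Field K hiding (zero)
  open IntegerSolver commutativeRing using (solve)
  open FieldLemmas K
  open FiniteField K q card
  open Decic K q card 89≤q 3-nonsquare using (#_; 2≉0; 3≉0)
  open Projective K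
  open Coverage K q card 89≤q 3-nonsquare
  open import Algebra.Properties.CommutativeSemiring.Exp.TCOptimised commutativeSemiring
    using (_^_; ^-homo-*)
  open import Relation.Binary.Reasoning.Setoid setoid

  Weighted : ∀ {a} → Set a → Set (ℓ₀ ⊔ a)
  Weighted A = List (Carrier × A)

  Vanish : ∀ {a} {A : Set a} → Weighted A → Set (ℓ₀ ⊔ a ⊔ ℓ)
  Vanish = All (λ x → proj₁ x ≈ 0#)

  Distinct : Weighted Carrier → Set (ℓ₀ ⊔ ℓ)
  Distinct = AllPairs (λ x y → ¬ proj₂ x ≈ proj₂ y)

  moment : ℕ → Weighted Carrier → Carrier
  moment k [] = 0#
  moment k ((a , t) ∷ L) = a * t ^ k + moment k L

  moment-vanish : ∀ k {L} → Vanish L → moment k L ≈ 0#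
  moment-vanish k [] = refl
  moment-vanish k (e ∷ es) = trans (+-cong (trans (*-congʳ e) (zeroˡ _)) (moment-vanish k es)) (+-identityˡ 0#)

  -- Multiplying each weight by s - t deletes the point t, and the new moments m_(k+1) - t m_k still
  -- vanish. The length is a separate argument because the twisted list is not a sublist, so the
  -- recursion runs on n.
  vandermonde-length : ∀ n L → length L ≡ n → Distinct L → (∀ k → k ℕ.< length L → moment k L ≈ 0#) → Vanish L
  vandermonde-length _ [] _ _ _ = []
  vandermonde-length (suc n) ((a , t) ∷ L) length≡ (t≉ ∷ distinct) zero-moments = a≈0 ∷ L≈0
    where
    twist : Weighted Carrier → Weighted Carrier
    twist = map λ (b , s) → b * (s + - t) , s
    length-twist : ∀ L → length (twist L) ≡ length L
    length-twist [] = ≡.refl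
    length-twist (_ ∷ L) = ≡.cong suc (length-twist L)
    moment-twist : ∀ k L → moment k (twist L) ≈ moment (suc k) L + - (t * moment k L)
    moment-twist k [] = solve 1 (λ t → κ 0 ⊜ κ 0 ⊕ ⊝ (t ⊗ κ 0)) refl t
    moment-twist k ((b , s) ∷ L) = begin
      b * (s + - t) * s ^ k + moment k (twist L) ≈⟨ +-congˡ (moment-twist k L) ⟩
      b * (s + - t) * s ^ k + (moment (suc k) L + - (t * moment k L))
        ≈⟨ solve 6 (λ b s t p m n → b ⊗ (s ⊕ ⊝ t) ⊗ p ⊕ (m ⊕ ⊝ (t ⊗ n)) ⊜ (b ⊗ (s ⊗ p) ⊕ m) ⊕ ⊝ (t ⊗ (b ⊗ p ⊕ n))) refl b s t (s ^ k) _ _ ⟩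
      (b * (s * s ^ k) + moment (suc k) L) + - (t * (b * s ^ k + moment k L)) ≈⟨ +-congʳ (+-congʳ (*-congˡ (^-homo-* s 1 k))) ⟨
      (b * s ^ suc k + moment (suc k) L) + - (t * (b * s ^ k + moment k L)) ∎
    twist-distinct : ∀ {L} → Distinct L → Distinct (twist L)
    twist-distinct [] = []
    twist-distinct (d ∷ ds) = twist-all d ∷ twist-distinct ds
      where
      twist-all : ∀ {s L} → All (λ y → ¬ s ≈ proj₂ y) L → All (λ y → ¬ s ≈ proj₂ y) (twist L)
      twist-all [] = []
      twist-all (d ∷ ds) = d ∷ twist-all ds
    untwist : ∀ {L} → All (λ y → ¬ t ≈ proj₂ y) L → Vanish (twist L) → Vanish L
    untwist {[]} [] [] = []
    untwist {_ ∷ L} (t≉s ∷ ds) (e ∷ es) = *-cancelʳ-0 (λ z → t≉s (sym (x-y≈0⇒x≈y z))) e ∷ untwist ds es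
    twisted-moments : ∀ k → k ℕ.< length (twist L) → moment k (twist L) ≈ 0#
    twisted-moments k lt = begin
      moment k (twist L) ≈⟨ moment-twist k L ⟩
      moment (suc k) L + - (t * moment k L)
        ≈⟨ solve 5 (λ a t p m n → m ⊕ ⊝ (t ⊗ n) ⊜ (a ⊗ (t ⊗ p) ⊕ m) ⊕ ⊝ (t ⊗ (a ⊗ p ⊕ n))) refl a t (t ^ k) _ _ ⟩
      (a * (t * t ^ k) + moment (suc k) L) + - (t * (a * t ^ k + moment k L)) ≈⟨ +-congʳ (+-congʳ (*-congˡ (^-homo-* t 1 k))) ⟨
      moment (suc k) ((a , t) ∷ L) + - (t * moment k ((a , t) ∷ L))
        ≈⟨ +-cong (zero-moments (suc k) (ℕ.s≤s lt′)) (-‿cong (*-congˡ (zero-moments k (ℕ.m<n⇒m<1+n lt′)))) ⟩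
      0# + - (t * 0#) ≈⟨ solve 1 (λ t → κ 0 ⊕ ⊝ (t ⊗ κ 0) ⊜ κ 0) refl t ⟩
      0# ∎
      where lt′ = ≡.subst (k ℕ.<_) (length-twist L) lt
    L≈0 : Vanish L
    L≈0 = untwist t≉ (vandermonde-length n (twist L) (≡.trans (length-twist L) (ℕ.suc-injective length≡)) (twist-distinct distinct) twisted-moments)
    a≈0 : a ≈ 0#
    a≈0 = begin
      a ≈⟨ solve 1 (λ a → a ⊜ a ⊗ κ 1 ⊕ κ 0) refl a ⟩
      a * 1# + 0# ≈⟨ +-congˡ (moment-vanish 0 L≈0) ⟨
      a * 1# + moment 0 L ≈⟨ zero-moments 0 (ℕ.s≤s ℕ.z≤n) ⟩
      0# ∎

  vandermonde : ∀ L → Distinct L → (∀ k → k ℕ.< length L → moment k L ≈ 0#) → Vanish L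
  vandermonde L = vandermonde-length (length L) L ≡.refl

  vandermonde₄ : ∀ L → Distinct L → length L ℕ.≤ 4 → moment 0 L ≈ 0# → moment 1 L ≈ 0# → moment 2 L ≈ 0# → moment 3 L ≈ 0# → Vanish L
  vandermonde₄ L d le m₀ m₁ m₂ m₃ = vandermonde L d λ k lt → go k (ℕ.<-≤-trans lt le)
    where
    go : ∀ k → k ℕ.< 4 → moment k L ≈ 0#
    go 0 _ = m₀
    go 1 _ = m₁
    go 2 _ = m₂
    go 3 _ = m₃
    go (suc (suc (suc (suc k)))) (ℕ.s≤s (ℕ.s≤s (ℕ.s≤s (ℕ.s≤s ()))))

  vandermonde₃ : ∀ L → Distinct L → length L ℕ.≤ 3 → moment 0 L ≈ 0# → moment 1 L ≈ 0# → moment 2 L ≈ 0# → Vanish L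
  vandermonde₃ L d le m₀ m₁ m₂ = vandermonde L d λ k lt → go k (ℕ.<-≤-trans lt le)
    where
    go : ∀ k → k ℕ.< 3 → moment k L ≈ 0#
    go 0 _ = m₀
    go 1 _ = m₁
    go 2 _ = m₂
    go (suc (suc (suc k))) (ℕ.s≤s (ℕ.s≤s (ℕ.s≤s ())))

  sumW : Weighted (Lift ℓ₀ ⊤) → Carrier
  sumW [] = 0#
  sumW ((a , _) ∷ L) = a + sumW L

  module Core (Cs Ds : Weighted Carrier) (Is : Weighted (Lift ℓ₀ ⊤)) where
    -- The weighted functional applied to the monomial T^k: curve points evaluate, tangent points
    -- evaluate the derivative, and `infinity` reads off the coefficient of T⁴. All k ≥ 4 repeat the
    -- last coordinate, which permits hypotheses over every k.
    E : ℕ → Carrier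
    E 0 = moment 0 Cs
    E 1 = moment 1 Cs + moment 0 Ds
    E 2 = moment 2 Cs + # 2 * moment 1 Ds
    E 3 = moment 3 Cs + # 3 * moment 2 Ds
    E _ = moment 4 Cs + # 4 * moment 3 Ds + sumW Is
    AllVanish : Set (ℓ₀ ⊔ ℓ)
    AllVanish = Vanish Cs × Vanish Ds × Vanish Is
  open Core using (E; AllVanish)

  single-vanish : ∀ Is → length Is ℕ.≤ 1 → sumW Is ≈ 0# → Vanish Is
  single-vanish [] _ _ = []
  single-vanish (_ ∷ []) _ e = trans (sym (+-identityʳ _)) e ∷ []
  single-vanish (_ ∷ _ ∷ _) (ℕ.s≤s ())

  infinity-vanish : ∀ {Cs Ds} Is → length Is ℕ.≤ 1 → Vanish Cs → Vanish Ds → E Cs Ds Is 4 ≈ 0# → Vanish Is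
  infinity-vanish {Cs} {Ds} Is le vC vD e₄ = single-vanish Is le (begin
    sumW Is ≈⟨ solve 1 (λ s → s ⊜ κ 0 ⊕ κ 4 ⊗ κ 0 ⊕ s) refl _ ⟩
    0# + # 4 * 0# + sumW Is ≈⟨ +-congʳ (+-cong (moment-vanish 4 vC) (*-congˡ (moment-vanish 3 vD))) ⟨
    moment 4 Cs + # 4 * moment 3 Ds + sumW Is ≈⟨ e₄ ⟩
    0# ∎)

  drop-C : ∀ k {Cs x y} → Vanish Cs → moment k Cs + x * y ≈ 0# → x ≉0 → y ≈ 0#
  drop-C k {Cs} {x} {y} vC e x≉0 = *-cancelˡ-0 x≉0 (begin
    x * y ≈⟨ +-identityˡ _ ⟨
    0# + x * y ≈⟨ +-congʳ (moment-vanish k vC) ⟨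
    moment k Cs + x * y ≈⟨ e ⟩
    0# ∎)

  -- Without curve points the k-th equation is k times the moment k - 1 of the tangent points, and
  -- 2, 3, 4 are invertible. If `infinity` takes part the last equation is lost, but then at most
  -- three tangent points remain.
  tangents-vanish : ∀ {Cs} Ds Is → Vanish Cs → Distinct Ds → length Is ℕ.≤ 1 → length Ds ℕ.+ length Is ℕ.≤ 4 →
    (∀ k → E Cs Ds Is k ≈ 0#) → Vanish Ds
  tangents-vanish {Cs} Ds Is vC distinct le le₄ e = go Is le le₄ (e 4)
    where
    n₀ : moment 0 Ds ≈ 0#
    n₀ = drop-C 1 vC (trans (+-congˡ (*-identityˡ _)) (e 1)) 1≉0
    n₁ : moment 1 Ds ≈ 0#
    n₁ = drop-C 2 vC (e 2) 2≉0
    n₂ : moment 2 Ds ≈ 0#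
    n₂ = drop-C 3 vC (e 3) 3≉0
    go : ∀ Is → length Is ℕ.≤ 1 → length Ds ℕ.+ length Is ℕ.≤ 4 → moment 4 Cs + # 4 * moment 3 Ds + sumW Is ≈ 0# → Vanish Ds
    go [] _ le₄ e₄ = vandermonde₄ Ds distinct (≡.subst (ℕ._≤ 4) (ℕ.+-identityʳ _) le₄) n₀ n₁ n₂
      (drop-C 4 vC (trans (sym (+-identityʳ _)) e₄) (≉0-resp (solve 0 (κ 2 ⊗ κ 2 ⊜ κ 4) refl) (*-≉0 2≉0 2≉0)))
    go (_ ∷ []) _ le₄ _ = vandermonde₃ Ds distinct (ℕ.≤-pred (≡.subst (ℕ._≤ 4) (ℕ.+-comm _ 1) le₄)) n₀ n₁ n₂
    go (_ ∷ _ ∷ _) (ℕ.s≤s ())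

  tangents-independent : ∀ {Cs} Ds Is → Vanish Cs → Distinct Ds → length Is ℕ.≤ 1 → length Ds ℕ.+ length Is ℕ.≤ 4 →
    (∀ k → E Cs Ds Is k ≈ 0#) → AllVanish Cs Ds Is
  tangents-independent Ds Is vC distinct le le₄ e = vC , vD , infinity-vanish Is le vC vD (e 4)
    where vD = tangents-vanish Ds Is vC distinct le le₄ e

  -- An elimination certificate: the multipliers p, r, s, t are inferred from an identity checked by
  -- the solver.
  combine : ∀ {x a b c d p r s t} → x ≈ p * a + r * b + s * c + t * d → a ≈ 0# → b ≈ 0# → c ≈ 0# → d ≈ 0# → x ≈ 0#
  combine {p = p} {r} {s} {t} e a b c d = trans e (trans (+-cong (+-cong (+-cong (*-congˡ a) (*-congˡ b)) (*-congˡ c)) (*-congˡ d))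
    (solve 4 (λ p r s t → p ⊗ κ 0 ⊕ r ⊗ κ 0 ⊕ s ⊗ κ 0 ⊕ t ⊗ κ 0 ⊜ κ 0) refl p r s t))

  module TwoPoints (a r b s : Carrier) (r≉s : ¬ r ≈ s) where
    pair : Weighted Carrier
    pair = (a , r) ∷ (b , s) ∷ []

    s-r≉0 : (s + - r) ≉0
    s-r≉0 z = r≉s (sym (x-y≈0⇒x≈y z))

    pair-vanish : b ≈ 0# → moment 0 pair ≈ 0# → Vanish pair
    pair-vanish b≈0 e = (begin
      a ≈⟨ solve 1 (λ a → a ⊜ a ⊗ κ 1 ⊕ (κ 0 ⊗ κ 1 ⊕ κ 0)) refl a ⟩
      a * 1# + (0# * 1# + 0#) ≈⟨ +-congˡ (+-congʳ (*-congʳ b≈0)) ⟨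
      a * 1# + (b * 1# + 0#) ≈⟨ e ⟩
      0# ∎) ∷ b≈0 ∷ []

    -- Since a = -b, a polynomial P with P′(u) = 0 gives b (P(s) - P(r)) = 0. Testing (T - u)² and
    -- T³ - 3u²T leads to (s - r)² = 0. Their degree is at most 3, so `infinity` does not
    -- contribute.
    with-one-tangent : ∀ δ u Is → (∀ k → E pair ((δ , u) ∷ []) Is k ≈ 0#) → b ≈ 0#
    with-one-tangent δ u Is e with b ≟ 0#
    ... | yes z = z
    ... | no b≉0 = ⊥-elim (*-≉0 s-r≉0 s-r≉0 (combine
        (solve 3 (λ r s u → (s ⊕ ⊝ r) ⊗ (s ⊕ ⊝ r) ⊜ κ 4 ⊗ (s ⊗ s ⊕ s ⊗ r ⊕ r ⊗ r ⊕ ⊝ (κ 3 ⊗ (u ⊗ u)))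
          ⊕ ⊝ (κ 3 ⊗ (s ⊕ r ⊕ κ 2 ⊗ u)) ⊗ (s ⊕ r ⊕ ⊝ (κ 2 ⊗ u)) ⊕ κ 0 ⊗ κ 0 ⊕ κ 0 ⊗ κ 0) refl r s u)
        quadratic linear refl refl))
      where
      x≉0 : (b * (s + - r)) ≉0
      x≉0 = *-≉0 b≉0 s-r≉0
      linear : s + r + - (# 2 * u) ≈ 0#
      linear = *-cancelˡ-0 x≉0 (combine (solve 6 (λ a r b s δ u →
        b ⊗ (s ⊕ ⊝ r) ⊗ (s ⊕ r ⊕ ⊝ (κ 2 ⊗ u))
        ⊜ κ 1 ⊗ ((a ⊗ r ⊛ 2 ⊕ (b ⊗ s ⊛ 2 ⊕ κ 0)) ⊕ κ 2 ⊗ (δ ⊗ u ⊕ κ 0)) ⊕ ⊝ (κ 2 ⊗ u) ⊗ ((a ⊗ r ⊕ (b ⊗ s ⊕ κ 0)) ⊕ (δ ⊗ κ 1 ⊕ κ 0))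
          ⊕ ⊝ (r ⊗ r ⊕ ⊝ (κ 2 ⊗ u ⊗ r)) ⊗ (a ⊗ κ 1 ⊕ (b ⊗ κ 1 ⊕ κ 0)) ⊕ κ 0 ⊗ κ 0) refl a r b s δ u) (e 2) (e 1) (e 0) refl)
      quadratic : s * s + s * r + r * r + - (# 3 * (u * u)) ≈ 0#
      quadratic = *-cancelˡ-0 x≉0 (combine (solve 6 (λ a r b s δ u →
        b ⊗ (s ⊕ ⊝ r) ⊗ (s ⊗ s ⊕ s ⊗ r ⊕ r ⊗ r ⊕ ⊝ (κ 3 ⊗ (u ⊗ u)))
        ⊜ κ 1 ⊗ ((a ⊗ r ⊛ 3 ⊕ (b ⊗ s ⊛ 3 ⊕ κ 0)) ⊕ κ 3 ⊗ (δ ⊗ u ⊛ 2 ⊕ κ 0)) ⊕ ⊝ (κ 3 ⊗ (u ⊗ u)) ⊗ ((a ⊗ r ⊕ (b ⊗ s ⊕ κ 0)) ⊕ (δ ⊗ κ 1 ⊕ κ 0))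
          ⊕ ⊝ (r ⊗ r ⊗ r ⊕ ⊝ (κ 3 ⊗ (u ⊗ u) ⊗ r)) ⊗ (a ⊗ κ 1 ⊕ (b ⊗ κ 1 ⊕ κ 0)) ⊕ κ 0 ⊗ κ 0) refl a r b s δ u) (e 3) (e 1) (e 0) refl)

    -- A nontrivial relation forces 3 (t − u)² = (s − r)².
    with-two-tangents : ∀ δ t ε u → ¬ t ≈ u → (∀ k → E pair ((δ , t) ∷ (ε , u) ∷ []) [] k ≈ 0#) → b ≈ 0#
    with-two-tangents δ t ε u t≉u e with b ≟ 0#
    ... | yes z = z
    ... | no b≉0 = ⊥-elim (3-nonsquare ((s + - r) * i , (begin
        (s + - r) * i * ((s + - r) * i) ≈⟨ solve 2 (λ x i → x ⊗ i ⊗ (x ⊗ i) ⊜ (x ⊗ x) ⊗ (i ⊗ i)) refl (s + - r) i ⟩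
        (s + - r) * (s + - r) * (i * i) ≈⟨ *-congʳ (sym (x-y≈0⇒x≈y ratio)) ⟩
        # 3 * ((t + - u) * (t + - u)) * (i * i) ≈⟨ solve 2 (λ x i → κ 3 ⊗ (x ⊗ x) ⊗ (i ⊗ i) ⊜ κ 3 ⊗ ((x ⊗ i) ⊗ (x ⊗ i))) refl (t + - u) i ⟩
        # 3 * ((t + - u) * i * ((t + - u) * i)) ≈⟨ *-congˡ (*-cong ti≈1 ti≈1) ⟩
        # 3 * (1# * 1#) ≈⟨ solve 0 (κ 3 ⊗ (κ 1 ⊗ κ 1) ⊜ κ 3) refl ⟩
        # 3 ∎)))
      where
      t-u≉0 : (t + - u) ≉0
      t-u≉0 z = t≉u (x-y≈0⇒x≈y z)
      i = proj₁ (inverse (t + - u) t-u≉0)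
      ti≈1 : (t + - u) * i ≈ 1#
      ti≈1 = proj₂ (inverse (t + - u) t-u≉0)
      x≉0 : (b * (s + - r)) ≉0
      x≉0 = *-≉0 b≉0 s-r≉0
      -- From the test polynomials with derivatives 12(T - t)(T - u) and 12 T(T - t)(T - u): their
      -- differences between s and r are (s - r) · 2R₁ and (s - r) · R₂.
      R₁ R₂ : Carrier
      R₁ = # 2 * (s * s + s * r + r * r) + - (# 3 * ((t + u) * (s + r))) + # 6 * (t * u)
      R₂ = # 3 * ((s + r) * (s * s + r * r)) + - (# 4 * ((t + u) * (s * s + s * r + r * r))) + # 6 * (t * u * (s + r))
      R₁≈0 : R₁ ≈ 0#
      R₁≈0 = *-cancelˡ-0 (*-≉0 2≉0 x≉0) (combine (solve 8 (λ a r b s δ t ε u →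
        κ 2 ⊗ (b ⊗ (s ⊕ ⊝ r)) ⊗ (κ 2 ⊗ (s ⊗ s ⊕ s ⊗ r ⊕ r ⊗ r) ⊕ ⊝ (κ 3 ⊗ ((t ⊕ u) ⊗ (s ⊕ r))) ⊕ κ 6 ⊗ (t ⊗ u))
        ⊜ κ 4 ⊗ ((a ⊗ r ⊛ 3 ⊕ (b ⊗ s ⊛ 3 ⊕ κ 0)) ⊕ κ 3 ⊗ (δ ⊗ t ⊛ 2 ⊕ (ε ⊗ u ⊛ 2 ⊕ κ 0)))
          ⊕ ⊝ (κ 6 ⊗ (t ⊕ u)) ⊗ ((a ⊗ r ⊛ 2 ⊕ (b ⊗ s ⊛ 2 ⊕ κ 0)) ⊕ κ 2 ⊗ (δ ⊗ t ⊕ (ε ⊗ u ⊕ κ 0)))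
          ⊕ κ 12 ⊗ (t ⊗ u) ⊗ ((a ⊗ r ⊕ (b ⊗ s ⊕ κ 0)) ⊕ (δ ⊗ κ 1 ⊕ (ε ⊗ κ 1 ⊕ κ 0)))
          ⊕ ⊝ (κ 4 ⊗ r ⊛ 3 ⊕ ⊝ (κ 6 ⊗ (t ⊕ u) ⊗ r ⊛ 2) ⊕ κ 12 ⊗ (t ⊗ u) ⊗ r) ⊗ (a ⊗ κ 1 ⊕ (b ⊗ κ 1 ⊕ κ 0)))
        refl a r b s δ t ε u) (e 3) (e 2) (e 1) (e 0))
      R₂≈0 : R₂ ≈ 0#
      R₂≈0 = *-cancelˡ-0 x≉0 (combine (solve 8 (λ a r b s δ t ε u →
        b ⊗ (s ⊕ ⊝ r) ⊗ (κ 3 ⊗ ((s ⊕ r) ⊗ (s ⊗ s ⊕ r ⊗ r)) ⊕ ⊝ (κ 4 ⊗ ((t ⊕ u) ⊗ (s ⊗ s ⊕ s ⊗ r ⊕ r ⊗ r))) ⊕ κ 6 ⊗ (t ⊗ u ⊗ (s ⊕ r)))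
        ⊜ κ 3 ⊗ ((a ⊗ r ⊛ 4 ⊕ (b ⊗ s ⊛ 4 ⊕ κ 0)) ⊕ κ 4 ⊗ (δ ⊗ t ⊛ 3 ⊕ (ε ⊗ u ⊛ 3 ⊕ κ 0)) ⊕ κ 0)
          ⊕ ⊝ (κ 4 ⊗ (t ⊕ u)) ⊗ ((a ⊗ r ⊛ 3 ⊕ (b ⊗ s ⊛ 3 ⊕ κ 0)) ⊕ κ 3 ⊗ (δ ⊗ t ⊛ 2 ⊕ (ε ⊗ u ⊛ 2 ⊕ κ 0)))
          ⊕ κ 6 ⊗ (t ⊗ u) ⊗ ((a ⊗ r ⊛ 2 ⊕ (b ⊗ s ⊛ 2 ⊕ κ 0)) ⊕ κ 2 ⊗ (δ ⊗ t ⊕ (ε ⊗ u ⊕ κ 0)))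
          ⊕ ⊝ (κ 3 ⊗ r ⊛ 4 ⊕ ⊝ (κ 4 ⊗ (t ⊕ u) ⊗ r ⊛ 3) ⊕ κ 6 ⊗ (t ⊗ u) ⊗ r ⊛ 2) ⊗ (a ⊗ κ 1 ⊕ (b ⊗ κ 1 ⊕ κ 0)))
        refl a r b s δ t ε u) (e 4) (e 3) (e 2) (e 0))
      -- R₂ - (s + r) R₁ factors as (s - r)² (s + r - t - u), so both pairs have the same midpoint.
      sums : s + r + - (t + u) ≈ 0#
      sums = *-cancelˡ-0 (*-≉0 s-r≉0 s-r≉0) (combine (solve 4 (λ r s t u →
        (s ⊕ ⊝ r) ⊗ (s ⊕ ⊝ r) ⊗ (s ⊕ r ⊕ ⊝ (t ⊕ u))
        ⊜ κ 1 ⊗ (κ 3 ⊗ ((s ⊕ r) ⊗ (s ⊗ s ⊕ r ⊗ r)) ⊕ ⊝ (κ 4 ⊗ ((t ⊕ u) ⊗ (s ⊗ s ⊕ s ⊗ r ⊕ r ⊗ r))) ⊕ κ 6 ⊗ (t ⊗ u ⊗ (s ⊕ r)))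
          ⊕ ⊝ (s ⊕ r) ⊗ (κ 2 ⊗ (s ⊗ s ⊕ s ⊗ r ⊕ r ⊗ r) ⊕ ⊝ (κ 3 ⊗ ((t ⊕ u) ⊗ (s ⊕ r))) ⊕ κ 6 ⊗ (t ⊗ u)) ⊕ κ 0 ⊗ κ 0 ⊕ κ 0 ⊗ κ 0)
        refl r s t u) R₂≈0 R₁≈0 refl refl)
      ratio : # 3 * ((t + - u) * (t + - u)) + - ((s + - r) * (s + - r)) ≈ 0#
      ratio = combine (solve 4 (λ r s t u →
        κ 3 ⊗ ((t ⊕ ⊝ u) ⊗ (t ⊕ ⊝ u)) ⊕ ⊝ ((s ⊕ ⊝ r) ⊗ (s ⊕ ⊝ r))
        ⊜ ⊝ κ 2 ⊗ (κ 2 ⊗ (s ⊗ s ⊕ s ⊗ r ⊕ r ⊗ r) ⊕ ⊝ (κ 3 ⊗ ((t ⊕ u) ⊗ (s ⊕ r))) ⊕ κ 6 ⊗ (t ⊗ u))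
          ⊕ (κ 3 ⊗ (s ⊕ r ⊕ ⊝ (t ⊕ u)) ⊕ ⊝ κ 0) ⊗ (s ⊕ r ⊕ ⊝ (t ⊕ u)) ⊕ κ 0 ⊗ κ 0 ⊕ κ 0 ⊗ κ 0)
        refl r s t u) R₁≈0 sums refl refl

  -- The test polynomials M = (T - r)(T - s)(T - t) and T M kill the curve points. If δ ≠ 0 they
  -- give M′(u) = 0 and M(u) = 0, a double root of a polynomial with three distinct roots.
  three-points-one-tangent : ∀ α r β s γ t δ u → ¬ r ≈ s → ¬ r ≈ t → ¬ s ≈ t →
    (∀ k → E ((α , r) ∷ (β , s) ∷ (γ , t) ∷ []) ((δ , u) ∷ []) [] k ≈ 0#) → δ ≈ 0#
  three-points-one-tangent α r β s γ t δ u r≉s r≉t s≉t e with δ ≟ 0#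
  ... | yes z = z
  ... | no δ≉0 = ⊥-elim contradiction
    where
    m′ m : Carrier
    m′ = (u + - s) * (u + - t) + (u + - r) * (u + - t) + (u + - r) * (u + - s)
    m = (u + - r) * (u + - s) * (u + - t)
    m′≈0 : m′ ≈ 0#
    m′≈0 = *-cancelˡ-0 δ≉0 (combine (solve 8 (λ α r β s γ t δ u →
      δ ⊗ ((u ⊕ ⊝ s) ⊗ (u ⊕ ⊝ t) ⊕ (u ⊕ ⊝ r) ⊗ (u ⊕ ⊝ t) ⊕ (u ⊕ ⊝ r) ⊗ (u ⊕ ⊝ s))
      ⊜ κ 1 ⊗ ((α ⊗ r ⊛ 3 ⊕ (β ⊗ s ⊛ 3 ⊕ (γ ⊗ t ⊛ 3 ⊕ κ 0))) ⊕ κ 3 ⊗ (δ ⊗ u ⊛ 2 ⊕ κ 0))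
        ⊕ ⊝ (r ⊕ s ⊕ t) ⊗ ((α ⊗ r ⊛ 2 ⊕ (β ⊗ s ⊛ 2 ⊕ (γ ⊗ t ⊛ 2 ⊕ κ 0))) ⊕ κ 2 ⊗ (δ ⊗ u ⊕ κ 0))
        ⊕ (r ⊗ s ⊕ r ⊗ t ⊕ s ⊗ t) ⊗ ((α ⊗ r ⊕ (β ⊗ s ⊕ (γ ⊗ t ⊕ κ 0))) ⊕ (δ ⊗ κ 1 ⊕ κ 0))
        ⊕ ⊝ (r ⊗ s ⊗ t) ⊗ (α ⊗ κ 1 ⊕ (β ⊗ κ 1 ⊕ (γ ⊗ κ 1 ⊕ κ 0))))
      refl α r β s γ t δ u) (e 3) (e 2) (e 1) (e 0))
    [um]′≈0 : u * m′ + m ≈ 0#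
    [um]′≈0 = *-cancelˡ-0 δ≉0 (combine (solve 8 (λ α r β s γ t δ u →
      δ ⊗ (u ⊗ ((u ⊕ ⊝ s) ⊗ (u ⊕ ⊝ t) ⊕ (u ⊕ ⊝ r) ⊗ (u ⊕ ⊝ t) ⊕ (u ⊕ ⊝ r) ⊗ (u ⊕ ⊝ s)) ⊕ (u ⊕ ⊝ r) ⊗ (u ⊕ ⊝ s) ⊗ (u ⊕ ⊝ t))
      ⊜ κ 1 ⊗ ((α ⊗ r ⊛ 4 ⊕ (β ⊗ s ⊛ 4 ⊕ (γ ⊗ t ⊛ 4 ⊕ κ 0))) ⊕ κ 4 ⊗ (δ ⊗ u ⊛ 3 ⊕ κ 0) ⊕ κ 0)
        ⊕ ⊝ (r ⊕ s ⊕ t) ⊗ ((α ⊗ r ⊛ 3 ⊕ (β ⊗ s ⊛ 3 ⊕ (γ ⊗ t ⊛ 3 ⊕ κ 0))) ⊕ κ 3 ⊗ (δ ⊗ u ⊛ 2 ⊕ κ 0))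
        ⊕ (r ⊗ s ⊕ r ⊗ t ⊕ s ⊗ t) ⊗ ((α ⊗ r ⊛ 2 ⊕ (β ⊗ s ⊛ 2 ⊕ (γ ⊗ t ⊛ 2 ⊕ κ 0))) ⊕ κ 2 ⊗ (δ ⊗ u ⊕ κ 0))
        ⊕ ⊝ (r ⊗ s ⊗ t) ⊗ ((α ⊗ r ⊕ (β ⊗ s ⊕ (γ ⊗ t ⊕ κ 0))) ⊕ (δ ⊗ κ 1 ⊕ κ 0)))
      refl α r β s γ t δ u) (e 4) (e 3) (e 2) (e 1))
    m≈0 : m ≈ 0#
    m≈0 = begin
      m ≈⟨ solve 2 (λ x m → m ⊜ (x ⊕ m) ⊕ ⊝ x) refl (u * m′) m ⟩
      (u * m′ + m) + - (u * m′) ≈⟨ +-cong [um]′≈0 (-‿cong (*-congˡ m′≈0)) ⟩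
      0# + - (u * 0#) ≈⟨ solve 1 (λ u → κ 0 ⊕ ⊝ (u ⊗ κ 0) ⊜ κ 0) refl u ⟩
      0# ∎
    -- At u = x the derivative reduces to (x - y)(x - z), which is nonzero.
    not-equal : ∀ {x y z} → ¬ x ≈ y → ¬ x ≈ z → (u + - y) * (u + - z) + (u + - x) * (u + - z) + (u + - x) * (u + - y) ≈ 0# → (u + - x) ≉0
    not-equal {x} {y} {z} x≉y x≉z e′ u-x≈0 = *-≉0 (λ p → x≉y (trans (sym u≈x) (x-y≈0⇒x≈y p))) (λ p → x≉z (trans (sym u≈x) (x-y≈0⇒x≈y p))) (begin
        (u + - y) * (u + - z) ≈⟨ solve 3 (λ a b c → b ⊗ c ⊜ (b ⊗ c ⊕ a ⊗ c ⊕ a ⊗ b) ⊕ ⊝ (a ⊗ (c ⊕ b))) refl (u + - x) (u + - y) (u + - z) ⟩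
        _ ≈⟨ +-cong e′ (-‿cong (*-congʳ u-x≈0)) ⟩
        0# + - (0# * ((u + - z) + (u + - y))) ≈⟨ solve 1 (λ w → κ 0 ⊕ ⊝ (κ 0 ⊗ w) ⊜ κ 0) refl _ ⟩
        0# ∎)
      where
      u≈x = x-y≈0⇒x≈y u-x≈0
    contradiction : ⊥
    contradiction = *-≉0 (*-≉0 (not-equal r≉s r≉t m′≈0)
        (not-equal (λ z → r≉s (sym z)) s≉t (trans (solve 3 (λ a b c → a ⊗ c ⊕ b ⊗ c ⊕ b ⊗ a ⊜ b ⊗ c ⊕ a ⊗ c ⊕ a ⊗ b) refl (u + - r) (u + - s) (u + - t)) m′≈0)))
      (not-equal (λ z → r≉t (sym z)) (λ z → s≉t (sym z)) (trans (solve 3 (λ a b c → a ⊗ b ⊕ c ⊗ b ⊕ c ⊗ a ⊜ b ⊗ c ⊕ a ⊗ c ⊕ a ⊗ b) refl (u + - r) (u + - s) (u + - t)) m′≈0)) m≈0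

  core : ∀ Cs Ds Is → Distinct Cs → Distinct Ds → length Is ℕ.≤ 1 → length Cs ℕ.+ length Ds ℕ.+ length Is ℕ.≤ 4 →
    (∀ k → E Cs Ds Is k ≈ 0#) → AllVanish Cs Ds Is
  core Cs [] Is dC _ le le₄ e = vC , [] , infinity-vanish Is le vC [] (e 4)
    where
    vC : Vanish Cs
    vC = vandermonde₄ Cs dC (ℕ.≤-trans (ℕ.m≤m+n _ 0) (ℕ.≤-trans (ℕ.m≤m+n _ _) le₄)) (e 0)
      (trans (sym (+-identityʳ _)) (e 1)) (trans (solve 1 (λ x → x ⊜ x ⊕ κ 2 ⊗ κ 0) refl _) (e 2)) (trans (solve 1 (λ x → x ⊜ x ⊕ κ 3 ⊗ κ 0) refl _) (e 3))
  core [] Ds@(_ ∷ _) Is _ dD le le₄ e = tangents-independent Ds Is [] dD le le₄ e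
  core ((a , r) ∷ []) Ds@(_ ∷ _) Is _ dD le le₄ e =
    tangents-independent Ds Is (trans (solve 1 (λ a → a ⊜ a ⊗ κ 1 ⊕ κ 0) refl a) (e 0) ∷ []) dD le (ℕ.≤-trans (ℕ.n≤1+n _) le₄) e
  core ((a , r) ∷ (b , s) ∷ []) Ds@((δ , u) ∷ []) Is ((r≉s ∷ []) ∷ _) dD le le₄ e =
    tangents-independent Ds Is (TwoPoints.pair-vanish a r b s r≉s (TwoPoints.with-one-tangent a r b s r≉s δ u Is e) (e 0)) dD le
      (ℕ.≤-trans (ℕ.m≤n+m _ 2) le₄) e
  core ((a , r) ∷ (b , s) ∷ []) Ds@((δ , t) ∷ (ε , u) ∷ []) [] ((r≉s ∷ []) ∷ _) dD@((t≉u ∷ []) ∷ _) le le₄ e =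
    tangents-independent Ds [] (TwoPoints.pair-vanish a r b s r≉s (TwoPoints.with-two-tangents a r b s r≉s δ t ε u t≉u e) (e 0)) dD le
      (ℕ.≤-trans (ℕ.m≤n+m _ 2) le₄) e
  core (_ ∷ _ ∷ []) (_ ∷ _ ∷ []) (_ ∷ _) _ _ _ (ℕ.s≤s (ℕ.s≤s (ℕ.s≤s (ℕ.s≤s ()))))
  core (_ ∷ _ ∷ []) (_ ∷ _ ∷ _ ∷ _) _ _ _ _ (ℕ.s≤s (ℕ.s≤s (ℕ.s≤s (ℕ.s≤s ()))))
  core Cs@((α , r) ∷ (β , s) ∷ (γ , t) ∷ []) ((δ , u) ∷ []) [] dC@((r≉s ∷ r≉t ∷ []) ∷ (s≉t ∷ []) ∷ _) _ _ _ e =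
    vandermonde₄ Cs dC (ℕ.n≤1+n 3) (e 0) (drop-D 1 0 1# (trans (+-congˡ (*-identityˡ _)) (e 1))) (drop-D 2 1 (# 2) (e 2)) (drop-D 3 2 (# 3) (e 3))
      , vD , []
    where
    vD : Vanish ((δ , u) ∷ [])
    vD = three-points-one-tangent α r β s γ t δ u r≉s r≉t s≉t e ∷ []
    drop-D : ∀ k l x → moment k Cs + x * moment l ((δ , u) ∷ []) ≈ 0# → moment k Cs ≈ 0#
    drop-D k l x e′ = begin
      moment k Cs ≈⟨ solve 2 (λ m x → m ⊜ m ⊕ x ⊗ κ 0) refl (moment k Cs) x ⟩
      moment k Cs + x * 0# ≈⟨ +-congˡ (*-congˡ (moment-vanish l vD)) ⟨
      moment k Cs + x * moment l ((δ , u) ∷ []) ≈⟨ e′ ⟩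
      0# ∎
  core (_ ∷ _ ∷ _ ∷ []) (_ ∷ []) (_ ∷ _) _ _ _ (ℕ.s≤s (ℕ.s≤s (ℕ.s≤s (ℕ.s≤s ()))))
  core (_ ∷ _ ∷ _ ∷ []) (_ ∷ _ ∷ _) _ _ _ _ (ℕ.s≤s (ℕ.s≤s (ℕ.s≤s (ℕ.s≤s ()))))
  core (_ ∷ _ ∷ _ ∷ _ ∷ Cs) (_ ∷ Ds) Is _ _ _ (ℕ.s≤s (ℕ.s≤s (ℕ.s≤s (ℕ.s≤s le)))) _ =
    ⊥-elim (ℕ.n≮0 (≡.subst (λ k → k ℕ.+ length Is ℕ.≤ 0) (ℕ.+-suc (length Cs) (length Ds)) le))

-- The track property and completeness.

module CompleteTrack {ℓ₀ ℓ} (K : Field ℓ₀ ℓ) (q : ℕ) (card : HasCardinality K q) (89≤q : 89 ℕ.≤ q) (3-nonsquare : ¬ ThreeIsSquare K) where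
  open Field K hiding (zero)
  open IntegerSolver commutativeRing using (solve)
  open FieldLemmas K
  open FiniteField K q card
  open Projective K
  open Coverage K q card 89≤q 3-nonsquare
  open Independence K q card 89≤q 3-nonsquare
  open LinearAlgebra K _≟_ using (kernel; Dependent)
  open import Relation.Binary.Reasoning.Setoid setoid

  combine-all : Weighted Pt → V5
  combine-all [] i = 0#
  combine-all ((a , w) ∷ L) i = a * ⟪ w ⟫ i + combine-all L i

  curves tangents : Weighted Pt → Weighted Carrier
  curves [] = []
  curves ((a , curve t) ∷ L) = (a , t) ∷ curves L
  curves (_ ∷ L) = curves L
  tangents [] = []
  tangents ((a , tangent t) ∷ L) = (a , t) ∷ tangents L
  tangents (_ ∷ L) = tangents L

  infinities : Weighted Pt → Weighted (Lift ℓ₀ ⊤)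
  infinities [] = []
  infinities ((a , infinity) ∷ L) = (a , lift tt) ∷ infinities L
  infinities (_ ∷ L) = infinities L

  length-split : ∀ L → length (curves L) ℕ.+ length (tangents L) ℕ.+ length (infinities L) ≡ length L
  length-split [] = ≡.refl
  length-split ((_ , curve _) ∷ L) = ≡.cong suc (length-split L)
  length-split ((_ , tangent _) ∷ L) = ≡.trans (≡.cong (ℕ._+ length (infinities L)) (ℕ.+-suc (length (curves L)) (length (tangents L))))
    (≡.cong suc (length-split L))
  length-split ((_ , infinity) ∷ L) = ≡.trans (ℕ.+-suc _ (length (infinities L))) (≡.cong suc (length-split L))

  DistinctPts : Weighted Pt → Set (ℓ₀ ⊔ ℓ)
  DistinctPts = AllPairs (λ x y → ¬ proj₂ x ≐ proj₂ y)

  curves-distinct : ∀ {L} → DistinctPts L → Distinct (curves L)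
  curves-distinct [] = []
  curves-distinct {(a , curve t) ∷ L} (d ∷ ds) = apart L d ∷ curves-distinct ds
    where
    apart : ∀ L → All (λ y → ¬ curve t ≐ proj₂ y) L → All (λ y → ¬ t ≈ proj₂ y) (curves L)
    apart [] [] = []
    apart ((_ , curve _) ∷ L) (d ∷ ds) = d ∷ apart L ds
    apart ((_ , tangent _) ∷ L) (_ ∷ ds) = apart L ds
    apart ((_ , infinity) ∷ L) (_ ∷ ds) = apart L ds
  curves-distinct {(a , tangent t) ∷ L} (d ∷ ds) = curves-distinct ds
  curves-distinct {(a , infinity) ∷ L} (d ∷ ds) = curves-distinct ds

  tangents-distinct : ∀ {L} → DistinctPts L → Distinct (tangents L)
  tangents-distinct [] = []
  tangents-distinct {(a , tangent t) ∷ L} (d ∷ ds) = apart L d ∷ tangents-distinct ds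
    where
    apart : ∀ L → All (λ y → ¬ tangent t ≐ proj₂ y) L → All (λ y → ¬ t ≈ proj₂ y) (tangents L)
    apart [] [] = []
    apart ((_ , tangent _) ∷ L) (d ∷ ds) = d ∷ apart L ds
    apart ((_ , curve _) ∷ L) (_ ∷ ds) = apart L ds
    apart ((_ , infinity) ∷ L) (_ ∷ ds) = apart L ds
  tangents-distinct {(a , curve t) ∷ L} (d ∷ ds) = tangents-distinct ds
  tangents-distinct {(a , infinity) ∷ L} (d ∷ ds) = tangents-distinct ds

  infinities-single : ∀ {L} → DistinctPts L → length (infinities L) ℕ.≤ 1
  infinities-single [] = ℕ.z≤n
  infinities-single {(a , curve t) ∷ L} (d ∷ ds) = infinities-single ds
  infinities-single {(a , tangent t) ∷ L} (d ∷ ds) = infinities-single ds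
  infinities-single {(a , infinity) ∷ L} (d ∷ ds) = ℕ.s≤s (ℕ.≤-reflexive (none L d))
    where
    none : ∀ L → All (λ y → ¬ infinity ≐ proj₂ y) L → length (infinities L) ≡ 0
    none [] [] = ≡.refl
    none ((_ , curve _) ∷ L) (_ ∷ ds) = none L ds
    none ((_ , tangent _) ∷ L) (_ ∷ ds) = none L ds
    none ((_ , infinity) ∷ L) (d ∷ ds) = ⊥-elim (d (lift tt))

  vanish-merge : ∀ L → Vanish (curves L) → Vanish (tangents L) → Vanish (infinities L) → Vanish L
  vanish-merge [] _ _ _ = []
  vanish-merge ((_ , curve _) ∷ L) (e ∷ c) d i = e ∷ vanish-merge L c d i
  vanish-merge ((_ , tangent _) ∷ L) c (e ∷ d) i = e ∷ vanish-merge L c d i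
  vanish-merge ((_ , infinity) ∷ L) c d (e ∷ i) = e ∷ vanish-merge L c d i

  coordinate : ℕ → Fin 5
  coordinate 0 = zero
  coordinate 1 = suc zero
  coordinate 2 = suc (suc zero)
  coordinate 3 = suc (suc (suc zero))
  coordinate _ = suc (suc (suc (suc zero)))

  E-split : ∀ L k → Core.E (curves L) (tangents L) (infinities L) k ≈ combine-all L (coordinate k)
  E-split [] 0 = refl
  E-split [] 1 = +-identityˡ 0#
  E-split [] 2 = solve 0 (κ 0 ⊕ κ 2 ⊗ κ 0 ⊜ κ 0) refl
  E-split [] 3 = solve 0 (κ 0 ⊕ κ 3 ⊗ κ 0 ⊜ κ 0) refl
  E-split [] (suc (suc (suc (suc _)))) = solve 0 (κ 0 ⊕ κ 4 ⊗ κ 0 ⊕ κ 0 ⊜ κ 0) refl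
  E-split ((a , curve t) ∷ L) 0 = +-congˡ (E-split L 0)
  E-split ((a , curve t) ∷ L) 1 = trans (+-assoc _ _ _) (+-congˡ (E-split L 1))
  E-split ((a , curve t) ∷ L) 2 = trans (+-assoc _ _ _) (+-congˡ (E-split L 2))
  E-split ((a , curve t) ∷ L) 3 = trans (+-assoc _ _ _)
    (+-cong (solve 2 (λ a t → a ⊗ t ⊛ 3 ⊜ a ⊗ (t ⊗ (t ⊗ t))) refl a t) (E-split L 3))
  E-split ((a , curve t) ∷ L) k@(suc (suc (suc (suc _)))) = trans (trans (+-congʳ (+-assoc _ _ _)) (+-assoc _ _ _))
    (+-cong (solve 2 (λ a t → a ⊗ t ⊛ 4 ⊜ a ⊗ (t ⊗ (t ⊗ (t ⊗ t)))) refl a t) (E-split L k))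
  E-split ((a , tangent t) ∷ L) 0 = trans (E-split L 0) (solve 2 (λ a x → x ⊜ a ⊗ κ 0 ⊕ x) refl a _)
  E-split ((a , tangent t) ∷ L) 1 = trans (solve 3 (λ a x y → x ⊕ (a ⊗ κ 1 ⊕ y) ⊜ a ⊗ κ 1 ⊕ (x ⊕ y)) refl a _ _) (+-congˡ (E-split L 1))
  E-split ((a , tangent t) ∷ L) 2 = trans (solve 4 (λ a t x y → x ⊕ κ 2 ⊗ (a ⊗ t ⊕ y) ⊜ a ⊗ (κ 2 ⊗ t) ⊕ (x ⊕ κ 2 ⊗ y)) refl a t _ _) (+-congˡ (E-split L 2))
  E-split ((a , tangent t) ∷ L) 3 = trans (solve 4 (λ a t x y → x ⊕ κ 3 ⊗ (a ⊗ t ⊛ 2 ⊕ y) ⊜ a ⊗ (κ 3 ⊗ (t ⊗ t)) ⊕ (x ⊕ κ 3 ⊗ y)) refl a t _ _) (+-congˡ (E-split L 3))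
  E-split ((a , tangent t) ∷ L) k@(suc (suc (suc (suc _)))) =
    trans (solve 5 (λ a t x y z → x ⊕ κ 4 ⊗ (a ⊗ t ⊛ 3 ⊕ y) ⊕ z ⊜ a ⊗ (κ 4 ⊗ (t ⊗ (t ⊗ t))) ⊕ (x ⊕ κ 4 ⊗ y ⊕ z)) refl a t _ _ _) (+-congˡ (E-split L k))
  E-split ((a , infinity) ∷ L) 0 = trans (E-split L 0) (solve 2 (λ a x → x ⊜ a ⊗ κ 0 ⊕ x) refl a _)
  E-split ((a , infinity) ∷ L) 1 = trans (E-split L 1) (solve 2 (λ a x → x ⊜ a ⊗ κ 0 ⊕ x) refl a _)
  E-split ((a , infinity) ∷ L) 2 = trans (E-split L 2) (solve 2 (λ a x → x ⊜ a ⊗ κ 0 ⊕ x) refl a _)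
  E-split ((a , infinity) ∷ L) 3 = trans (E-split L 3) (solve 2 (λ a x → x ⊜ a ⊗ κ 0 ⊕ x) refl a _)
  E-split ((a , infinity) ∷ L) k@(suc (suc (suc (suc _)))) =
    trans (solve 4 (λ a x y z → x ⊕ y ⊕ (a ⊕ z) ⊜ a ⊗ κ 1 ⊕ (x ⊕ y ⊕ z)) refl a _ _ _) (+-congˡ (E-split L k))

  independent : ∀ L → DistinctPts L → length L ℕ.≤ 4 → IsZeroVec (combine-all L) → Vanish L
  independent L d le e = vanish-merge L (proj₁ all) (proj₁ (proj₂ all)) (proj₂ (proj₂ all))
    where
    all = core (curves L) (tangents L) (infinities L) (curves-distinct d) (tangents-distinct d) (infinities-single d)
      (≡.subst (ℕ._≤ 4) (≡.sym (length-split L)) le) (λ k → trans (E-split L k) (e (coordinate k)))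

  ⟪⟫-nonzero : ∀ w → ¬ IsZeroVec ⟪ w ⟫
  ⟪⟫-nonzero (curve t) e = 1≉0 (e zero)
  ⟪⟫-nonzero (tangent t) e = 1≉0 (e (suc zero))
  ⟪⟫-nonzero infinity e = 1≉0 (e (suc (suc (suc (suc zero)))))

  ⟪⟫∈theSet : ∀ w → theSet ⟪ w ⟫
  ⟪⟫∈theSet (curve t) = inj₁ (t , λ _ → refl)
  ⟪⟫∈theSet (tangent t) = inj₂ (inj₁ (t , λ _ → refl))
  ⟪⟫∈theSet infinity = inj₂ (inj₂ λ _ → refl)

  theSet⇒Pt : ∀ v → theSet v → ∃ λ w → v ≋ ⟪ w ⟫
  theSet⇒Pt v (inj₁ (t , e)) = curve t , e
  theSet⇒Pt v (inj₂ (inj₁ (t , e))) = tangent t , e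
  theSet⇒Pt v (inj₂ (inj₂ e)) = infinity , e

  record Multiple (p : V5) : Set (ℓ₀ ⊔ ℓ) where
    constructor multiple
    field
      point : Pt
      factor : Carrier
      factor≉0 : factor ≉0
      p≈ : ∀ i → p i ≈ factor * ⟪ point ⟫ i

  ∈theSet⇒Multiple : ∀ {p} → p ∈ₚ theSet → Multiple p
  ∈theSet⇒Multiple {p} (v , v∈ , a , a≉0 , e) = multiple (proj₁ w) a a≉0 λ i → trans (e i) (*-congˡ (proj₂ w i))
    where w = theSet⇒Pt v v∈

  ⟪⟫-cong : ∀ w w′ → w ≐ w′ → ⟪ w ⟫ ≋ ⟪ w′ ⟫
  ⟪⟫-cong (curve s) (curve t) e = coordinatewise refl e (*-cong e e) (*-cong e (*-cong e e)) (*-cong e (*-cong e (*-cong e e)))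
  ⟪⟫-cong (tangent s) (tangent t) e = coordinatewise refl refl (*-congˡ e) (*-congˡ (*-cong e e)) (*-congˡ (*-cong e (*-cong e e)))
  ⟪⟫-cong infinity infinity e = λ _ → refl

  Multiple-distinct : ∀ {p p′} (m : Multiple p) (m′ : Multiple p′) → ¬ (p ∼ p′) → ¬ Multiple.point m ≐ Multiple.point m′
  Multiple-distinct {p} {p′} (multiple w a a≉0 e) (multiple w′ a′ a′≉0 e′) p≁p′ w≐w′ =
    p≁p′ (a * i , *-≉0 a≉0 i≉0 , λ k → begin
      p k ≈⟨ e k ⟩
      a * ⟪ w ⟫ k ≈⟨ *-congˡ (⟪⟫-cong w w′ w≐w′ k) ⟩
      a * ⟪ w′ ⟫ k ≈⟨ solve 2 (λ a w → a ⊗ w ⊜ a ⊗ κ 1 ⊗ w) refl a _ ⟩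
      a * 1# * ⟪ w′ ⟫ k ≈⟨ *-congʳ (*-congˡ a′i≈1) ⟨
      a * (a′ * i) * ⟪ w′ ⟫ k ≈⟨ solve 4 (λ a b i w → a ⊗ (b ⊗ i) ⊗ w ⊜ a ⊗ i ⊗ (b ⊗ w)) refl a a′ i _ ⟩
      a * i * (a′ * ⟪ w′ ⟫ k) ≈⟨ *-congˡ (e′ k) ⟨
      a * i * p′ k ∎)
    where
    i = proj₁ (inverse a′ a′≉0)
    a′i≈1 = proj₂ (inverse a′ a′≉0)
    i≉0 : i ≉0
    i≉0 z = 1≉0 (trans (sym a′i≈1) (trans (*-congˡ z) (zeroʳ a′)))

  module _ {p₁ p₂ p₃ p₄ : V5} (m₁ : Multiple p₁) (m₂ : Multiple p₂) (m₃ : Multiple p₃) (m₄ : Multiple p₄)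
    (n₁₂ : ¬ (p₁ ∼ p₂)) (n₁₃ : ¬ (p₁ ∼ p₃)) (n₁₄ : ¬ (p₁ ∼ p₄))
    (n₂₃ : ¬ (p₂ ∼ p₃)) (n₂₄ : ¬ (p₂ ∼ p₄)) (n₃₄ : ¬ (p₃ ∼ p₄)) where
    private
      module M₁ = Multiple m₁
      module M₂ = Multiple m₂
      module M₃ = Multiple m₃
      module M₄ = Multiple m₄

    multiples-independent : ∀ x₁ x₂ x₃ x₄ →
      IsZeroVec (λ i → x₁ * p₁ i + (x₂ * p₂ i + (x₃ * p₃ i + (x₄ * p₄ i + 0#)))) →
      (x₁ ≈ 0#) × (x₂ ≈ 0#) × (x₃ ≈ 0#) × (x₄ ≈ 0#)
    multiples-independent x₁ x₂ x₃ x₄ e = extract (independent L L-distinct ℕ.≤-refl L≈0)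
      where
      L : Weighted Pt
      L = (x₁ * M₁.factor , M₁.point) ∷ (x₂ * M₂.factor , M₂.point) ∷ (x₃ * M₃.factor , M₃.point) ∷ (x₄ * M₄.factor , M₄.point) ∷ []
      L-distinct : DistinctPts L
      L-distinct = (Multiple-distinct m₁ m₂ n₁₂ ∷ Multiple-distinct m₁ m₃ n₁₃ ∷ Multiple-distinct m₁ m₄ n₁₄ ∷ [])
        ∷ (Multiple-distinct m₂ m₃ n₂₃ ∷ Multiple-distinct m₂ m₄ n₂₄ ∷ []) ∷ (Multiple-distinct m₃ m₄ n₃₄ ∷ []) ∷ [] ∷ []
      weigh : ∀ {p} y (m : Multiple p) i → y * Multiple.factor m * ⟪ Multiple.point m ⟫ i ≈ y * p i
      weigh y m i = trans (*-assoc _ _ _) (*-congˡ (sym (Multiple.p≈ m i)))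
      L≈0 : IsZeroVec (combine-all L)
      L≈0 i = trans (+-cong (weigh x₁ m₁ i) (+-cong (weigh x₂ m₂ i) (+-cong (weigh x₃ m₃ i) (+-congʳ (weigh x₄ m₄ i))))) (e i)
      extract : Vanish L → (x₁ ≈ 0#) × (x₂ ≈ 0#) × (x₃ ≈ 0#) × (x₄ ≈ 0#)
      extract (z₁ ∷ z₂ ∷ z₃ ∷ z₄ ∷ []) = *-cancelʳ-0 M₁.factor≉0 z₁ , *-cancelʳ-0 M₂.factor≉0 z₂
        , *-cancelʳ-0 M₃.factor≉0 z₃ , *-cancelʳ-0 M₄.factor≉0 z₄

    -- The four points have coefficient rows of length three, so some nontrivial combination of the
    -- rows is zero; it would be a linear relation between the points.
    no-common-plane : ¬ OnCommonPlane p₁ p₂ p₃ p₄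
    no-common-plane (u , v , w , _ , (a₁ , b₁ , d₁ , e₁) , (a₂ , b₂ , d₂ , e₂) , (a₃ , b₃ , d₃ , e₃) , (a₄ , b₄ , d₄ , e₄)) =
      absurd (kernel 3 matrix)
      where
      matrix : Fin 4 → Fin 3 → Carrier
      matrix zero zero = a₁
      matrix zero (suc zero) = b₁
      matrix zero (suc (suc zero)) = d₁
      matrix (suc zero) zero = a₂
      matrix (suc zero) (suc zero) = b₂
      matrix (suc zero) (suc (suc zero)) = d₂
      matrix (suc (suc zero)) zero = a₃
      matrix (suc (suc zero)) (suc zero) = b₃
      matrix (suc (suc zero)) (suc (suc zero)) = d₃
      matrix (suc (suc (suc zero))) zero = a₄
      matrix (suc (suc (suc zero))) (suc zero) = b₄
      matrix (suc (suc (suc zero))) (suc (suc zero)) = d₄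
      regroup : ∀ x₁ x₂ x₃ x₄ u v w →
        x₁ * (a₁ * u + b₁ * v + d₁ * w) + (x₂ * (a₂ * u + b₂ * v + d₂ * w) + (x₃ * (a₃ * u + b₃ * v + d₃ * w) + (x₄ * (a₄ * u + b₄ * v + d₄ * w) + 0#)))
        ≈ (x₁ * a₁ + (x₂ * a₂ + (x₃ * a₃ + (x₄ * a₄ + 0#)))) * u + (x₁ * b₁ + (x₂ * b₂ + (x₃ * b₃ + (x₄ * b₄ + 0#)))) * v
          + (x₁ * d₁ + (x₂ * d₂ + (x₃ * d₃ + (x₄ * d₄ + 0#)))) * w
      regroup x₁ x₂ x₃ x₄ = solve 19 (λ x₁ x₂ x₃ x₄ a₁ a₂ a₃ a₄ b₁ b₂ b₃ b₄ d₁ d₂ d₃ d₄ u v w →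
        x₁ ⊗ (a₁ ⊗ u ⊕ b₁ ⊗ v ⊕ d₁ ⊗ w) ⊕ (x₂ ⊗ (a₂ ⊗ u ⊕ b₂ ⊗ v ⊕ d₂ ⊗ w) ⊕ (x₃ ⊗ (a₃ ⊗ u ⊕ b₃ ⊗ v ⊕ d₃ ⊗ w) ⊕ (x₄ ⊗ (a₄ ⊗ u ⊕ b₄ ⊗ v ⊕ d₄ ⊗ w) ⊕ κ 0)))
        ⊜ (x₁ ⊗ a₁ ⊕ (x₂ ⊗ a₂ ⊕ (x₃ ⊗ a₃ ⊕ (x₄ ⊗ a₄ ⊕ κ 0)))) ⊗ u ⊕ (x₁ ⊗ b₁ ⊕ (x₂ ⊗ b₂ ⊕ (x₃ ⊗ b₃ ⊕ (x₄ ⊗ b₄ ⊕ κ 0)))) ⊗ v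
          ⊕ (x₁ ⊗ d₁ ⊕ (x₂ ⊗ d₂ ⊕ (x₃ ⊗ d₃ ⊕ (x₄ ⊗ d₄ ⊕ κ 0)))) ⊗ w)
        refl x₁ x₂ x₃ x₄ a₁ a₂ a₃ a₄ b₁ b₂ b₃ b₄ d₁ d₂ d₃ d₄
      absurd : ¬ Dependent 4 3 matrix
      absurd (x , (i , x≉0) , relation) = none i x≉0
        where
        x₁ = x zero
        x₂ = x (suc zero)
        x₃ = x (suc (suc zero))
        x₄ = x (suc (suc (suc zero)))
        zeros = multiples-independent x₁ x₂ x₃ x₄ λ i → begin
          x₁ * p₁ i + (x₂ * p₂ i + (x₃ * p₃ i + (x₄ * p₄ i + 0#)))
            ≈⟨ +-cong (*-congˡ (e₁ i)) (+-cong (*-congˡ (e₂ i)) (+-cong (*-congˡ (e₃ i)) (+-congʳ (*-congˡ (e₄ i))))) ⟩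
          _ ≈⟨ regroup x₁ x₂ x₃ x₄ (u i) (v i) (w i) ⟩
          _ ≈⟨ +-cong (+-cong (*-congʳ (relation zero)) (*-congʳ (relation (suc zero)))) (*-congʳ (relation (suc (suc zero)))) ⟩
          0# * u i + 0# * v i + 0# * w i ≈⟨ solve 3 (λ u v w → κ 0 ⊗ u ⊕ κ 0 ⊗ v ⊕ κ 0 ⊗ w ⊜ κ 0) refl (u i) (v i) (w i) ⟩
          0# ∎
        none : ∀ i → ¬ x i ≉0
        none zero ne = ne (proj₁ zeros)
        none (suc zero) ne = ne (proj₁ (proj₂ zeros))
        none (suc (suc zero)) ne = ne (proj₁ (proj₂ (proj₂ zeros)))
        none (suc (suc (suc zero))) ne = ne (proj₂ (proj₂ (proj₂ zeros)))

  isTrack : IsTrack theSet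
  isTrack = (λ v v∈ z → ⟪⟫-nonzero (proj₁ (theSet⇒Pt v v∈)) λ i → trans (sym (proj₂ (theSet⇒Pt v v∈) i)) (z i)) ,
    λ p₁ p₂ p₃ p₄ i₁ i₂ i₃ i₄ → no-common-plane (∈theSet⇒Multiple i₁) (∈theSet⇒Multiple i₂) (∈theSet⇒Multiple i₃) (∈theSet⇒Multiple i₄)

  ⟪⟫∈ₚtheSet : ∀ w → ⟪ w ⟫ ∈ₚ theSet
  ⟪⟫∈ₚtheSet w = ⟪ w ⟫ , ⟪⟫∈theSet w , 1# , 1≉0 , λ i → sym (*-identityˡ _)

  ∼? : ∀ v w → Dec (v ∼ w)
  ∼? v w = ∃? (λ e (a≉0 , v≈) → ≉0-resp e a≉0 , λ i → trans (v≈ i) (*-congʳ e))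
    (λ a → ¬? (a ≟ 0#) ×-dec Fin.all? (λ i → v i ≟ a * w i))

  ⟪⟫-apart : ∀ {w w′} → ¬ w ≐ w′ → ¬ (⟪ w ⟫ ∼ ⟪ w′ ⟫)
  ⟪⟫-apart {w} {w′} w≠w′ (a , _ , e) = absurd (independent ((1# , w) ∷ (- a , w′) ∷ []) ((w≠w′ ∷ []) ∷ [] ∷ []) (ℕ.s≤s (ℕ.s≤s ℕ.z≤n))
      λ i → trans (+-congʳ (*-congˡ (e i))) (solve 2 (λ a x → κ 1 ⊗ (a ⊗ x) ⊕ (⊝ a ⊗ x ⊕ κ 0) ⊜ κ 0) refl a _))
    where
    absurd : ¬ Vanish ((1# , w) ∷ (- a , w′) ∷ [])
    absurd (z ∷ _) = 1≉0 z

  spanned-coplanar : ∀ {p} (s : Spanned p) → OnCommonPlane p ⟪ Spanned.w₁ s ⟫ ⟪ Spanned.w₂ s ⟫ ⟪ Spanned.w₃ s ⟫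
  spanned-coplanar (spanned {w₁} {w₂} {w₃} n₁₂ n₁₃ n₂₃ α β γ e) = ⟪ w₁ ⟫ , ⟪ w₂ ⟫ , ⟪ w₃ ⟫ , linIndep , (α , β , γ , e)
    , (1# , 0# , 0# , λ i → solve 3 (λ x y z → x ⊜ κ 1 ⊗ x ⊕ κ 0 ⊗ y ⊕ κ 0 ⊗ z) refl _ _ _)
    , (0# , 1# , 0# , λ i → solve 3 (λ x y z → y ⊜ κ 0 ⊗ x ⊕ κ 1 ⊗ y ⊕ κ 0 ⊗ z) refl _ _ _)
    , (0# , 0# , 1# , λ i → solve 3 (λ x y z → z ⊜ κ 0 ⊗ x ⊕ κ 0 ⊗ y ⊕ κ 1 ⊗ z) refl _ _ _)
    where
    linIndep : LinIndep3 ⟪ w₁ ⟫ ⟪ w₂ ⟫ ⟪ w₃ ⟫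
    linIndep a b d z = extract (independent ((a , w₁) ∷ (b , w₂) ∷ (d , w₃) ∷ []) ((n₁₂ ∷ n₁₃ ∷ []) ∷ (n₂₃ ∷ []) ∷ [] ∷ [])
        (ℕ.n≤1+n 3) λ i → trans (solve 3 (λ x y z → x ⊕ (y ⊕ (z ⊕ κ 0)) ⊜ x ⊕ y ⊕ z) refl _ _ _) (z i))
      where
      extract : Vanish ((a , w₁) ∷ (b , w₂) ∷ (d , w₃) ∷ []) → (a ≈ 0#) × (b ≈ 0#) × (d ≈ 0#)
      extract (x ∷ y ∷ z ∷ []) = x , y , z

  complete : ∀ (T : PointSet (ℓ₀ ⊔ ℓ)) → IsTrack T → theSet ⊆ₚ T → T ⊆ₚ theSet
  complete T (_ , T-track) S⊆T p p≉0 p∈T = onCovered (covered-all p p≉0)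
    where
    -- If `p` is none of the three spanning points, it forms with them four distinct coplanar points
    -- of the larger track.
    onSpanned : (s : Spanned p) → Dec (p ∼ ⟪ Spanned.w₁ s ⟫) → Dec (p ∼ ⟪ Spanned.w₂ s ⟫) → Dec (p ∼ ⟪ Spanned.w₃ s ⟫) → p ∈ₚ theSet
    onSpanned s (yes p∼) _ _ = _ , ⟪⟫∈theSet (Spanned.w₁ s) , p∼
    onSpanned s _ (yes p∼) _ = _ , ⟪⟫∈theSet (Spanned.w₂ s) , p∼
    onSpanned s _ _ (yes p∼) = _ , ⟪⟫∈theSet (Spanned.w₃ s) , p∼
    onSpanned s (no n₁) (no n₂) (no n₃) = ⊥-elim (T-track p ⟪ w₁ ⟫ ⟪ w₂ ⟫ ⟪ w₃ ⟫ p∈T (inT w₁) (inT w₂) (inT w₃)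
        n₁ n₂ n₃ (⟪⟫-apart {w₁} {w₂} (Spanned.w₁≠w₂ s)) (⟪⟫-apart {w₁} {w₃} (Spanned.w₁≠w₃ s)) (⟪⟫-apart {w₂} {w₃} (Spanned.w₂≠w₃ s)) (spanned-coplanar s))
      where
      open Spanned s using (w₁; w₂; w₃)
      inT : ∀ w → ⟪ w ⟫ ∈ₚ T
      inT w = S⊆T ⟪ w ⟫ (⟪⟫-nonzero w) (⟪⟫∈ₚtheSet w)
    onCovered : Covered p → p ∈ₚ theSet
    onCovered (inj₁ (w , a , a≉0 , e)) = ⟪ w ⟫ , ⟪⟫∈theSet w , a , a≉0 , e
    onCovered (inj₂ s) = onSpanned s (∼? p ⟪ Spanned.w₁ s ⟫) (∼? p ⟪ Spanned.w₂ s ⟫) (∼? p ⟪ Spanned.w₃ s ⟫)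

theorem2p5 : ∀ {c ℓ : Level} (F : Field c ℓ) (q : ℕ) → IsPrimePower q → q ≥ 89 →
    HasCardinality F q → ¬ ThreeIsSquare F →
    Projective.IsCompleteTrack F (Projective.theSet F)
theorem2p5 F q _ 89≤q card 3-nonsquare = isTrack , complete
  where open CompleteTrack F q card 89≤q 3-nonsquare
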